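{- Let $n\ge 2$ be an integer and let $q$ be a prime power such that $q\ge 3$ if $n=2$. Let $T$ be an $n$-vertex bypass transition graph. Then the graph $G(n,q,T)$ is Hamilton connected.
   Context: $GL(n,q)$ is the group of invertible $n\times n$ matrices over the finite field $\mathbb{F}_q$, and $[n]=\{1,\dots,n\}$. Fix a generator $\alpha$ of the multiplicative group of $\mathbb{F}_q$. A transition graph is a directed graph $T$ (without loops) on the vertex set $[n]$, with edge set $E(T)$. A transition graph $T$ on $[n]$ is a bypass transition graph if either $n=1$, or $n\ge 2$ and (i) there exist an edge $(i,n)$ and an edge $(n,j)$ of $T$ for some $i,j\in[n-1]$, and (ii) the graph $T-n$ obtained by removing the vertex $n$ from $T$ is a bypass transition graph on $[n-1]$. For distinct $x,y\in[n]$ let $A_{xy}$ be the $n\times n$ matrix with entry $1$ at position $(i,j)$ if $i=j$ or ($i=y$ and $j=x$), and $0$ elsewhere (left multiplication by $A_{xy}$ adds row $x$ to row $y$). For $x\in[n]$ let $M_x$ be the diagonal matrix with $\alpha$ at position $(x,x)$ and $1$ at the other diagonal positions. Define $\mathrm{ops}(T)=\{A_{ij},A_{ij}^{ -1}:(i,j)\in E(T)\}\cup\{M_i,M_i^{ -1}:i\in[n]\}$ if $q>2$, and $\mathrm{ops}(T)=\{A_{ij},A_{ij}^{ -1}:(i,j)\in E(T)\}$ if $q=2$. $G(n,q,T)$ is the undirected simple graph with vertex set $GL(n,q)$ and edges $\{X,SX\}$ for $X\in GL(n,q)$, $S\in\mathrm{ops}(T)$ (the Cayley graph with generators acting on the left).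 A graph is Hamilton connected if for any two distinct vertices there is a Hamilton path between them. -}

module Defs where

open import Algebra.Bundles using (CommutativeRing; Semiring)
open import Algebra.Definitions using (Invertible)
import Algebra.Definitions.RawSemiring as RawSemiringDefs
open import Data.Bool.Base using (_∨_; _∧_; if_then_else_)
open import Data.Empty using (⊥)
open import Data.Fin.Base using (Fin; inject₁; fromℕ)
open import Data.Fin.Properties using (_≟_; inject₁-injective)
open import Data.List.Base using (List; head; last)
import Data.List.Membership.Setoid as Membership
open import Data.List.Relation.Unary.Linked using (Linked)
import Data.List.Relation.Unary.Unique.Setoid as UniqueSetoid
open import Data.Maybe.Base using (just)
open import Data.Nat.Base using (ℕ; zero; suc; _≤_; _<_; _^_)
open import Data.Nat.Primality using (Prime)
open import Data.Product.Base using (∃; ∃-syntax; ∃₂; _×_; _,_)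
open import Data.Unit.Base using (⊤)
open import Data.Vec.Functional using (Vector)
import Data.Vec.Functional.Relation.Binary.Equality.Setoid as VecEq
open import Function.Base using (_∘_; _on_)
open import Function.Bundles using (Inverse)
open import Level using (Level; _⊔_; 0ℓ) renaming (suc to lsuc)
open import Relation.Binary.Bundles using (Setoid)
import Relation.Binary.Construct.On as On
open import Relation.Binary.Construct.Closure.Symmetric
  using (SymClosure; fwd; bwd; symmetric)
open import Relation.Binary.Core using (Rel)
open import Relation.Binary.Definitions
  using (Irreflexive; Symmetric; _Respects₂_)
open import Relation.Binary.PropositionalEquality.Core using (_≡_; cong)
open import Relation.Binary.PropositionalEquality.Properties using (setoid)
open import Relation.Nullary.Decidable.Core using (⌊_⌋)

private
  variable
    c ℓ ℓ′ : Level

------------------------------------------------------------------------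
-- Simple graphs and Hamilton connectivity

record SimpleGraph (c ℓ ℓ′ : Level) : Set (lsuc (c ⊔ ℓ ⊔ ℓ′)) where
  field
    vertices : Setoid c ℓ

  open Setoid vertices public
    using () renaming (Carrier to Vertex; _≈_ to _≈ᵥ_; _≉_ to _≉ᵥ_)

  field
    Adj        : Rel Vertex ℓ′
    Adj-resp   : Adj Respects₂ _≈ᵥ_
    Adj-sym    : Symmetric Adj
    Adj-irrefl : Irreflexive _≈ᵥ_ Adj

module _ (G : SimpleGraph c ℓ ℓ′) where
  open SimpleGraph G
  open Membership vertices using (_∈_)
  open UniqueSetoid vertices using (Unique)

  record HamiltonPath (x y : Vertex) : Set (c ⊔ ℓ ⊔ ℓ′) where
    field
      path      : List Vertex
      start     : head path ≡ just x
      end       : last path ≡ just y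
      adjacent  : Linked Adj path
      distinct  : Unique path
      spanning  : ∀ v → v ∈ path

  HamiltonConnected : Set (c ⊔ ℓ ⊔ ℓ′)
  HamiltonConnected = ∀ x y → x ≉ᵥ y → HamiltonPath x y

------------------------------------------------------------------------
-- Transition graphs

record TransitionGraph (n : ℕ) : Set₁ where
  field
    Edge    : Rel (Fin n) 0ℓ
    no-loop : Irreflexive _≡_ Edge

deleteLast : ∀ {n} → TransitionGraph (suc n) → TransitionGraph n
deleteLast T = record
  { Edge    = Edge on inject₁
  ; no-loop = λ i≡j → no-loop (cong inject₁ i≡j)
  } where open TransitionGraph T

-- The vertices 1, …, n are represented by Fin n, with n as fromℕ (n ∸ 1) and
-- [n-1] as the image of inject₁.
IsBypass : ∀ {n} → TransitionGraph n → Set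
IsBypass {zero}        T = ⊥
IsBypass {suc zero}    T = ⊤
IsBypass {suc (suc n)} T =
  (∃[ i ] Edge (inject₁ i) (fromℕ (suc n))) ×
  (∃[ j ] Edge (fromℕ (suc n)) (inject₁ j)) ×
  IsBypass (deleteLast T)
  where open TransitionGraph T

------------------------------------------------------------------------
-- Finite fields

IsPrimePower : ℕ → Set
IsPrimePower q = ∃₂ λ p k → Prime p × 1 ≤ k × q ≡ p ^ k

record FiniteField (c ℓ : Level) (q : ℕ) : Set (lsuc (c ⊔ ℓ)) where
  field
    commutativeRing : CommutativeRing c ℓ

  open CommutativeRing commutativeRing public renaming (setoid to ≈-setoid)

  field
    1≉0         : 1# ≉ 0#
    invertible  : ∀ x → x ≉ 0# → Invertible _≈_ 1# _*_ x
    cardinality : Inverse (setoid (Fin q)) ≈-setoid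

module _ {q : ℕ} (F : FiniteField c ℓ q) where
  open FiniteField F
  open RawSemiringDefs (Semiring.rawSemiring semiring) using (sum) renaming (_^_ to _^ᶠ_)

  -- The multiplicative group is finite, so nonnegative powers suffice.
  -- For q = 2, the condition α ≉ 0# is not implied by the other one.
  IsGenerator : Carrier → Set (c ⊔ ℓ)
  IsGenerator α = α ≉ 0# × (∀ x → x ≉ 0# → ∃[ k ] x ≈ α ^ᶠ k)

  ----------------------------------------------------------------------
  -- Matrices

  Matrix : ℕ → Set c
  Matrix n = Vector (Vector Carrier n) n

  matrixSetoid : ℕ → Setoid c ℓ
  matrixSetoid n = VecEq.≋-setoid (VecEq.≋-setoid ≈-setoid n) n

  module _ {n : ℕ} where
    open Setoid (matrixSetoid n) using () renaming (_≈_ to _≋_)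

    infixl 7 _·_
    _·_ : Matrix n → Matrix n → Matrix n
    (X · Y) i j = sum λ k → X i k * Y k j

    I : Matrix n
    I i j = if ⌊ i ≟ j ⌋ then 1# else 0#

    A : Fin n → Fin n → Matrix n
    A x y i j = if ⌊ i ≟ j ⌋ ∨ (⌊ i ≟ y ⌋ ∧ ⌊ j ≟ x ⌋) then 1# else 0#

    M : Carrier → Fin n → Matrix n
    M α x i j = if ⌊ i ≟ j ⌋ then (if ⌊ i ≟ x ⌋ then α else 1#) else 0#

    IsInverseOf : Rel (Matrix n) ℓ
    IsInverseOf Y X = (Y · X) ≋ I × (X · Y) ≋ I

    ·-congˡ : ∀ S {X Y} → X ≋ Y → (S · X) ≋ (S · Y)
    ·-congˡ S {X} {Y} X≋Y i j = sum-cong λ k → *-congˡ (X≋Y k j)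
      where
      open import Algebra.Properties.Monoid.Sum +-monoid
        using () renaming (sum-cong-≋ to sum-cong)

  record GL (n : ℕ) : Set (c ⊔ ℓ) where
    constructor mkGL
    field
      matrix       : Matrix n
      isInvertible : Invertible (Setoid._≈_ (matrixSetoid n)) I _·_ matrix

  open GL using (matrix)

  GL-setoid : ℕ → Setoid (c ⊔ ℓ) ℓ
  GL-setoid n = On.setoid (matrixSetoid n) (matrix {n})

  ----------------------------------------------------------------------
  -- The graph G(n,q,T)

  module _ {n : ℕ} (α : Carrier) (T : TransitionGraph n) where
    open TransitionGraph T
    private
      module S = Setoid (GL-setoid n)
      open Setoid (matrixSetoid n) using ()
        renaming (_≈_ to _≋_; trans to ≋-trans; sym to ≋-sym)

    data Ops : Matrix n → Set (c ⊔ ℓ) where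
      add    : ∀ {x y} → Edge x y → Ops (A x y)
      add⁻¹  : ∀ {x y S} → Edge x y → IsInverseOf S (A x y) → Ops S
      mult   : ∀ x → 2 < q → Ops (M α x)
      mult⁻¹ : ∀ x {S} → 2 < q → IsInverseOf S (M α x) → Ops S

    Step : Rel (GL n) (c ⊔ ℓ)
    Step X Y = ∃[ S ] Ops S × matrix Y ≋ (S · matrix X)

    cayleyGraph : SimpleGraph (c ⊔ ℓ) ℓ (c ⊔ ℓ)
    cayleyGraph = record
      { vertices   = GL-setoid n
      ; Adj        = Adj
      ; Adj-resp   = respʳ , λ Y≈Z → sym′ ∘ respʳ Y≈Z ∘ sym′
      ; Adj-sym    = sym′
      ; Adj-irrefl = λ X≈Y (X≉Y , _) → X≉Y X≈Y
      }
      where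
      Adj : Rel (GL n) (c ⊔ ℓ)
      Adj X Y = X S.≉ Y × SymClosure Step X Y

      sym′ : Symmetric Adj
      sym′ {X} {Y} (X≉Y , s) =
        (λ Y≈X → X≉Y (S.sym {Y} {X} Y≈X)) , symmetric Step s

      respʳ : ∀ {X Y Z} → Y S.≈ Z → Adj X Y → Adj X Z
      respʳ {X} {Y} {Z} Y≈Z (X≉Y , s) =
        (λ X≈Z → X≉Y (S.trans {X} {Z} {Y} X≈Z (S.sym {Y} {Z} Y≈Z))) , go s
        where
        go : SymClosure Step X Y → SymClosure Step X Z
        go (fwd (S , S∈ , Y≋SX)) = fwd (S , S∈ , ≋-trans (≋-sym Y≈Z) Y≋SX)
        go (bwd (S , S∈ , X≋SY)) = bwd (S , S∈ , ≋-trans X≋SY (·-congˡ S Y≈Z))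

{-# OPTIONS --safe #-}

-- GL(n) is exhausted along GL(n-1) ⊂ GL(n-1) × GL(1) ⊂ Stab ⊂ GL(n), where Stab
-- is the stabiliser of the line of the last unit vector. Right translations are
-- automorphisms of the graph, so a subgroup H and its cosets carry isomorphic
-- graphs. In the last two steps the larger group is H ∪ H t⁻¹ H for a single
-- generator t; hence any two cosets are joined by edges, even by three disjoint
-- ones, and Hamilton paths of the cosets may be concatenated in any order, while
-- the second group is a cycle of cosets of the first. For n = 2 the group Stab is
-- the union of the translates T u_s of the torus T of diagonal matrices, a grid
-- that wraps around; a walk passes through them in the order s = v, γ v, γ² v, …
-- When q is odd the parity of the torus coordinates restricts the ends inside
-- each T u_s, so γ is chosen to make γ and γ - 1 odd and the order of the visits
-- depends on the end vertex; when q is even T is not bipartite, and the passage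
-- from T to Stab is again by double cosets. The case n = 3, q = 2 is finite.

module Submission where

open import Algebra.Bundles using (Group; CommutativeRing; Semiring)
open import Algebra.Bundles.Raw using (RawRing)
import Algebra.Properties.AbelianGroup as AbelianGroupProperties
import Algebra.Properties.CommutativeSemigroup as CommutativeSemigroupProperties
import Algebra.Properties.Group as GroupProperties
import Algebra.Properties.Ring as RingProperties
import Algebra.Properties.Semiring.Exp as Exp
import Algebra.Properties.Semiring.Mult as Mult
import Algebra.Properties.Semiring.Sum as SemiringSum
import Algebra.Solver.Ring as RingSolver
open import Algebra.Solver.Ring.AlmostCommutativeRing using (fromCommutativeRing; _-Raw-AlmostCommutative⟶_; Induced-equivalence)
open import Data.Bool.Base using (Bool; true; false; not; _xor_; if_then_else_)
import Data.Bool.Properties as Bool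
open import Data.Empty using (⊥-elim; ⊥)
open import Data.Fin.Base using (Fin; zero; suc; inject₁; fromℕ)
open import Data.Fin.Patterns using (0F; 1F; 2F)
import Data.Fin.Properties as Fin
open import Data.Fin.Relation.Unary.Top using (View; ‵fromℕ; ‵inj₁; view; view-fromℕ; view-inject₁)
open import Data.List.Base as List using (List; []; _∷_; _++_; map; reverse; [_]; concat; concatMap; _∷ʳ_; filter; deduplicate; head; last)
import Data.List.Membership.DecPropositional as DecMembership
import Data.List.Membership.Propositional as Membershipₚ
import Data.List.Membership.Setoid as Mem
import Data.List.Membership.Setoid.Properties as MemP
open import Data.List.Properties using (unfold-reverse; ++-assoc; ++-identityʳ; concatMap-++)
import Data.List.Relation.Binary.Permutation.Setoid as Perm
import Data.List.Relation.Binary.Permutation.Setoid.Properties as PermP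
open import Data.List.Relation.Binary.Pointwise using (Pointwise; []; _∷_)
open import Data.List.Relation.Unary.All as All using (All; []; _∷_)
import Data.List.Relation.Unary.All.Properties as AllP
open import Data.List.Relation.Unary.AllPairs as AllPairs using (AllPairs; []; _∷_)
import Data.List.Relation.Unary.AllPairs.Properties as AllPairsP
open import Data.List.Relation.Unary.Any as Any using (Any; here; there)
import Data.List.Relation.Unary.Any.Properties as AnyP
open import Data.List.Relation.Unary.Linked as Linked using (Linked; []; [-]; _∷_)
import Data.List.Relation.Unary.Linked.Properties as LinkedP
import Data.List.Relation.Unary.Unique.DecPropositional as DecUnique
import Data.List.Relation.Unary.Unique.DecSetoid.Properties as DecUniqP
import Data.List.Relation.Unary.Unique.Propositional as Uniqueₚ
import Data.List.Relation.Unary.Unique.Setoid as Uniq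
import Data.List.Relation.Unary.Unique.Setoid.Properties as UniqP
open import Data.Maybe.Base using (just; nothing)
open import Data.Nat.Base as ℕ using (ℕ; zero; suc; _<_; z≤n; s≤s; z<s; s<s; _≤_)
open import Data.Nat.DivMod using (_%_; _/_; m%n<n; m≡m%n+[m/n]*n; _mod_; [m+kn]%n≡m%n; m<n⇒m%n≡m)
import Data.Nat.Properties as ℕ
open import Data.Product.Base as Prod using (∃; ∃₂; ∃-syntax; _×_; _,_; proj₁; proj₂)
open import Data.Sum.Base as Sum using (_⊎_; inj₁; inj₂; [_,_]′)
open import Data.Unit.Polymorphic.Base using (⊤; tt)
open import Data.Vec.Base as Vec using (Vec; lookup; []; _∷_; updateAt; zipWith; tabulate)
import Data.Vec.Properties as Vec
open import Defs
open import Function.Base using (_∘_)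
open import Function.Bundles using (Inverse)
open import Level using (Level; _⊔_) renaming (suc to lsuc)
open import Relation.Binary.Bundles using (Setoid; DecSetoid)
open import Relation.Binary.Construct.Closure.Symmetric using (SymClosure; fwd; bwd)
open import Relation.Binary.Core using (Rel)
open import Relation.Binary.Definitions using (Decidable; DecidableEquality; WeaklyDecidable; tri<; tri≈; tri>)
open import Relation.Binary.PropositionalEquality as ≡ using (_≡_; refl; cong; subst; _≢_)
import Relation.Binary.Reasoning.Setoid as SetoidReasoning
import Relation.Binary.Reflection as Reflection
open import Relation.Nullary using (¬_; Dec; yes; no)
open import Relation.Nullary.Decidable using (¬?; _×-dec_; ⌊_⌋; map′; _→-dec_; toSum; _⊎-dec_; from-yes)
open import Relation.Unary as Unary using (Pred)

-- An edge between consecutive cosets has to avoid the first vertex prescribed in one and the last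
-- vertex prescribed in the other; each rules out at most one of three disjoint edges. Such edges
-- come from elements of H ∩ t⁻¹Ht. For H = GL(2,2) × GL(1) and the edge t that leads to the
-- stabiliser this intersection has order two, and the graph of GL(2,2) is a hexagon; hence q = 2
-- starts at n = 3.
--
-- For odd q colour the vertices of a torus by the parity of i + j; its Hamilton paths join opposite
-- colours. A step by u_1 leads from T u_s to T u_t at (i, j) only if t - s is, up to sign, a power
-- of the generator whose exponent has the parity of i + j. So logarithms of differences dictate the
-- colours at which tori are joined. Along a geometric progression the differences are (γ - 1) γᵏ s;
-- for odd γ their parities alternate, as the traversals demand, and γ - 1 odd makes the passage
-- from T to the first term fit. Ends of the wrong colour are reached by visiting a torus in two
-- parts.

module SetoidLists {c ℓ} (V : Setoid c ℓ) where

  open Setoid V renaming (Carrier to C; refl to ≈-refl; sym to ≈-sym; trans to ≈-trans)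
  open Perm V using (_↭_; ↭-refl; ↭-sym; ↭-trans)
  open PermP V using (∈-resp-↭; shift)
  open Mem V using (_∈_)
  open Uniq V using (Unique)

  -- Walks are compared as multisets; for duplicate-free lists this reduces the comparison to
  -- equality of the underlying sets, with no counting.
  unique-↭ : ∀ {l l′} → Unique l → Unique l′ → (∀ {v} → v ∈ l → v ∈ l′) →
    (∀ {v} → v ∈ l′ → v ∈ l) → l ↭ l′
  unique-↭ {[]} {[]}     _ _ _ _ = ↭-refl
  unique-↭ {[]} {x ∷ l′} _ _ _ g with () ← g (here ≈-refl)
  unique-↭ {x ∷ l} {l′} (x∉l ∷ ul) ul′ f g with MemP.∈-∃++ V (f (here ≈-refl))
  ... | ys , zs , w , x≈w , eq = ↭-trans
        (Perm.prep x≈w (unique-↭ ul uys (λ i → toʳ i (∈-resp-↭ l′↭ (f (there i))))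
          (λ i → toˡ i (g (∈-resp-↭ (↭-sym l′↭) (there i))))))
        (↭-sym l′↭)
    where
    l′↭ : l′ ↭ w ∷ ys ++ zs
    l′↭ = ↭-trans (Perm.↭-reflexive-≋ V eq) (shift ≈-refl ys zs)
    tail : ∀ {x l} → Unique (x ∷ l) → Unique l
    tail (_ ∷ u) = u
    uw = PermP.Unique-resp-↭ V l′↭ ul′
    uys = tail uw
    toʳ : ∀ {v} → v ∈ l → v ∈ w ∷ ys ++ zs → v ∈ ys ++ zs
    toʳ i (here v≈w) = ⊥-elim (MemP.All[≉]⇒∉ V x∉l (MemP.∈-resp-≈ V (≈-trans v≈w (≈-sym x≈w)) i))
    toʳ i (there j)  = j
    toˡ : ∀ {v} → v ∈ ys ++ zs → v ∈ x ∷ l → v ∈ l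
    toˡ i (here v≈x) = ⊥-elim (UniqP.Unique[x∷xs]⇒x∉xs V uw (MemP.∈-resp-≈ V (≈-trans v≈x x≈w) i))
    toˡ i (there j)  = j

-- Graphs and walks over setoids

record Graph (c ℓ r : Level) : Set (lsuc (c ⊔ ℓ ⊔ r)) where
  field
    vertices : Setoid c ℓ
  open Setoid vertices using (_≈_) renaming (Carrier to C)
  field
    Adj      : Rel C r
    adj-resp : ∀ {x x′ y y′} → x ≈ x′ → y ≈ y′ → Adj x y → Adj x′ y′
    adj-sym  : ∀ {x y} → Adj x y → Adj y x

-- A walk visits the listed vertices; its two ends are only recorded up to ≈.
module Walks {c ℓ r} (Γ : Graph c ℓ r) where

  open Graph Γ renaming (vertices to V)
  open Setoid V renaming (Carrier to C; refl to ≈-refl; sym to ≈-sym; trans to ≈-trans)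
  open Perm V using (_↭_; ↭-refl; ↭-trans)
  open PermP V using (++⁺; ↭-reverse)
  open Mem V using (_∈_)

  open SetoidLists V public using (unique-↭)

  data Walk : C → C → List C → Set (c ⊔ ℓ ⊔ r) where
    stop : ∀ {x u y} → x ≈ u → u ≈ y → Walk x y [ u ]
    step : ∀ {x u z y l} → x ≈ u → Adj u z → Walk z y l → Walk x y (u ∷ l)

  walk-resp : ∀ {x x′ y y′ l} → x ≈ x′ → y ≈ y′ → Walk x y l → Walk x′ y′ l
  walk-resp p q (stop a b)   = stop (≈-trans (≈-sym p) a) (≈-trans b q)
  walk-resp p q (step a e w) = step (≈-trans (≈-sym p) a) e (walk-resp ≈-refl q w)

  walk-++ : ∀ {x a b y l l′} → Walk x a l → Adj a b → Walk b y l′ → Walk x y (l ++ l′)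
  walk-++ (stop p q)   e w′ = step p (adj-resp (≈-sym q) ≈-refl e) w′
  walk-++ (step p d w) e w′ = step p d (walk-++ w e w′)

  walk-reverse : ∀ {x y l} → Walk x y l → Walk y x (reverse l)
  walk-reverse (stop p q) = stop (≈-sym q) (≈-sym p)
  walk-reverse {y = y} (step {u = u} {l = l} p e w) =
    subst (Walk y _) (≡.sym (unfold-reverse u l))
      (walk-++ (walk-reverse w) (adj-sym e) (stop ≈-refl (≈-sym p)))

  walk-head : ∀ {x y l} → Walk x y l → x ∈ l
  walk-head (stop p _)   = here p
  walk-head (step p _ _) = here p

  walk-last : ∀ {x y l} → Walk x y l → y ∈ l
  walk-last (stop _ q)   = here (≈-sym q)
  walk-last (step _ _ w) = there (walk-last w)

  -- Adjacent vertices in different classes split any walk that meets two classes.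
  walk-split : ∀ {q} {_~_ : Rel C q} → (∀ {u v w} → u ~ v → v ~ w → u ~ w) →
    (∀ {u v} → u ~ v → v ~ u) → (∀ {u v} → u ≈ v → u ~ v) → Decidable _~_ →
    ∀ {x y l} → Walk x y l →
    (∀ {v} → v ∈ l → x ~ v) ⊎
    (∃₂ λ a b → ∃₂ λ l₁ l₂ → (¬ a ~ b) × Walk x a l₁ × Walk b y l₂ × l ≡ l₁ ++ l₂)
  walk-split tr sy re _~?_ (stop p q) = inj₁ λ { (here v≈u) → re (≈-trans p (≈-sym v≈u)) }
  walk-split {_~_ = _~_} tr sy re _~?_ (step {x = x} {u} {z} p e w) with u ~? z
  ... | no  u≁z = inj₂ (u , z , [ u ] , _ , u≁z , stop p ≈-refl , w , refl)
  ... | yes u~z with walk-split tr sy re _~?_ w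
  ...   | inj₂ (a , b , l₁ , l₂ , a≁b , w₁ , w₂ , refl) =
          inj₂ (a , b , u ∷ l₁ , l₂ , a≁b , step p e w₁ , w₂ , refl)
  ...   | inj₁ same = inj₁ λ
          { (here v≈u) → re (≈-trans p (≈-sym v≈u))
          ; (there i)  → tr (tr (re p) u~z) (same i) }

  -- Path l x y: some arrangement of the multiset l is a walk from x to y.
  Path : List C → C → C → Set (c ⊔ ℓ ⊔ r)
  Path l x y = ∃[ p ] Walk x y p × p ↭ l

  path-resp : ∀ {x x′ y y′ l} → x ≈ x′ → y ≈ y′ → Path l x y → Path l x′ y′
  path-resp p q (l , w , e) = l , walk-resp p q w , e

  path-↭ : ∀ {x y l l′} → l ↭ l′ → Path l x y → Path l′ x y
  path-↭ e (p , w , f) = p , w , ↭-trans f e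

  path-++ : ∀ {x a b y l l′} → Path l x a → Adj a b → Path l′ b y → Path (l ++ l′) x y
  path-++ (p , w , f) e (p′ , w′ , f′) = p ++ p′ , walk-++ w e w′ , ++⁺ f f′

  path-reverse : ∀ {x y l} → Path l x y → Path l y x
  path-reverse (p , w , f) = reverse p , walk-reverse w , ↭-trans (↭-reverse p) f

  path-[] : ∀ {x y} → x ≈ y → Path [ x ] x y
  path-[] p = _ , stop ≈-refl p , ↭-refl

  path-∷ : ∀ {x z y l} → Adj x z → Path l z y → Path (x ∷ l) x y
  path-∷ e w = path-++ (path-[] ≈-refl) e w

module WalkMap {c ℓ r c′ ℓ′ r′} (Γ : Graph c ℓ r) (Γ′ : Graph c′ ℓ′ r′)
  (f : Setoid.Carrier (Graph.vertices Γ) → Setoid.Carrier (Graph.vertices Γ′))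
  (f-cong : ∀ {x y} → Setoid._≈_ (Graph.vertices Γ) x y → Setoid._≈_ (Graph.vertices Γ′) (f x) (f y))
  (f-adj : ∀ {x y} → Graph.Adj Γ x y → Graph.Adj Γ′ (f x) (f y)) where

  private
    module G = Walks Γ
    module G′ = Walks Γ′

  walk-map : ∀ {x y l} → G.Walk x y l → G′.Walk (f x) (f y) (map f l)
  walk-map (G.stop p q)   = G′.stop (f-cong p) (f-cong q)
  walk-map (G.step p e w) = G′.step (f-cong p) (f-adj e) (walk-map w)

  path-map : ∀ {x y l} → G.Path l x y → G′.Path (map f l) (f x) (f y)
  path-map (p , w , e) = map f p , walk-map w , PermP.map⁺ (Graph.vertices Γ) (Graph.vertices Γ′) f-cong e

-- Decides equations in free groups by comparing reduced words.
module GroupSolver {c ℓ} (G : Group c ℓ) where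

  open Group G renaming (refl to ≈-refl; sym to ≈-sym; trans to ≈-trans)
  open GroupProperties G

  infixl 7 _⊕_
  infix 8 _⊖

  data Expr (n : ℕ) : Set where
    var : Fin n → Expr n
    ∅   : Expr n
    _⊕_ : Expr n → Expr n → Expr n
    _⊖  : Expr n → Expr n

  Env : ℕ → Set c
  Env = Vec Carrier

  Word : ℕ → Set
  Word n = List (Bool × Fin n)

  ⟦_⟧ : ∀ {n} → Expr n → Env n → Carrier
  ⟦ var i ⟧ ρ = lookup ρ i
  ⟦ ∅ ⟧     ρ = ε
  ⟦ a ⊕ b ⟧ ρ = ⟦ a ⟧ ρ ∙ ⟦ b ⟧ ρ
  ⟦ a ⊖ ⟧   ρ = ⟦ a ⟧ ρ ⁻¹

  letter : ∀ {n} → Env n → Bool × Fin n → Carrier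
  letter ρ (true  , i) = lookup ρ i
  letter ρ (false , i) = lookup ρ i ⁻¹

  word : ∀ {n} → Env n → Word n → Carrier
  word ρ []      = ε
  word ρ (a ∷ w) = letter ρ a ∙ word ρ w

  letters : ∀ {n} → Bool → Expr n → Word n → Word n
  cons : ∀ {n} → Bool × Fin n → Word n → Word n

  letters b (var i)     w = cons (b , i) w
  letters b ∅           w = w
  letters true  (x ⊕ y) w = letters true x (letters true y w)
  letters false (x ⊕ y) w = letters false y (letters false x w)
  letters b (x ⊖)       w = letters (not b) x w

  cons a [] = a ∷ []
  cons (b , i) ((b′ , i′) ∷ w) with b Bool.≟ not b′ | i Fin.≟ i′
  ... | yes _ | yes _ = w
  ... | _     | _     = (b , i) ∷ (b′ , i′) ∷ w

  signed : ∀ {n} → Env n → Bool → Expr n → Carrier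
  signed ρ true  e = ⟦ e ⟧ ρ
  signed ρ false e = ⟦ e ⟧ ρ ⁻¹

  cons-correct : ∀ {n} (ρ : Env n) a w → word ρ (cons a w) ≈ letter ρ a ∙ word ρ w
  cons-correct ρ a [] = ≈-refl
  cons-correct ρ (b , i) ((b′ , i′) ∷ w) with b Bool.≟ not b′ | i Fin.≟ i′
  ... | no _  | _     = ≈-refl
  ... | yes _ | no _  = ≈-refl
  ... | yes refl | yes refl = cancel b′
    where
    cancel : ∀ b → word ρ w ≈ letter ρ (not b , i) ∙ (letter ρ (b , i) ∙ word ρ w)
    cancel true  = ≈-sym (\\-leftDividesʳ (lookup ρ i) (word ρ w))
    cancel false = ≈-sym (\\-leftDividesˡ (lookup ρ i) (word ρ w))

  letters-correct : ∀ {n} (ρ : Env n) b e w → word ρ (letters b e w) ≈ signed ρ b e ∙ word ρ w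
  letters-correct ρ true  (var i) w = cons-correct ρ _ w
  letters-correct ρ false (var i) w = cons-correct ρ _ w
  letters-correct ρ true  ∅ w = ≈-sym (identityˡ _)
  letters-correct ρ false ∅ w = ≈-sym (≈-trans (∙-congʳ ε⁻¹≈ε) (identityˡ _))
  letters-correct ρ true  (x ⊕ y) w = ≈-trans (letters-correct ρ true x _)
    (≈-trans (∙-congˡ (letters-correct ρ true y w)) (≈-sym (assoc _ _ _)))
  letters-correct ρ false (x ⊕ y) w = ≈-trans (letters-correct ρ false y _)
    (≈-trans (∙-congˡ (letters-correct ρ false x w))
    (≈-trans (≈-sym (assoc _ _ _)) (∙-congʳ (≈-sym (⁻¹-anti-homo-∙ _ _)))))
  letters-correct ρ true  (x ⊖) w = letters-correct ρ false x w
  letters-correct ρ false (x ⊖) w = ≈-trans (letters-correct ρ true x w)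
    (∙-congʳ (≈-sym (⁻¹-involutive _)))

  ⟦_⇓⟧ : ∀ {n} → Expr n → Env n → Carrier
  ⟦ e ⇓⟧ ρ = word ρ (letters true e [])

  correct : ∀ {n} (e : Expr n) ρ → ⟦ e ⇓⟧ ρ ≈ ⟦ e ⟧ ρ
  correct e ρ = ≈-trans (letters-correct ρ true e []) (identityʳ _)

  open Reflection setoid var ⟦_⟧ ⟦_⇓⟧ correct public using (solve; _⊜_)

-- Cayley graphs, cosets, and Hamilton paths of extensions of a subgroup

module Cayley {c ℓ s} (G : Group c ℓ) (_≟_ : Decidable (Group._≈_ G)) (S : Pred (Group.Carrier G) s) where

  open Group G renaming (Carrier to C; refl to ≈-refl; sym to ≈-sym; trans to ≈-trans; setoid to V)
  open GroupProperties G
  open GroupSolver G using (solve; _⊜_; _⊕_; _⊖; ∅)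

  cayley : Graph c ℓ (c ⊔ ℓ ⊔ s)
  cayley = record
    { vertices = V
    ; Adj      = λ x y → ∃[ g ] S g × (y ≈ g ∙ x ⊎ x ≈ g ∙ y)
    ; adj-resp = λ { p q (g , Sg , inj₁ e) → g , Sg , inj₁ (≈-trans (≈-sym q) (≈-trans e (∙-congˡ p)))
                   ; p q (g , Sg , inj₂ e) → g , Sg , inj₂ (≈-trans (≈-sym p) (≈-trans e (∙-congˡ q))) }
    ; adj-sym  = λ { (g , Sg , inj₁ e) → g , Sg , inj₂ e ; (g , Sg , inj₂ e) → g , Sg , inj₁ e }
    }

  open Graph cayley using (Adj; adj-resp; adj-sym) public
  open Walks cayley public
  open Perm V using (_↭_; ↭-refl; ↭-sym; ↭-trans; ↭-reflexive)
  open PermP V using (++⁺; ++⁺ʳ; ++⁺ˡ; ∈-resp-↭; ++-comm)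
  open Mem V using (_∈_)
  open Uniq V using (Unique)

  adj-gen : ∀ {g} x → S g → Adj x (g ∙ x)
  adj-gen x Sg = _ , Sg , inj₁ ≈-refl

  path-∙ʳ : ∀ g {l x y} → Path l x y → Path (map (_∙ g) l) (x ∙ g) (y ∙ g)
  path-∙ʳ g = WalkMap.path-map cayley cayley (_∙ g) ∙-congʳ
    λ { (h , Sh , inj₁ e) → h , Sh , inj₁ (≈-trans (∙-congʳ e) (assoc _ _ _))
      ; (h , Sh , inj₂ e) → h , Sh , inj₂ (≈-trans (∙-congʳ e) (assoc _ _ _)) }

  iterate : (C → C) → C → ℕ → C
  iterate f x zero    = x
  iterate f x (suc n) = iterate f (f x) n

  record Subgroup (p : Level) : Set (c ⊔ ℓ ⊔ lsuc p) where
    field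
      P         : Pred C p
      resp      : ∀ {x y} → x ≈ y → P x → P y
      ε-closed  : P ε
      ∙-closed  : ∀ {x y} → P x → P y → P (x ∙ y)
      ⁻¹-closed : ∀ {x} → P x → P (x ⁻¹)
      P?        : Unary.Decidable P

  record HamConn {p} (P : Pred C p) : Set (c ⊔ ℓ ⊔ s ⊔ p) where
    field
      elems    : List C
      unique   : Unique elems
      sound    : ∀ {v} → v ∈ elems → P v
      complete : ∀ {v} → P v → v ∈ elems
      path     : ∀ {x y} → P x → P y → ¬ x ≈ y → Path elems x y

  -- Right multiplication by `x` in H permutes H, so a Hamilton path moved by `x` is again one for
  -- the same list `elems`.
  translate : ∀ {p} (H : Subgroup p) (elems : List C) → Unique elems →
    (∀ {v} → v ∈ elems → Subgroup.P H v) → (∀ {v} → Subgroup.P H v → v ∈ elems) → ∀ x → Subgroup.P H x → map (_∙ x) elems ↭ elems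
  translate H elems u sound complete x Px = unique-↭ (UniqP.map⁺ V V (∙-cancelʳ x _ _) u) u to from
    where
    open Subgroup H
    to : ∀ {v} → v ∈ map (_∙ x) elems → v ∈ elems
    to i with MemP.∈-map⁻ V V i
    ... | h , h∈ , v≈hx = complete (resp (≈-sym v≈hx) (∙-closed (sound h∈) Px))
    from : ∀ {v} → v ∈ elems → v ∈ map (_∙ x) elems
    from {v} i = MemP.∈-resp-≈ V (solve 2 (λ v x → (v ⊕ x ⊖) ⊕ x ⊜ v) ≈-refl v x)
        (MemP.∈-map⁺ V V ∙-congʳ (complete (∙-closed (sound i) (⁻¹-closed Px))))

  -- Right translations are automorphisms, so paths may be assumed to start at ε.
  fromIdentity : ∀ {p} (H : Subgroup p) (elems : List C) → Unique elems →
    (∀ {v} → v ∈ elems → Subgroup.P H v) → (∀ {v} → Subgroup.P H v → v ∈ elems) →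
    (∀ g → Subgroup.P H g → ¬ ε ≈ g → Path elems ε g) → HamConn (Subgroup.P H)
  fromIdentity H elems u sound complete path = record
    { elems = elems ; unique = u ; sound = sound ; complete = complete
    ; path  = λ {x} {y} Px Py x≉y → path-↭ (translate H elems u sound complete x Px)
        (path-resp (identityˡ x) (solve 2 (λ x y → (y ⊕ x ⊖) ⊕ x ⊜ y) ≈-refl x y)
          (path-∙ʳ x (path (y ∙ x ⁻¹) (Subgroup.∙-closed H Py (Subgroup.⁻¹-closed H Px))
            λ e → x≉y (≈-sym (x∙y⁻¹≈ε⇒x≈y y x (≈-sym e))))))
    }

  module Cosets {p} (H : Subgroup p) (hc : HamConn (Subgroup.P H)) where

    open Subgroup H using (resp; ε-closed; ∙-closed; ⁻¹-closed; P?) renaming (P to InH)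
    open HamConn hc

    infix 4 _~_
    -- Right cosets Hx: the generators act on the left, so right multiplication by `x` carries the
    -- graph on H to the graph on Hx.
    _~_ : Rel C p
    x ~ y = InH (x ∙ y ⁻¹)

    ~-sym : ∀ {x y} → x ~ y → y ~ x
    ~-sym p = resp (solve 2 (λ x y → (x ⊕ y ⊖) ⊖ ⊜ y ⊕ x ⊖) ≈-refl _ _) (⁻¹-closed p)

    ~-trans : ∀ {x y z} → x ~ y → y ~ z → x ~ z
    ~-trans p q = resp (solve 3 (λ x y z → (x ⊕ y ⊖) ⊕ (y ⊕ z ⊖) ⊜ x ⊕ z ⊖) ≈-refl _ _ _) (∙-closed p q)

    ~-reflexive : ∀ {x y} → x ≈ y → x ~ y
    ~-reflexive p = resp (≈-sym (x≈y⇒x∙y⁻¹≈ε p)) ε-closed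

    ~-∙ˡ : ∀ {h} x → InH h → h ∙ x ~ x
    ~-∙ˡ x = resp (solve 2 (λ h x → h ⊜ (h ⊕ x) ⊕ x ⊖) ≈-refl _ x)

    -- The set of cosets without a choice of representatives: the carrier is the group itself and
    -- only the equality is coarser.
    Q : DecSetoid c p
    Q = record { isDecEquivalence = record
      { isEquivalence = record { refl = ~-reflexive ≈-refl ; sym = ~-sym ; trans = ~-trans }
      ; _≟_ = λ x y → P? (x ∙ y ⁻¹) } }

    Qs = DecSetoid.setoid Q
    open Mem Qs using () renaming (_∈_ to _∈Q_)
    open Uniq Qs using () renaming (Unique to UniqueQ)

    coset : C → List C
    coset x = map (_∙ x) elems

    ∈coset⁺ : ∀ {v x} → v ~ x → v ∈ coset x
    ∈coset⁺ v~x = MemP.∈-resp-≈ V (solve 2 (λ v x → (v ⊕ x ⊖) ⊕ x ⊜ v) ≈-refl _ _)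
      (MemP.∈-map⁺ V V ∙-congʳ (complete v~x))

    ∈coset⁻ : ∀ {v x} → v ∈ coset x → v ~ x
    ∈coset⁻ i with MemP.∈-map⁻ V V i
    ... | h , h∈ , v≈hx = ~-trans (~-reflexive v≈hx) (~-∙ˡ _ (sound h∈))

    coset-unique : ∀ x → Unique (coset x)
    coset-unique x = UniqP.map⁺ V V (∙-cancelʳ x _ _) unique

    coset-↭ : ∀ {x y} → x ~ y → coset x ↭ coset y
    coset-↭ x~y = unique-↭ (coset-unique _) (coset-unique _)
      (λ i → ∈coset⁺ (~-trans (∈coset⁻ i) x~y)) (λ i → ∈coset⁺ (~-trans (∈coset⁻ i) (~-sym x~y)))

    coset-path : ∀ {x y} → y ~ x → ¬ x ≈ y → Path (coset x) x y
    coset-path {x} {y} y~x x≉y = path-resp (identityˡ x)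
      (solve 2 (λ y x → (y ⊕ x ⊖) ⊕ x ⊜ y) ≈-refl y x)
      (path-∙ʳ x (path ε-closed y~x λ e → x≉y (≈-sym (x∙y⁻¹≈ε⇒x≈y _ _ (≈-sym e)))))

    blocks : List C → List C
    blocks = concatMap coset

    ∈blocks⁺ : ∀ {v bl} → v ∈Q bl → v ∈ blocks bl
    ∈blocks⁺ i = MemP.∈-concatMap⁺ V V (Any.map ∈coset⁺ i)

    ∈blocks⁻ : ∀ {v} bl → v ∈ blocks bl → v ∈Q bl
    ∈blocks⁻ bl i = Any.map ∈coset⁻ (MemP.∈-concatMap⁻ V V {xs = bl} i)

    blocks-unique : ∀ {bl} → UniqueQ bl → Unique (blocks bl)
    blocks-unique u = UniqP.concat⁺ V (AllP.map⁺ (All.universal coset-unique _))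
      (AllPairsP.map⁺ (AllPairs.map disjoint u))
      where
      disjoint : ∀ {x y} → ¬ x ~ y → ∀ {v} → ¬ (v ∈ coset x × v ∈ coset y)
      disjoint x≁y (i , j) = x≁y (~-trans (~-sym (∈coset⁻ i)) (∈coset⁻ j))

    blocks-↭ : ∀ {bl bl′} → UniqueQ bl → UniqueQ bl′ → (∀ {v} → v ∈Q bl → v ∈Q bl′) →
      (∀ {v} → v ∈Q bl′ → v ∈Q bl) → blocks bl ↭ blocks bl′
    blocks-↭ {bl} {bl′} u u′ f g = unique-↭ (blocks-unique u) (blocks-unique u′)
      (λ i → ∈blocks⁺ (f (∈blocks⁻ bl i))) (λ i → ∈blocks⁺ (g (∈blocks⁻ bl′ i)))

    -- Visiting whole cosets one after the other, as soon as consecutive cosets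
    -- are joined by edges avoiding any prescribed end vertices.
    module _ (In : Pred C p) (H⊆In : ∀ {h x} → InH h → In x → In (h ∙ x))
      (link : ∀ {x y} → In x → In y → ¬ x ~ y →
        ∃₂ λ z z′ → z ~ x × z′ ~ y × ¬ x ≈ z × ¬ z′ ≈ y × Adj z z′) where

      In-~ : (∀ {x y} → x ≈ y → In x → In y) → ∀ {x y} → x ~ y → In y → In x
      In-~ r x~y iy = r (solve 2 (λ x y → (x ⊕ y ⊖) ⊕ y ⊜ x) ≈-refl _ _) (H⊆In x~y iy)

      chain : (∀ {x y} → x ≈ y → In x → In y) → ∀ {x} gs {y} → In x → All In gs → In y →
        Linked (λ a b → ¬ a ~ b) (x ∷ gs ++ [ y ]) → Path (blocks (x ∷ gs ++ [ y ])) x y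
      chain r [] {y} ix [] iy (x≁y ∷ [-]) with link ix iy x≁y
      ... | z , z′ , z~x , z′~y , x≉z , z′≉y , e =
            path-++ (coset-path z~x x≉z) e
              (path-↭ (↭-trans (coset-↭ z′~y) (↭-reflexive (≡.sym (++-identityʳ _))))
                (coset-path (~-sym z′~y) z′≉y))
      chain r (g ∷ gs) {y} ix (ig ∷ igs) iy (x≁g ∷ lk) with link ix ig x≁g
      ... | z , z′ , z~x , z′~g , x≉z , _ , e =
            path-++ (coset-path z~x x≉z) e
              -- The recursion starts at the arrival vertex `z′` instead of the representative `g`;
              -- both lie in one coset, so only the order of the listed vertices changes.
              (path-↭ (++⁺ʳ (blocks (gs ++ [ y ])) (coset-↭ z′~g))
                (chain r gs (In-~ r z′~g ig) igs iy (relink gs lk)))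
        where
        relink : ∀ gs → Linked (λ a b → ¬ a ~ b) (g ∷ gs ++ [ y ]) → Linked (λ a b → ¬ a ~ b) (z′ ∷ gs ++ [ y ])
        relink []      (g≁y ∷ l) = (λ z′~y → g≁y (~-trans (~-sym z′~g) z′~y)) ∷ l
        relink (_ ∷ _) (g≁y ∷ l) = (λ z′~y → g≁y (~-trans (~-sym z′~g) z′~y)) ∷ l

  private
    -- Two partial injective tests cannot reject three distinct candidates.
    pick : ∀ {a b} {A : C → Set a} {B : C → Set b} → Unary.Decidable A → Unary.Decidable B →
      (∀ {x y} → A x → A y → x ≈ y) → (∀ {x y} → B x → B y → x ≈ y) →
      ∀ u v w → ¬ u ≈ v → ¬ u ≈ w → ¬ v ≈ w →
      ∃[ x ] (x ≡ u ⊎ x ≡ v ⊎ x ≡ w) × ¬ A x × ¬ B x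
    pick {A = A} {B} A? B? inA inB u v w u≉v u≉w v≉w = go (bad u) (bad v) (bad w)
      where
      bad : ∀ x → (¬ A x × ¬ B x) ⊎ (A x ⊎ B x)
      bad x with A? x | B? x
      ... | yes a | _     = inj₂ (inj₁ a)
      ... | no _  | yes b = inj₂ (inj₂ b)
      ... | no ¬a | no ¬b = inj₁ (¬a , ¬b)
      go : _ → _ → _ → _
      go (inj₁ g) _ _ = u , inj₁ refl , g
      go _ (inj₁ g) _ = v , inj₂ (inj₁ refl) , g
      go _ _ (inj₁ g) = w , inj₂ (inj₂ refl) , g
      go (inj₂ (inj₁ a)) (inj₂ (inj₁ b)) _ = ⊥-elim (u≉v (inA a b))
      go (inj₂ (inj₂ a)) (inj₂ (inj₂ b)) _ = ⊥-elim (u≉v (inB a b))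
      go (inj₂ (inj₁ a)) (inj₂ (inj₂ _)) (inj₂ (inj₁ b)) = ⊥-elim (u≉w (inA a b))
      go (inj₂ (inj₂ a)) (inj₂ (inj₁ _)) (inj₂ (inj₂ b)) = ⊥-elim (u≉w (inB a b))
      go (inj₂ (inj₂ _)) (inj₂ (inj₁ a)) (inj₂ (inj₁ b)) = ⊥-elim (v≉w (inA a b))
      go (inj₂ (inj₁ _)) (inj₂ (inj₂ a)) (inj₂ (inj₂ b)) = ⊥-elim (v≉w (inB a b))

  -- K is the union of H and the double coset H t⁻¹ H, so K acts doubly
  -- transitively on the cosets of H; the coset graph is complete and every
  -- edge of it is carried by at least three disjoint edges.
  module Extension {p} (H K : Subgroup p)
    (H⊆K : ∀ {x} → Subgroup.P H x → Subgroup.P K x) (t : C) (St : S t) (Kt : Subgroup.P K t) (t∉H : ¬ Subgroup.P H t)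
    (h₀ : C) (Hh₀ : Subgroup.P H h₀) (spread : ¬ Subgroup.P H (t ∙ h₀ ∙ t ⁻¹))
    (double : ∀ g → Subgroup.P K g → ¬ Subgroup.P H g → ∃[ h ] Subgroup.P H h × Subgroup.P H (t ∙ (h ∙ g)))
    (u w : C) (Hu : Subgroup.P H u) (Hw : Subgroup.P H w) (Hu′ : Subgroup.P H (t ∙ u ∙ t ⁻¹)) (Hw′ : Subgroup.P H (t ∙ w ∙ t ⁻¹))
    (u≉ε : ¬ ε ≈ u) (w≉ε : ¬ ε ≈ w) (u≉w : ¬ u ≈ w)
    (hc : HamConn (Subgroup.P H)) where

    open Subgroup
    open Cosets H hc
    open HamConn hc
    open Mem Qs using () renaming (_∈_ to _∈Q_)
    open Uniq Qs using () renaming (Unique to UniqueQ)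

    private
      -- `double` gives one edge, from h x to t h x in Hy. For f in H with t f t⁻¹ in H the edge at
      -- f h x joins the same two cosets, so f = `ε`, `u`, `w` give three disjoint edges, one of
      -- which misses both ends.
      link : ∀ {x y} → P K x → P K y → ¬ x ~ y →
        ∃₂ λ z z′ → z ~ x × z′ ~ y × ¬ x ≈ z × ¬ z′ ≈ y × Adj z z′
      link {x} {y} Kx Ky x≁y with double (x ∙ y ⁻¹) (∙-closed K Kx (⁻¹-closed K Ky)) x≁y
      ... | h , Hh , Hthg with pick (λ f → x ≟ (f ∙ h ∙ x)) (λ f → (t ∙ (f ∙ h ∙ x)) ≟ y)
              (λ a b → ∙-cancelʳ h _ _ (∙-cancelʳ x _ _ (≈-trans (≈-sym a) b)))
              (λ a b → ∙-cancelʳ h _ _ (∙-cancelʳ x _ _ (∙-cancelˡ t _ _ (≈-trans a (≈-sym b)))))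
              ε u w u≉ε w≉ε u≉w
      ...   | f , f≡ , ok₁ , ok₂ = f ∙ h ∙ x , t ∙ (f ∙ h ∙ x) ,
              resp H (solve 3 (λ f h x → f ⊕ h ⊜ ((f ⊕ h) ⊕ x) ⊕ x ⊖) ≈-refl f h x)
                (∙-closed H (proj₁ (Hf f≡)) Hh) ,
              resp H (solve 5 (λ t f h x y → ((t ⊕ f) ⊕ t ⊖) ⊕ (t ⊕ (h ⊕ (x ⊕ y ⊖))) ⊜
                  (t ⊕ ((f ⊕ h) ⊕ x)) ⊕ y ⊖) ≈-refl t f h x y)
                (∙-closed H (proj₂ (Hf f≡)) Hthg) ,
              ok₁ , ok₂ , adj-gen _ St
        where
        Hf : ∀ {f} → f ≡ ε ⊎ f ≡ u ⊎ f ≡ w → P H f × P H (t ∙ f ∙ t ⁻¹)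
        Hf (inj₁ refl) = ε-closed H ,
          resp H (solve 1 (λ t → ∅ ⊜ (t ⊕ ∅) ⊕ t ⊖) ≈-refl t) (ε-closed H)
        Hf (inj₂ (inj₁ refl)) = Hu , Hu′
        Hf (inj₂ (inj₂ refl)) = Hw , Hw′

      H∙K : ∀ {h x} → P H h → P K x → P K (h ∙ x)
      H∙K a b = ∙-closed K (H⊆K a) b

      K-~ : ∀ {x y} → x ~ y → P K y → P K x
      K-~ = In-~ (P K) H∙K link (resp K)

      -- An element v of K outside H has t h v = h′ for some h, h′ in H, so Hv = H t⁻¹ h′. Hence `ε`
      -- and the products t⁻¹ h′ meet every coset.
      candidates reps : List C
      candidates = ε ∷ map (t ⁻¹ ∙_) elems
      reps = deduplicate (λ x y → P? H (x ∙ y ⁻¹)) candidates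

      reps-unique : UniqueQ reps
      reps-unique = DecUniqP.deduplicate-! Q candidates

      reps-K : ∀ {v} → v ∈Q reps → P K v
      reps-K i with MemP.∈-deduplicate⁻ Qs _ candidates i
      ... | here v~ε = K-~ v~ε (ε-closed K)
      ... | there j with MemP.∈-map⁻ V Qs {f = t ⁻¹ ∙_} j
      ...   | h , h∈ , v~ = K-~ v~ (∙-closed K (⁻¹-closed K Kt) (H⊆K (sound h∈)))

      reps-complete : ∀ {v} → P K v → v ∈Q reps
      reps-complete {v} Kv = MemP.∈-deduplicate⁺ Qs _ (λ p q → ~-trans q (~-sym p)) lemma
        where
        lemma : v ∈Q candidates
        lemma with P? H v
        ... | yes Hv = here (resp H (solve 1 (λ v → v ⊜ v ⊕ ∅ ⊖) ≈-refl v) Hv)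
        ... | no ¬Hv with double v Kv ¬Hv
        ...   | h , Hh , Hthv = there (AnyP.map⁺ (Any.map back (complete Hthv)))
          where
          back : ∀ {h′} → t ∙ (h ∙ v) ≈ h′ → v ~ t ⁻¹ ∙ h′
          back e = ~-trans (~-sym (~-∙ˡ v Hh)) (~-reflexive
            (≈-trans (solve 3 (λ t h v → h ⊕ v ⊜ t ⊖ ⊕ (t ⊕ (h ⊕ v))) ≈-refl t h v) (∙-congˡ e)))

      -- The vertices that remain are visited between the cosets of x and y.
      module Between (x y : C) (avoid : List C) (Kx : P K x) (Ky : P K y) (Ka : All (P K) avoid)
        (u! : UniqueQ (x ∷ y ∷ avoid)) where

        open import Data.List.Membership.DecSetoid Q using (_∈?_)

        fresh? : Unary.Decidable (λ v → ¬ v ∈Q (x ∷ y ∷ avoid))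
        fresh? v = ¬? (v ∈? (x ∷ y ∷ avoid))

        rest : List C
        rest = filter fresh? reps

        rest⁻ : ∀ {v} → v ∈Q rest → v ∈Q reps × ¬ v ∈Q (x ∷ y ∷ avoid)
        rest⁻ = MemP.∈-filter⁻ Qs fresh? (MemP.∉-resp-≈ Qs) {xs = reps}

        rest-K : All (P K) rest
        rest-K = All.tabulateₛ V λ i → reps-K (proj₁ (rest⁻ (Any.map ~-reflexive i)))

        all-unique : UniqueQ ((x ∷ y ∷ avoid) ++ rest)
        all-unique = UniqP.++⁺ Qs u! (UniqP.filter⁺ Qs fresh? reps-unique) λ (i , j) → proj₂ (rest⁻ j) i

        order-unique : UniqueQ (x ∷ rest ++ [ y ])
        order-unique = PermP.Unique-resp-↭ Qs
          (Perm.prep (~-reflexive ≈-refl) (PermP.++-comm Qs [ y ] rest))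
          (PermP.Unique-resp-↭ Qs (PermP.++-comm Qs rest (x ∷ [ y ]))
            (drop avoid (PermP.Unique-resp-↭ Qs (perm avoid) all-unique)))
          where
          drop : ∀ as {bs} → UniqueQ (as ++ bs) → UniqueQ bs
          drop []       u       = u
          drop (_ ∷ as) (_ ∷ u) = drop as u
          perm : ∀ as → (Perm._↭_ Qs) ((x ∷ y ∷ as) ++ rest) (as ++ (rest ++ (x ∷ [ y ])))
          perm as = Perm.↭-trans Qs (PermP.++⁺ʳ Qs rest (PermP.++-comm Qs (x ∷ [ y ]) as))
            (Perm.↭-trans Qs (Perm.↭-reflexive Qs (++-assoc as (x ∷ [ y ]) rest))
              (PermP.++⁺ˡ Qs as (PermP.++-comm Qs (x ∷ [ y ]) rest)))

        path-between : Path (blocks (x ∷ rest ++ [ y ])) x y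
        path-between = chain (P K) H∙K link (resp K) rest Kx rest-K Ky (LinkedP.AllPairs⇒Linked order-unique)

        all-↭ : blocks avoid ++ blocks (x ∷ rest ++ [ y ]) ↭ blocks reps
        all-↭ = ↭-trans (↭-reflexive (≡.sym (concatMap-++ coset avoid _)))
          (blocks-↭ (PermP.Unique-resp-↭ Qs order-↭ all-unique) reps-unique
            (λ i → covered (PermP.∈-resp-↭ Qs (Perm.↭-sym Qs order-↭) i)) (λ i → PermP.∈-resp-↭ Qs order-↭ (listed i)))
          where
          order-↭ : (Perm._↭_ Qs) ((x ∷ y ∷ avoid) ++ rest) (avoid ++ (x ∷ rest ++ [ y ]))
          order-↭ = Perm.↭-trans Qs (PermP.++⁺ʳ Qs rest (PermP.++-comm Qs (x ∷ [ y ]) avoid))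
            (Perm.↭-trans Qs (Perm.↭-reflexive Qs (++-assoc avoid (x ∷ [ y ]) rest))
              (PermP.++⁺ˡ Qs avoid (Perm.prep (~-reflexive ≈-refl) (PermP.++-comm Qs [ y ] rest))))
          K-avoid : ∀ {v} → v ∈Q (x ∷ y ∷ avoid) → P K v
          K-avoid (here p) = K-~ p Kx
          K-avoid (there (here p)) = K-~ p Ky
          K-avoid (there (there i)) = All.lookupₛ Qs (λ p q → K-~ (~-sym p) q) Ka i
          covered : ∀ {v} → v ∈Q ((x ∷ y ∷ avoid) ++ rest) → v ∈Q reps
          covered i with MemP.∈-++⁻ Qs (x ∷ y ∷ avoid) i
          ... | inj₁ j = reps-complete (K-avoid j)
          ... | inj₂ j = proj₁ (rest⁻ j)
          listed : ∀ {v} → v ∈Q reps → v ∈Q ((x ∷ y ∷ avoid) ++ rest)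
          listed {v} i with v ∈? (x ∷ y ∷ avoid)
          ... | yes j = MemP.∈-++⁺ˡ Qs j
          ... | no ¬j = MemP.∈-++⁺ʳ Qs (x ∷ y ∷ avoid)
                          (MemP.∈-filter⁺ Qs fresh? (MemP.∉-resp-≈ Qs) i ¬j)

      -- If both ends lie in one coset Hx, take its Hamilton path. By `spread` the coset of t v is
      -- not constant along it, so some edge ab of that path has t a and t b in different cosets;
      -- this edge is replaced by a detour from t a to t b through all cosets other than Hx. `t∉H`
      -- keeps t a and t b out of Hx.
      path-K : ∀ {x y} → P K x → P K y → ¬ x ≈ y → Path (blocks reps) x y
      path-K {x} {y} Kx Ky x≉y with P? H (x ∙ y ⁻¹)
      ... | no x≁y = path-↭ B.all-↭ B.path-between
        where
        module B = Between x y [] Kx Ky [] ((x≁y ∷ []) ∷ [] ∷ [])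
      ... | yes x~y with coset-path (~-sym x~y) x≉y
      ...   | p , walk , p↭ with walk-split (λ q r → ~-trans q r) ~-sym
                (λ e → ~-reflexive (∙-congˡ e)) (λ a b → P? H ((t ∙ a) ∙ (t ∙ b) ⁻¹)) walk
      ...     | inj₁ same = ⊥-elim (spread (resp H
                  (solve 3 (λ t h x → ((t ⊕ x) ⊕ (t ⊕ (h ⊕ x)) ⊖) ⊖ ⊜ (t ⊕ h) ⊕ t ⊖) ≈-refl t h₀ x)
                  (⁻¹-closed H (same (∈-resp-↭ (↭-sym p↭) (∈coset⁺ (~-∙ˡ x Hh₀)))))))
      ...     | inj₂ (a , b , l₁ , l₂ , ta≁tb , w₁ , w₂ , refl) =
                l₁ ++ (proj₁ middle ++ l₂) ,
                walk-++ w₁ (adj-gen a St) (walk-++ (proj₁ (proj₂ middle)) (adj-sym (adj-gen b St)) w₂) ,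
                ↭-trans (++⁺ˡ l₁ (++-comm (proj₁ middle) l₂))
                  (↭-trans (↭-reflexive (≡.sym (++-assoc l₁ l₂ _)))
                  (↭-trans (++⁺ p↭ (proj₂ (proj₂ middle)))
                  (↭-trans (++⁺ʳ _ (↭-reflexive (≡.sym (++-identityʳ (coset x))))) B.all-↭)))
        where
        near : ∀ {v} → v ∈ l₁ ++ l₂ → v ~ x
        near i = ∈coset⁻ (∈-resp-↭ p↭ i)
        a~x = near (MemP.∈-++⁺ˡ V (walk-last w₁))
        b~x = near (MemP.∈-++⁺ʳ V l₁ (walk-head w₂))
        escape : ∀ {v} → v ~ x → ¬ t ∙ v ~ x
        escape v~x tv~x = t∉H (resp H (solve 2 (λ t v → (t ⊕ v) ⊕ v ⊖ ⊜ t) ≈-refl t _)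
          (~-trans tv~x (~-sym v~x)))
        module B = Between (t ∙ a) (t ∙ b) [ x ] (∙-closed K Kt (K-~ a~x Kx)) (∙-closed K Kt (K-~ b~x Kx))
          (Kx ∷ []) ((ta≁tb ∷ escape a~x ∷ []) ∷ (escape b~x ∷ []) ∷ [] ∷ [])
        middle = B.path-between

    extension : HamConn (P K)
    extension = record
      { elems    = blocks reps
      ; unique   = blocks-unique reps-unique
      ; sound    = λ i → reps-K (∈blocks⁻ reps i)
      ; complete = λ Kv → ∈blocks⁺ (reps-complete Kv)
      ; path     = path-K
      }


  -- K is the union of the cosets H bⁱ for i ≤ k, and b maps each of them
  -- bijectively onto the next one.
  module CosetRow {p} (H K : Subgroup p)
    (H⊆K : ∀ {x} → Subgroup.P H x → Subgroup.P K x) (b : C) (Sb : S b) (Kb : Subgroup.P K b)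
    (normal : ∀ {x} → Subgroup.P H x → Subgroup.P H (b ∙ x ∙ b ⁻¹)) (k : ℕ)
    (apart : ∀ i → 0 < i → i < suc k → ¬ Subgroup.P H (iterate (b ∙_) ε i))
    (cover : ∀ g → Subgroup.P K g → ∃[ i ] i < suc k × Subgroup.P H (g ∙ iterate (b ∙_) ε i ⁻¹))
    (u w : C) (Hu : Subgroup.P H u) (Hw : Subgroup.P H w) (u≉ε : ¬ ε ≈ u) (w≉ε : ¬ ε ≈ w) (u≉w : ¬ u ≈ w)
    (hc : HamConn (Subgroup.P H)) where

    open Subgroup
    open Cosets H hc
    open HamConn hc
    open Mem Qs using () renaming (_∈_ to _∈Q_)
    open Uniq Qs using () renaming (Unique to UniqueQ)

    private
      row : ℕ → C → List C
      row zero    x = []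
      row (suc n) x = x ∷ row n (b ∙ x)

      shift-iterate : ∀ i x → iterate (b ∙_) (b ∙ x) i ≈ iterate (b ∙_) ε (suc i) ∙ x
      iterate-∙ : ∀ i x → iterate (b ∙_) x i ≈ iterate (b ∙_) ε i ∙ x
      iterate-∙ zero    x = ≈-sym (identityˡ x)
      iterate-∙ (suc i) x = shift-iterate i x
      shift-iterate i x = ≈-trans (iterate-∙ i (b ∙ x)) (≈-trans (≈-sym (assoc _ _ _))
        (∙-congʳ (≈-sym (≈-trans (iterate-∙ i (b ∙ ε)) (∙-congˡ (identityʳ b))))))

      ∈row⁺ : ∀ {n v} i x → i < n → v ~ iterate (b ∙_) x i → v ∈Q row n x
      ∈row⁺ zero    x z<s       e = here e
      ∈row⁺ (suc i) x (s<s i<n) e = there (∈row⁺ i (b ∙ x) i<n e)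

      ∈row⁻ : ∀ {n v} x → v ∈Q row n x → ∃[ i ] i < n × v ~ iterate (b ∙_) x i
      ∈row⁻ {suc n} x (here e)  = 0 , z<s , e
      ∈row⁻ {suc n} x (there i) with ∈row⁻ (b ∙ x) i
      ... | j , j<n , e = suc j , s<s j<n , e

      row-unique : ∀ n x → n ℕ.≤ suc k → UniqueQ (row n x)
      row-unique zero    x _   = []
      row-unique (suc n) x n<k = MemP.∉⇒All[≉] Qs new ∷ row-unique n (b ∙ x) (ℕ.≤-trans (ℕ.n≤1+n n) n<k)
        where
        new : ¬ x ∈Q row n (b ∙ x)
        new i with ∈row⁻ (b ∙ x) i
        ... | j , j<n , x~ = apart (suc j) z<s (ℕ.≤-trans (s<s j<n) n<k)
              (resp H (solve 2 (λ x g → (g ⊕ x) ⊕ x ⊖ ⊜ g) ≈-refl x _)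
                (~-sym (~-trans x~ (~-reflexive (shift-iterate j x)))))

      b-~ : ∀ {x y} → x ~ y → b ∙ x ~ b ∙ y
      b-~ x~y = resp H (solve 3 (λ b x y → (b ⊕ (x ⊕ y ⊖)) ⊕ b ⊖ ⊜ (b ⊕ x) ⊕ (b ⊕ y) ⊖) ≈-refl b _ _) (normal x~y)

      row-↭ : ∀ n {x y} → x ~ y → blocks (row n x) ↭ blocks (row n y)
      row-↭ zero    x~y = ↭-refl
      row-↭ (suc n) x~y = ++⁺ (coset-↭ x~y) (row-↭ n (b-~ x~y))

      -- A path starting in the first coset: either leave that coset after
      -- visiting all of it, or make a detour right after the first vertex.
      rowPath : ∀ n {x y} → y ∈Q row (suc n) x → ¬ x ≈ y → Path (blocks (row (suc n) x)) x y
      rowPath zero (here y~x) x≉y = path-↭ (↭-reflexive (≡.sym (++-identityʳ _))) (coset-path y~x x≉y)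
      rowPath (suc n) {x} {y} (here y~x) x≉y with coset-path y~x x≉y
      ... | _ , stop x≈u u≈y , _ = ⊥-elim (x≉y (≈-trans x≈u u≈y))
      ... | p , step {u = a} {z = z} {l = l} x≈a e w , p↭ =
            path-↭ perm (path-++ (path-[] ≈-refl) (adj-gen x Sb) (path-++ detour (adj-sym (adj-gen z Sb)) (l , w , ↭-refl)))
        where
        a∉l : ¬ a ∈ l
        a∉l = UniqP.Unique[x∷xs]⇒x∉xs V (PermP.Unique-resp-↭ V (↭-sym p↭) (coset-unique x))
        z~x = ∈coset⁻ (∈-resp-↭ p↭ (there (walk-head w)))
        detour = rowPath n {b ∙ x} {b ∙ z} (here (b-~ z~x)) λ bx≈bz →
          a∉l (MemP.∈-resp-≈ V (≈-trans (≈-sym (∙-cancelˡ b _ _ bx≈bz)) x≈a) (walk-head w))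
        perm : [ x ] ++ (blocks (row (suc n) (b ∙ x)) ++ l) ↭ blocks (row (suc (suc n)) x)
        perm = ↭-trans (Perm.prep x≈a (++-comm _ l)) (++⁺ʳ _ p↭)
      rowPath (suc n) {x} {y} (there y∈) x≉y = choose
        -- The coset is left at z = f x, which must differ from x, and the next one is entered at b
        -- z, which must differ from y; three candidates for f suffice.
        (pick (λ f → x ≟ (f ∙ x)) (λ f → (b ∙ (f ∙ x)) ≟ y)
          (λ p q → ∙-cancelʳ x _ _ (≈-trans (≈-sym p) q))
          (λ p q → ∙-cancelʳ x _ _ (∙-cancelˡ b _ _ (≈-trans p (≈-sym q))))
          ε u w u≉ε w≉ε u≉w)
        where
        choose : (∃[ f ] (f ≡ ε ⊎ f ≡ u ⊎ f ≡ w) × ¬ x ≈ f ∙ x × ¬ b ∙ (f ∙ x) ≈ y) → _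
        choose (f , f≡ , x≉z , bz≉y) = path-++ (coset-path z~x x≉z) (adj-gen z Sb)
          (path-↭ (row-↭ (suc n) (b-~ z~x)) (rowPath n (carry y∈) bz≉y))
          where
          Hf : ∀ {f} → f ≡ ε ⊎ f ≡ u ⊎ f ≡ w → P H f
          Hf (inj₁ refl) = ε-closed H
          Hf (inj₂ (inj₁ refl)) = Hu
          Hf (inj₂ (inj₂ refl)) = Hw
          z = f ∙ x
          z~x : z ~ x
          z~x = ~-∙ˡ x (Hf f≡)
          carry : y ∈Q row (suc n) (b ∙ x) → y ∈Q row (suc n) (b ∙ z)
          carry i = go (row (suc n) (b ∙ x)) (row (suc n) (b ∙ z)) (same (suc n) (b-~ (~-sym z~x))) i
            where
            open import Data.List.Relation.Binary.Pointwise as Pointwise using (Pointwise; []; _∷_)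
            same : ∀ m {v v′} → v ~ v′ → Pointwise _~_ (row m v) (row m v′)
            same zero    e = []
            same (suc m) e = e ∷ same m (b-~ e)
            go : ∀ l l′ → Pointwise _~_ l l′ → y ∈Q l → y ∈Q l′
            go _ _ (e ∷ _)  (here p)  = here (~-trans p e)
            go _ _ (_ ∷ es) (there i) = there (go _ _ es i)

      b^i-K : ∀ i → P K (iterate (b ∙_) ε i)
      b^i-K zero    = ε-closed K
      b^i-K (suc i) = resp K (≈-sym (shift-iterate i ε)) (∙-closed K (resp K (≈-sym (step-out i)) (∙-closed K Kb (b^i-K i))) (ε-closed K))
        where
        step-out : ∀ i → iterate (b ∙_) ε (suc i) ≈ b ∙ iterate (b ∙_) ε i
        step-out zero    = ≈-refl
        step-out (suc i) = ≈-trans (iterate-∙ (suc i) (b ∙ ε)) (≈-trans (∙-congʳ (step-out i))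
          (≈-trans (assoc _ _ _) (∙-congˡ (≈-sym (iterate-∙ i (b ∙ ε))))))

      ∈row : ∀ {x y} → P K x → P K y → y ∈Q row (suc k) x
      ∈row {x} {y} Kx Ky with cover (y ∙ x ⁻¹) (∙-closed K Ky (⁻¹-closed K Kx))
      ... | i , i<k , Hi = ∈row⁺ i x i<k (~-trans
            (resp H (solve 3 (λ x y g → (y ⊕ x ⊖) ⊕ g ⊖ ⊜ y ⊕ (g ⊕ x) ⊖) ≈-refl x y _) Hi)
            (~-reflexive (≈-sym (iterate-∙ i x))))

      row-K : ∀ {v} → v ∈Q row (suc k) ε → P K v
      row-K i with ∈row⁻ ε i
      ... | j , _ , v~ = resp K (solve 2 (λ v g → (v ⊕ g ⊖) ⊕ g ⊜ v) ≈-refl _ _) (∙-closed K (H⊆K v~) (b^i-K j))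

    cosetRow : HamConn (P K)
    cosetRow = record
      { elems    = blocks (row (suc k) ε)
      ; unique   = blocks-unique (row-unique (suc k) ε ℕ.≤-refl)
      ; sound    = λ i → row-K (∈blocks⁻ (row (suc k) ε) i)
      ; complete = λ Kv → ∈blocks⁺ (∈row (ε-closed K) Kv)
      -- The row starts in the coset of `x` itself. By `cover` the k + 1 successive cosets from
      -- there are again all cosets of H in K, so the target is always met going forward.
      ; path     = λ {x} {y} Kx Ky x≉y → path-↭
          (blocks-↭ (row-unique (suc k) x ℕ.≤-refl) (row-unique (suc k) ε ℕ.≤-refl)
            (λ i → ∈row (ε-closed K) (inside Kx i)) (λ i → ∈row Kx (row-K i)))
          (rowPath k (∈row Kx Ky) x≉y)
      }
      where
      inside : ∀ {x v} → P K x → v ∈Q row (suc k) x → P K v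
      inside {x} Kx i with ∈row⁻ x i
      ... | j , _ , v~ = resp K (solve 2 (λ v g → (v ⊕ g ⊖) ⊕ g ⊜ v) ≈-refl _ _)
            (∙-closed K (H⊆K v~) (resp K (≈-sym (iterate-∙ j x)) (∙-closed K (b^i-K j) Kx)))

-- Grids spanned by two commuting elements

odd : ℕ → Bool
odd zero    = false
odd (suc n) = not (odd n)

odd-+ : ∀ i j → odd (i ℕ.+ j) ≡ odd i xor odd j
odd-+ zero    j = refl
odd-+ (suc i) j = ≡.trans (≡.cong not (odd-+ i j)) (lemma (odd i))
  where
  lemma : ∀ b → not (b xor odd j) ≡ not b xor odd j
  lemma true  = Bool.not-involutive (odd j)
  lemma false = refl

module Tori {c ℓ s} (G : Group c ℓ) (_≟_ : Decidable (Group._≈_ G)) (S : Pred (Group.Carrier G) s) where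

  open Group G renaming (Carrier to C; refl to ≈-refl; sym to ≈-sym; trans to ≈-trans; setoid to V)
  open GroupProperties G
  open GroupSolver G using (solve; _⊜_; _⊕_; _⊖)
  open Cayley G _≟_ S
  open Perm V using (_↭_; ↭-refl; ↭-sym; ↭-trans; ↭-reflexive; ↭-prep)
  open PermP V using (++⁺; ++⁺ˡ; ++-comm; ↭-shift)

  Steps : C → Set (c ⊔ ℓ ⊔ s)
  Steps a = ∀ x → Adj x (a ∙ x)

  step-gen : ∀ {a} → S a → Steps a
  step-gen Sa x = adj-gen x Sa

  step-inverse : ∀ {a a′} → Steps a → (∀ x → a ∙ (a′ ∙ x) ≈ x) → Steps a′
  step-inverse {a} {a′} st inv x = adj-resp (inv x) ≈-refl (adj-sym (st (a′ ∙ x)))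

  step-resp : ∀ {a a′} → a ≈ a′ → Steps a → Steps a′
  step-resp a≈a′ st x = adj-resp ≈-refl (∙-congʳ a≈a′) (st x)

  step-⁻¹ : ∀ {a} → Steps a → Steps (a ⁻¹)
  step-⁻¹ {a} st = step-inverse st (\\-leftDividesˡ a)

  pow : C → ℕ → C → C
  pow a zero    x = x
  pow a (suc i) x = a ∙ pow a i x

  pow-cong : ∀ a i {x y} → x ≈ y → pow a i x ≈ pow a i y
  pow-cong a zero    p = p
  pow-cong a (suc i) p = ∙-congˡ (pow-cong a i p)

  pow-∙ : ∀ a i x y → pow a i x ∙ y ≈ pow a i (x ∙ y)
  pow-∙ a zero    x y = ≈-refl
  pow-∙ a (suc i) x y = ≈-trans (assoc _ _ _) (∙-congˡ (pow-∙ a i x y))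

  pow-+ : ∀ a i j x → pow a (i ℕ.+ j) x ≈ pow a i (pow a j x)
  pow-+ a zero    j x = ≈-refl
  pow-+ a (suc i) j x = ∙-congˡ (pow-+ a i j x)

  Commute : C → C → Set ℓ
  Commute a b = a ∙ b ≈ b ∙ a

  commute-⁻¹ : ∀ {a b} → Commute a b → Commute a (b ⁻¹)
  commute-⁻¹ {a} {b} e = ≈-trans (solve 2 (λ a b → a ⊕ b ⊖ ⊜ b ⊖ ⊕ (b ⊕ a) ⊕ b ⊖) ≈-refl a b)
    (≈-trans (∙-congʳ (∙-congˡ (≈-sym e))) (solve 2 (λ a b → b ⊖ ⊕ (a ⊕ b) ⊕ b ⊖ ⊜ b ⊖ ⊕ a) ≈-refl a b))

  swap-∙ : ∀ {a b} → Commute a b → ∀ x → a ∙ (b ∙ x) ≈ b ∙ (a ∙ x)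
  swap-∙ e x = ≈-trans (≈-sym (assoc _ _ _)) (≈-trans (∙-congʳ e) (assoc _ _ _))

  pow-swap : ∀ {a b} → Commute a b → ∀ i x → pow a i (b ∙ x) ≈ b ∙ pow a i x
  pow-swap e zero    x = ≈-refl
  pow-swap e (suc i) x = ≈-trans (∙-congˡ (pow-swap e i x)) (swap-∙ e _)

  pow-suc : ∀ a i x → pow a i (a ∙ x) ≈ a ∙ pow a i x
  pow-suc a = pow-swap ≈-refl

  pow-⁻¹ : ∀ a i x → pow (a ⁻¹) i (pow a i x) ≈ x
  pow-⁻¹ a zero    x = ≈-refl
  pow-⁻¹ a (suc i) x = ≈-trans (≈-sym (pow-suc (a ⁻¹) i _))
    (≈-trans (pow-cong (a ⁻¹) i (solve 2 (λ a y → a ⊖ ⊕ (a ⊕ y) ⊜ y) ≈-refl a _)) (pow-⁻¹ a i x))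

  segment : C → ℕ → C → List C
  segment a zero    x = []
  segment a (suc k) x = x ∷ segment a k (a ∙ x)

  segment-cong : ∀ a k {x y} → x ≈ y → segment a k x ↭ segment a k y
  segment-cong a zero    p = ↭-refl
  segment-cong a (suc k) p = Perm.prep p (segment-cong a k (∙-congˡ p))

  segment-∷ʳ : ∀ a k x → segment a (suc k) x ↭ pow a k x ∷ segment a k x
  segment-∷ʳ a zero    x = ↭-refl
  segment-∷ʳ a (suc k) x = ↭-trans (↭-prep x (segment-∷ʳ a k (a ∙ x)))
    (Perm.swap ≈-refl (pow-suc a k x) ↭-refl)

  walk-segment : ∀ {a} → Steps a → ∀ k x → Walk x (pow a k x) (segment a (suc k) x)
  walk-segment st zero    x = stop ≈-refl ≈-refl
  walk-segment {a} st (suc k) x = step ≈-refl (st x) (walk-resp ≈-refl (pow-suc a k x) (walk-segment st k (a ∙ x)))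

  module Ladder {a : C} (a-step : Steps a) where

    ladder : ℕ → C → C → List C
    ladder zero    b x = []
    ladder (suc k) b x = x ∷ b ∙ x ∷ ladder k b (a ∙ x)

    ladder-cong : ∀ k b {x y} → x ≈ y → ladder k b x ↭ ladder k b y
    ladder-cong zero    b p = ↭-refl
    ladder-cong (suc k) b p = Perm.prep p (Perm.prep (∙-congˡ p) (ladder-cong k b (∙-congˡ p)))

    ladder-flip : ∀ k {b} → Commute a b → ∀ x → ladder k (b ⁻¹) (b ∙ x) ↭ ladder k b x
    ladder-flip zero    e x = ↭-refl
    ladder-flip (suc k) {b} e x = Perm.swap ≈-refl (solve 2 (λ b x → b ⊖ ⊕ (b ⊕ x) ⊜ x) ≈-refl b x)
      (↭-trans (ladder-cong k (b ⁻¹) (swap-∙ e x)) (ladder-flip k e (a ∙ x)))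

    ladder-rows : ∀ k {b} → Commute a b → ∀ x → ladder k b x ↭ segment a k x ++ segment a k (b ∙ x)
    ladder-rows zero    e x = ↭-refl
    ladder-rows (suc k) {b} e x = ↭-prep x (↭-trans
      (↭-prep (b ∙ x) (↭-trans (ladder-rows k e (a ∙ x)) (++⁺ˡ (segment a k (a ∙ x)) (segment-cong a k (≈-sym (swap-∙ e x))))))
      (↭-sym (↭-shift (segment a k (a ∙ x)) (segment a k (a ∙ (b ∙ x))))))

    -- Zigzag through j columns, then go around the remaining ones.
    target : ℕ → C → C → C
    target zero    b x = b ∙ x
    target (suc j) b x = target j (b ⁻¹) (a ∙ (b ∙ x))

    zigzag : ∀ k j → j ≤ k → ∀ {b} → Steps b → Commute a b → ∀ x → Path (ladder (suc k) b x) x (target j b x)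
    zigzag zero    zero    _ {b} sb e x = path-∷ (sb x) (path-[] ≈-refl)
    zigzag (suc k) zero    _ {b} sb e x = path-↭
      (↭-prep x (++-comm (ladder (suc k) b (a ∙ x)) [ b ∙ x ]))
      (path-∷ (a-step x) (path-++ (zigzag k zero z≤n sb e (a ∙ x))
        (adj-resp (swap-∙ e x) ≈-refl (adj-sym (a-step (b ∙ x)))) (path-[] ≈-refl)))
    zigzag (suc k) (suc j) (s≤s j≤k) {b} sb e x = path-∷ (sb x) (path-∷ (a-step (b ∙ x))
      (path-↭ (↭-trans (ladder-cong (suc k) (b ⁻¹) (swap-∙ e x)) (ladder-flip (suc k) e (a ∙ x)))
        (zigzag k j j≤k (step-⁻¹ sb) (commute-⁻¹ e) (a ∙ (b ∙ x)))))

    -- Each column crossed changes the row, and going around the remaining ones changes it once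
    -- more, so the end lies in the first row exactly for odd j.
    target-even : ∀ j {b} → Commute a b → ∀ x → odd j ≡ false → target j b x ≈ pow a j (b ∙ x)
    target-odd : ∀ j {b} → Commute a b → ∀ x → odd j ≡ true → target j b x ≈ pow a j x
    target-even zero e x _ = ≈-refl
    target-even (suc j) {b} e x eq = ≈-trans (target-odd j (commute-⁻¹ e) _ (flip eq)) (pow-suc a j _)
      where
      flip : ∀ {b} → not b ≡ false → b ≡ true
      flip {true} _ = refl
    target-odd (suc j) {b} e x eq = ≈-trans (target-even j (commute-⁻¹ e) _ (flip eq))
      (≈-trans (pow-cong a j (≈-trans (∙-congˡ (swap-∙ e x)) (solve 2 (λ b y → b ⊖ ⊕ (b ⊕ y) ⊜ y) ≈-refl b _))) (pow-suc a j x))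
      where
      flip : ∀ {b} → not b ≡ true → b ≡ false
      flip {false} _ = refl

  -- Cosets of the cyclic group generated by a, of order n + 2, are the rows;
  -- b moves from a row to the next one.
  module Cylinder {a b : C} (a-step : Steps a) (b-step : Steps b) (comm : Commute a b) (n : ℕ)
    (a^m : ∀ x → pow a (suc (suc n)) x ≈ x) where

    open Ladder a-step

    m : ℕ
    m = suc (suc n)

    row : C → List C
    row = segment a m

    rows : ℕ → C → List C
    rows zero    x = []
    rows (suc k) x = row x ++ rows k (b ∙ x)

    rows-cong : ∀ k {x y} → x ≈ y → rows k x ↭ rows k y
    rows-cong zero    p = ↭-refl
    rows-cong (suc k) p = ++⁺ (segment-cong a m p) (rows-cong k (∙-congˡ p))

    row-rotate : ∀ x → row (a ∙ x) ↭ row x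
    row-rotate x = ↭-trans (segment-∷ʳ a (suc n) (a ∙ x)) (Perm.prep (≈-trans (pow-suc a (suc n) x) (a^m x)) ↭-refl)

    rows-rotate : ∀ k x → rows k (a ∙ x) ↭ rows k x
    rows-rotate zero    x = ↭-refl
    rows-rotate (suc k) x = ++⁺ (row-rotate x)
      (↭-trans (rows-cong k (≈-sym (swap-∙ comm x))) (rows-rotate k (b ∙ x)))

    last≈ : ∀ x → pow a (suc n) x ≈ a ⁻¹ ∙ x
    last≈ x = ∙-cancelˡ a _ _ (≈-trans (a^m x) (solve 2 (λ a x → x ⊜ a ⊕ (a ⊖ ⊕ x)) ≈-refl a x))

    around : ∀ x → Path (row x) x (a ⁻¹ ∙ x)
    around x = row x , walk-resp ≈-refl (last≈ x) (walk-segment a-step (suc n) x) , ↭-refl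

    -- A path through whole rows can be made to absorb further rows next to it.
    absorb : ∀ k x → Path (rows (suc k) x) x (a ⁻¹ ∙ x)
    absorb⁻ : ∀ k x → Path (rows (suc k) x) x (a ∙ x)
    absorb zero    x = path-↭ (↭-reflexive (≡.sym (++-identityʳ (row x)))) (around x)
    absorb (suc k) x = path-↭
      (↭-prep x (++-comm (rows (suc k) (b ∙ x)) (segment a (suc n) (a ∙ x))))
      (path-∷ (b-step x) (path-++ (absorb⁻ k (b ∙ x)) (adj-resp (≈-sym (swap-∙ comm x)) ≈-refl (adj-sym (b-step (a ∙ x))))
        (segment a (suc n) (a ∙ x) ,
         walk-resp ≈-refl (≈-trans (pow-suc a n x) (last≈ x)) (walk-segment a-step n (a ∙ x)) , ↭-refl)))
    absorb⁻ k x = path-↭ (rows-rotate (suc k) x) (path-resp (solve 2 (λ a x → a ⊖ ⊕ (a ⊕ x) ⊜ x) ≈-refl a x) ≈-refl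
      (path-reverse (absorb k (a ∙ x))))

    row-⁻¹ : ∀ k x → segment (a ⁻¹) (suc k) x ↭ segment a (suc k) (pow (a ⁻¹) k x)
    row-⁻¹ zero    x = ↭-refl
    row-⁻¹ (suc k) x = ↭-trans (segment-∷ʳ (a ⁻¹) (suc k) x) (↭-prep _ (↭-trans (row-⁻¹ k x)
      (segment-cong a (suc k) (solve 2 (λ a y → y ⊜ a ⊕ (a ⊖ ⊕ y)) ≈-refl a _))))

    private
      regroup : ∀ {L R} s₁ s₂ y → L ↭ s₁ ++ s₂ → L ++ (R ++ [ y ]) ↭ s₁ ++ (y ∷ s₂ ++ R)
      regroup {L} {R} s₁ s₂ y e = ↭-trans (++⁺ e (++-comm R [ y ])) (↭-trans (↭-reflexive (++-assoc s₁ s₂ (y ∷ R)))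
        (++⁺ˡ s₁ (↭-shift s₂ R)))

      columns : ∀ x → ladder (suc n) b (a ∙ x) ↭ segment a (suc n) (a ∙ x) ++ segment a (suc n) (a ∙ (b ∙ x))
      columns x = ↭-trans (ladder-rows (suc n) comm (a ∙ x))
        (++⁺ˡ (segment a (suc n) (a ∙ x)) (segment-cong a (suc n) (≈-sym (swap-∙ comm x))))

      columns⁻¹ : ∀ x → ladder (suc n) (b ⁻¹) (a ∙ (b ∙ x)) ↭ segment a (suc n) (a ∙ x) ++ segment a (suc n) (a ∙ (b ∙ x))
      columns⁻¹ x = ↭-trans (ladder-cong (suc n) (b ⁻¹) (swap-∙ comm x))
        (↭-trans (ladder-flip (suc n) comm (a ∙ x)) (columns x))

      back : ∀ x → Adj (b ∙ (a ∙ x)) (b ∙ x)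
      back x = adj-resp (swap-∙ comm x) ≈-refl (adj-sym (a-step (b ∙ x)))

    -- The first two rows are a prism; the edge between columns 0 and 1 of its
    -- second row is replaced by a detour through the remaining k rows.
    prism : ∀ k j → j < m → ∀ x → Path (rows (2 ℕ.+ k) x) x (target j b x)
    prism k zero _ x = finish k
      where
      s₁ = segment a (suc n) (a ∙ x)
      s₂ = segment a (suc n) (a ∙ (b ∙ x))
      turn : Path (ladder (suc n) b (a ∙ x)) (a ∙ x) (b ∙ (a ∙ x))
      turn = zigzag n 0 z≤n b-step comm (a ∙ x)
      finish : ∀ k → Path (rows (2 ℕ.+ k) x) x (b ∙ x)
      finish zero = path-↭ (↭-prep x (regroup {R = []} s₁ s₂ (b ∙ x) (columns x)))
        (path-∷ (a-step x) (path-++ turn (back x) (path-[] ≈-refl)))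
      finish (suc k) = path-↭ (↭-prep x (regroup {R = rows (suc k) (b ∙ (b ∙ x))} s₁ s₂ (b ∙ x) (columns x)))
        (path-∷ (a-step x) (path-++ turn (b-step (b ∙ (a ∙ x))) (path-++ detour (adj-sym (b-step (b ∙ x))) (path-[] ≈-refl))))
        where
        moved : a ∙ (b ∙ (b ∙ x)) ≈ b ∙ (b ∙ (a ∙ x))
        moved = ≈-trans (swap-∙ comm (b ∙ x)) (∙-congˡ (swap-∙ comm x))
        detour : Path (rows (suc k) (b ∙ (b ∙ x))) (b ∙ (b ∙ (a ∙ x))) (b ∙ (b ∙ x))
        detour = path-resp moved ≈-refl (path-reverse (absorb⁻ k (b ∙ (b ∙ x))))
    prism k (suc j) (s<s j<m) x = start k
      where
      s₁ = segment a (suc n) (a ∙ x)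
      s₂ = segment a (suc n) (a ∙ (b ∙ x))
      y = a ∙ (b ∙ x)
      rest : Path (ladder (suc n) (b ⁻¹) y) y (target j (b ⁻¹) y)
      rest = zigzag n j (ℕ.≤-pred j<m) (step-⁻¹ b-step) (commute-⁻¹ comm) y
      regroup′ : ∀ {L} R → L ↭ s₁ ++ s₂ → (b ∙ x) ∷ (R ++ L) ↭ s₁ ++ ((b ∙ x) ∷ s₂ ++ R)
      regroup′ {L} R e = ↭-trans (++-comm (b ∙ x ∷ R) L) (↭-trans (++⁺ˡ L (++-comm [ b ∙ x ] R)) (regroup {R = R} s₁ s₂ (b ∙ x) e))
      start : ∀ k → Path (rows (2 ℕ.+ k) x) x (target j (b ⁻¹) y)
      start zero = path-↭ (↭-prep x (regroup′ [] (columns⁻¹ x)))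
        (path-∷ (b-step x) (path-∷ (a-step (b ∙ x)) rest))
      start (suc k) = path-↭ (↭-prep x (regroup′ (rows (suc k) (b ∙ (b ∙ x))) (columns⁻¹ x)))
        (path-∷ (b-step x) (path-∷ (b-step (b ∙ x)) (path-++ (absorb⁻ k (b ∙ (b ∙ x)))
          (adj-resp (≈-sym (swap-∙ comm (b ∙ x))) ≈-refl (adj-sym (b-step y))) rest)))

  module CylinderPaths {a b : C} (a-step : Steps a) (b-step : Steps b) (comm : Commute a b) (n : ℕ)
    (a^m : ∀ x → pow a (suc (suc n)) x ≈ x) where

    open Cylinder a-step b-step comm n a^m
    open Ladder a-step

    private
      a⁻¹-comm : Commute (a ⁻¹) b
      a⁻¹-comm = ≈-sym (commute-⁻¹ (≈-sym comm))

      a⁻ᵐ : ∀ x → pow (a ⁻¹) m x ≈ x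
      a⁻ᵐ x = ≈-trans (pow-cong (a ⁻¹) m (≈-sym (a^m x))) (pow-⁻¹ a m x)

      module L⁻ = Ladder (step-⁻¹ a-step)
      module C⁻ = Cylinder (step-⁻¹ a-step) b-step a⁻¹-comm n a⁻ᵐ

      mirror : ∀ k x → C⁻.rows k x ↭ rows k x
      mirror zero    x = ↭-refl
      mirror (suc k) x = ++⁺ (↭-trans (row-⁻¹ (suc n) x) (↭-trans (segment-cong a m
        (∙-cancelˡ (a ⁻¹) _ _ (≈-trans (a⁻ᵐ x) (solve 2 (λ a x → x ⊜ a ⊖ ⊕ (a ⊕ x)) ≈-refl a x)))) (row-rotate x))) (mirror k (b ∙ x))

      pow-mirror : ∀ i x → i ≤ m → pow (a ⁻¹) (m ℕ.∸ i) x ≈ pow a i x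
      pow-mirror i x i≤m = ≈-trans (pow-cong (a ⁻¹) (m ℕ.∸ i) (≈-sym (≈-trans
        (≈-sym (pow-+ a (m ℕ.∸ i) i x)) (≈-trans (≈-reflexive (≡.cong (λ k → pow a k x) (ℕ.m∸n+n≡m i≤m))) (a^m x)))))
        (pow-⁻¹ a (m ℕ.∸ i) (pow a i x))
        where ≈-reflexive = Group.reflexive G

    -- An odd displacement; around an odd cycle every nonzero one can be made odd.
    Admissible : ℕ → ℕ → Set
    Admissible i r = odd (i ℕ.+ r) ≡ true ⊎ (odd m ≡ true × 0 < i ℕ.+ r)

    private
      split : ∀ b → b ≡ true ⊎ b ≡ false
      split true  = inj₁ refl
      split false = inj₂ refl

      complement : ∀ i → i ≤ m → odd m ≡ true → odd (m ℕ.∸ i) ≡ not (odd i)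
      complement i i≤m om = lemma (odd (m ℕ.∸ i)) (odd i) (≡.trans (≡.sym (odd-+ (m ℕ.∸ i) i))
        (≡.trans (≡.cong odd (ℕ.m∸n+n≡m i≤m)) om))
        where
        lemma : ∀ p q → p xor q ≡ true → p ≡ not q
        lemma true  false _ = refl
        lemma false true  _ = refl

    first-row : ∀ k i → i < m → odd i ≡ true → ∀ x → Path (rows (2 ℕ.+ k) x) x (pow a i x)
    first-row k i i<m oi x = path-resp ≈-refl (target-odd i comm x oi) (prism k i i<m x)

    second-row : ∀ k i → i < m → odd i ≡ false → ∀ x → Path (rows (2 ℕ.+ k) x) x (pow a i (b ∙ x))
    second-row k i i<m ei x = path-resp ≈-refl (target-even i comm x ei) (prism k i i<m x)

    -- Ends in the first two rows are reached by `prism`, in the direction of `a` or, if m is odd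
    -- and the parity is wrong, in that of `a ⁻¹`, where the distance is m - i. For a higher row the
    -- first row is used up, ending at a⁻¹ x, and the walk starts afresh at b a⁻¹ x: the column
    -- displacement grows by one while the row displacement drops by one, so the parity of their sum
    -- is kept.
    cylinder : ∀ k r i → r < 2 ℕ.+ k → i < m → Admissible i r → ∀ x → Path (rows (2 ℕ.+ k) x) x (pow a i (pow b r x))
    cylinder k zero i _ i<m adm x with split (odd i) | adm
    ... | inj₁ oi | _ = first-row k i i<m oi x
    ... | inj₂ ei | inj₁ o = ⊥-elim (contra (≡.trans (≡.sym (≡.trans (≡.cong odd (ℕ.+-identityʳ i)) ei)) o))
      where
      contra : ¬ false ≡ true
      contra ()
    cylinder k zero zero    _ i<m adm x | inj₂ ei | inj₂ (_ , ())
    cylinder k zero (suc i) _ i<m adm x | inj₂ ei | inj₂ (om , _) = path-↭ (mirror (2 ℕ.+ k) x)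
      (path-resp ≈-refl (≈-trans (L⁻.target-odd (m ℕ.∸ suc i) a⁻¹-comm x (≡.trans (complement (suc i) (ℕ.<⇒≤ i<m) om) (≡.cong not ei)))
        (pow-mirror (suc i) x (ℕ.<⇒≤ i<m))) (C⁻.prism k (m ℕ.∸ suc i) (ℕ.∸-monoʳ-< {m} {suc i} {0} z<s (ℕ.<⇒≤ i<m)) x))
    cylinder k (suc zero) i _ i<m adm x with split (odd i) | adm
    ... | inj₂ ei | _ = second-row k i i<m ei x
    ... | inj₁ oi | inj₁ o = ⊥-elim (contra (≡.trans (≡.sym (≡.cong not oi)) (≡.trans (≡.cong odd (ℕ.+-comm 1 i)) o)))
      where
      contra : ¬ false ≡ true
      contra ()
    cylinder k (suc zero) zero    _ i<m adm x | inj₁ () | inj₂ _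
    cylinder k (suc zero) (suc i) _ i<m adm x | inj₁ oi | inj₂ (om , _) = path-↭ (mirror (2 ℕ.+ k) x)
      (path-resp ≈-refl (≈-trans (L⁻.target-even (m ℕ.∸ suc i) a⁻¹-comm x (≡.trans (complement (suc i) (ℕ.<⇒≤ i<m) om) (≡.cong not oi)))
        (pow-mirror (suc i) (b ∙ x) (ℕ.<⇒≤ i<m))) (C⁻.prism k (m ℕ.∸ suc i) (ℕ.∸-monoʳ-< {m} {suc i} {0} z<s (ℕ.<⇒≤ i<m)) x))
    cylinder zero    (suc (suc r)) i (s<s (s<s ())) i<m adm x
    cylinder (suc k) (suc (suc r)) i (s<s r<k) i<m adm x = further (ℕ.<-cmp (suc i) m)
      where
      x′ = b ∙ (a ⁻¹ ∙ x)
      open import Relation.Binary.Definitions using (Tri; tri<; tri≈; tri>)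
      go : ∀ {y} → Path (rows (2 ℕ.+ k) x′) x′ y → Path (rows (3 ℕ.+ k) x) x y
      go p = path-++ (around x) (b-step (a ⁻¹ ∙ x)) (path-↭ (↭-trans (rows-cong (2 ℕ.+ k) (≈-sym (swap-∙ a⁻¹-comm x)))
        (↭-trans (↭-sym (rows-rotate (2 ℕ.+ k) (a ⁻¹ ∙ (b ∙ x)))) (rows-cong (2 ℕ.+ k)
          (solve 2 (λ a y → a ⊕ (a ⊖ ⊕ y) ⊜ y) ≈-refl a (b ∙ x))))) p)
      shifted : pow a (suc i) (pow b (suc r) x′) ≈ pow a i (pow b (suc (suc r)) x)
      shifted = ≈-trans (≈-sym (pow-suc a i _)) (pow-cong a i (≈-trans
        (≈-sym (pow-swap (≈-sym comm) (suc r) x′)) (≈-trans (pow-cong b (suc r) (≈-trans (swap-∙ comm (a ⁻¹ ∙ x))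
          (∙-congˡ (solve 2 (λ a y → a ⊕ (a ⊖ ⊕ y) ⊜ y) ≈-refl a x)))) (pow-suc b (suc r) x))))
      same-parity : Admissible i (suc (suc r)) → Admissible (suc i) (suc r)
      same-parity (inj₁ o)        = inj₁ (≡.trans (≡.cong odd (≡.sym (ℕ.+-suc i (suc r)))) o)
      same-parity (inj₂ (om , _)) = inj₂ (om , z<s)
      -- At i + 1 = m the column displacement becomes 0; this preserves parity for even m, and for
      -- odd m only a nonzero total is needed.
      wrapped : suc i ≡ m → Admissible i (suc (suc r)) → Admissible 0 (suc r)
      wrapped si≡m adm′ with split (odd m) | same-parity adm′
      ... | inj₁ om | _ = inj₂ (om , z<s)
      ... | inj₂ em | inj₂ (om , _) = inj₂ (om , z<s)
      ... | inj₂ em | inj₁ o = inj₁ (lemma (odd (suc r)) (≡.trans (≡.sym (≡.trans (≡.cong (λ k → odd (k ℕ.+ suc r)) si≡m)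
              (≡.trans (odd-+ m (suc r)) (≡.cong (_xor odd (suc r)) em)))) o))
        where
        lemma : ∀ b → false xor b ≡ true → b ≡ true
        lemma true _ = refl
      further : Tri (suc i < m) (suc i ≡ m) (m < suc i) → Path (rows (3 ℕ.+ k) x) x (pow a i (pow b (suc (suc r)) x))
      further (tri< si<m _ _) = go (path-resp ≈-refl shifted (cylinder k (suc r) (suc i) r<k si<m (same-parity adm) x′))
      further (tri≈ _ si≡m _) = go (path-resp ≈-refl (≈-trans (≈-sym (a^m _)) (≈-trans
        (Group.reflexive G (≡.cong (λ k → pow a k (pow b (suc r) x′)) (≡.sym si≡m))) shifted))
        (cylinder k (suc r) 0 r<k z<s (wrapped si≡m adm) x′))
      further (tri> _ _ m<si) = ⊥-elim (ℕ.<⇒≱ i<m (ℕ.≤-pred m<si))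

  module CylinderLists {a b : C} (a-step : Steps a) (b-step : Steps b) (comm : Commute a b) (n : ℕ)
    (a^m : ∀ x → pow a (suc (suc n)) x ≈ x) where

    open Cylinder a-step b-step comm n a^m
    open Mem V using (_∈_)
    open Uniq V using (Unique)

    private
      ∈segment⁺ : ∀ {k v} i x → i < k → v ≈ pow a i x → v ∈ segment a k x
      ∈segment⁺ zero    x z<s       p = here p
      ∈segment⁺ (suc i) x (s<s i<k) p = there (∈segment⁺ i (a ∙ x) i<k (≈-trans p (≈-sym (pow-suc a i x))))

      ∈segment⁻ : ∀ k {v} x → v ∈ segment a k x → ∃[ i ] i < k × v ≈ pow a i x
      ∈segment⁻ (suc k) x (here p)  = 0 , z<s , p
      ∈segment⁻ (suc k) x (there p) with ∈segment⁻ k (a ∙ x) p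
      ... | i , i<k , q = suc i , s<s i<k , ≈-trans q (pow-suc a i x)

      segment-unique : ∀ k x → (∀ i i′ → i < k → i′ < k → pow a i x ≈ pow a i′ x → i ≡ i′) → Unique (segment a k x)
      segment-unique zero    x inj = []
      segment-unique (suc k) x inj = MemP.∉⇒All[≉] V fresh ∷ segment-unique k (a ∙ x) λ i i′ i<k i′<k p →
          ℕ.suc-injective (inj (suc i) (suc i′) (s<s i<k) (s<s i′<k) (≈-trans (≈-sym (pow-suc a i x)) (≈-trans p (pow-suc a i′ x))))
        where
        fresh : ¬ x ∈ segment a k (a ∙ x)
        fresh p with ∈segment⁻ k (a ∙ x) p
        ... | i , i<k , q with inj 0 (suc i) z<s (s<s i<k) (≈-trans q (pow-suc a i x))
        ...   | ()

    ∈rows⁺ : ∀ {k v} i r x → i < m → r < k → v ≈ pow a i (pow b r x) → v ∈ rows k x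
    ∈rows⁺ i zero    x i<m z<s       p = MemP.∈-++⁺ˡ V (∈segment⁺ i x i<m p)
    ∈rows⁺ i (suc r) x i<m (s<s r<k) p = MemP.∈-++⁺ʳ V (row x) (∈rows⁺ i r (b ∙ x) i<m r<k (≈-trans p (pow-cong a i (≈-sym (pow-suc b r x)))))

    ∈rows⁻ : ∀ k {v} x → v ∈ rows k x → ∃[ i ] ∃[ r ] i < m × r < k × v ≈ pow a i (pow b r x)
    ∈rows⁻ (suc k) x p with MemP.∈-++⁻ V (row x) p
    ... | inj₁ q = let (i , i<m , r) = ∈segment⁻ m x q in i , 0 , i<m , z<s , r
    ... | inj₂ q with ∈rows⁻ k (b ∙ x) q
    ...   | i , r , i<m , r<k , t = i , suc r , i<m , s<s r<k , ≈-trans t (pow-cong a i (pow-suc b r x))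

    rows-unique : ∀ k x → (∀ {i r i′ r′} → i < m → r < k → i′ < m → r′ < k → pow a i (pow b r x) ≈ pow a i′ (pow b r′ x) → i ≡ i′ × r ≡ r′) →
      Unique (rows k x)
    rows-unique zero    x inj = []
    rows-unique (suc k) x inj = UniqP.++⁺ V
      (segment-unique m x λ i i′ i<m i′<m p → proj₁ (inj i<m z<s i′<m z<s p))
      (rows-unique k (b ∙ x) λ {i} {r} {i′} {r′} i<m r<k i′<m r′<k p →
        let (p₁ , p₂) = inj i<m (s<s r<k) i′<m (s<s r′<k) (≈-trans (shift-row i r) (≈-trans p (≈-sym (shift-row i′ r′)))) in p₁ , ℕ.suc-injective p₂)
      λ (p , p′) → disjoint (∈segment⁻ m x p) (∈rows⁻ k (b ∙ x) p′)
      where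
      shift-row : ∀ i r → pow a i (b ∙ pow b r x) ≈ pow a i (pow b r (b ∙ x))
      shift-row i r = pow-cong a i (≈-sym (pow-suc b r x))
      disjoint : ∀ {v} → ∃[ i ] i < m × v ≈ pow a i x → ∃[ i ] ∃[ r ] i < m × r < k × v ≈ pow a i (pow b r (b ∙ x)) → ⊥
      disjoint (i , i<m , p) (i′ , r′ , i′<m , r′<k , p′)
        with proj₂ (inj {r = 0} {r′ = suc r′} i<m z<s i′<m (s<s r′<k) (≈-trans (≈-sym p) (≈-trans p′ (≈-sym (shift-row i′ r′)))))
      ... | ()

-- Polynomial identities in commutative rings

-- A solver for commutative ring equations: coefficients are formal differences
-- (a , b) of natural numbers, kept with a = 0 or b = 0 so that they are canonical.
module Solver {c ℓ} (R : CommutativeRing c ℓ) where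

  open CommutativeRing R renaming (refl to ≈-refl)
  open Mult semiring using (×-homo-+; ×1-homo-*) renaming (_×_ to _⨯_)
  open RingProperties ring using (-‿distribˡ-*; -‿distribʳ-*; -0#≈0#; -‿involutive; ⁻¹-anti-homo‿-)
  open AbelianGroupProperties +-abelianGroup using (⁻¹-∙-comm)
  open CommutativeSemigroupProperties +-commutativeSemigroup using (interchange)
  open SetoidReasoning setoid

  reduce : ℕ → ℕ → ℕ × ℕ
  reduce (suc a) (suc b) = reduce a b
  reduce a       b       = a , b

  differences : RawRing _ _
  differences = record
    { Carrier = ℕ × ℕ
    ; _≈_ = _≡_
    ; _+_ = λ { (a , b) (c , d) → reduce (a ℕ.+ c) (b ℕ.+ d) }
    ; _*_ = λ { (a , b) (c , d) → reduce (a ℕ.* c ℕ.+ b ℕ.* d) (a ℕ.* d ℕ.+ b ℕ.* c) }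
    ; -_  = λ { (a , b) → b , a }
    ; 0#  = 0 , 0
    ; 1#  = 1 , 0
    }

  private
    ⟪_⟫ : ℕ → Carrier
    ⟪ n ⟫ = n ⨯ 1#

    -- The first two clauses make the solver's constants definitionally 0# and 1#.
    value : ℕ × ℕ → Carrier
    value (0 , 0) = 0#
    value (1 , 0) = 1#
    value (a , b) = ⟪ a ⟫ - ⟪ b ⟫

    value≈ : ∀ a b → value (a , b) ≈ ⟪ a ⟫ - ⟪ b ⟫
    value≈ 0 0 = sym (-‿inverseʳ 0#)
    value≈ 1 0 = sym (trans (+-cong (+-identityʳ 1#) -0#≈0#) (+-identityʳ 1#))
    value≈ 0 (suc _) = ≈-refl
    value≈ 1 (suc _) = ≈-refl
    value≈ (suc (suc _)) 0 = ≈-refl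
    value≈ (suc (suc _)) (suc _) = ≈-refl

    diff-+ : ∀ x y z w → (x + z) - (y + w) ≈ (x - y) + (z - w)
    diff-+ x y z w = trans (+-congˡ (sym (⁻¹-∙-comm y w))) (interchange x z (- y) (- w))

    value-reduce : ∀ a b → value (reduce a b) ≈ ⟪ a ⟫ - ⟪ b ⟫
    value-reduce 0       b       = value≈ 0 b
    value-reduce (suc a) 0       = value≈ (suc a) 0
    value-reduce (suc a) (suc b) = trans (value-reduce a b) (sym (trans (diff-+ 1# 1# ⟪ a ⟫ ⟪ b ⟫)
      (trans (+-congʳ (-‿inverseʳ 1#)) (+-identityˡ _))))

    diff-* : ∀ x y z w → (x * z + y * w) - (x * w + y * z) ≈ (x - y) * (z - w)
    diff-* x y z w = begin
      (x * z + y * w) - (x * w + y * z)        ≈⟨ diff-+ (x * z) (x * w) (y * w) (y * z) ⟩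
      (x * z - x * w) + (y * w - y * z)        ≈⟨ +-cong (+-congˡ (-‿distribʳ-* x w)) (trans (+-cong (sym (trans (-‿cong (sym (-‿distribˡ-* y w))) (-‿involutive _))) (-‿distribˡ-* y z)) (+-comm _ _)) ⟩
      (x * z + x * - w) + (- y * z + - (- y * w)) ≈⟨ +-congˡ (+-congˡ (-‿distribʳ-* (- y) w)) ⟩
      (x * z + x * - w) + (- y * z + - y * - w) ≈⟨ +-cong (distribˡ x z (- w)) (distribˡ (- y) z (- w)) ⟨
      x * (z - w) + - y * (z - w)              ≈⟨ distribʳ (z - w) x (- y) ⟨
      (x - y) * (z - w)                        ∎

    morphism : differences -Raw-AlmostCommutative⟶ fromCommutativeRing R
    morphism = record
      { ⟦_⟧    = value
      ; +-homo = λ { (a , b) (c , d) → trans (value-reduce (a ℕ.+ c) (b ℕ.+ d))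
                     (trans (+-cong (×-homo-+ 1# a c) (-‿cong (×-homo-+ 1# b d)))
                     (trans (diff-+ ⟪ a ⟫ ⟪ b ⟫ ⟪ c ⟫ ⟪ d ⟫) (sym (+-cong (value≈ a b) (value≈ c d))))) }
      ; *-homo = λ { (a , b) (c , d) → trans (value-reduce (a ℕ.* c ℕ.+ b ℕ.* d) (a ℕ.* d ℕ.+ b ℕ.* c)) (trans
                     (+-cong (trans (×-homo-+ 1# (a ℕ.* c) (b ℕ.* d)) (+-cong (×1-homo-* a c) (×1-homo-* b d)))
                       (-‿cong (trans (×-homo-+ 1# (a ℕ.* d) (b ℕ.* c)) (+-cong (×1-homo-* a d) (×1-homo-* b c)))))
                     (trans (diff-* ⟪ a ⟫ ⟪ b ⟫ ⟪ c ⟫ ⟪ d ⟫) (sym (*-cong (value≈ a b) (value≈ c d))))) }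
      ; -‿homo = λ { (a , b) → trans (value≈ b a) (trans (sym (⁻¹-anti-homo‿- ⟪ a ⟫ ⟪ b ⟫)) (-‿cong (sym (value≈ a b)))) }
      ; 0-homo = ≈-refl
      ; 1-homo = ≈-refl
      }

    equal : WeaklyDecidable (Induced-equivalence morphism)
    equal (a , b) (c , d) with (a ℕ.+ d) ℕ.≟ (c ℕ.+ b)
    ... | no _  = nothing
    ... | yes e = just (trans (value≈ a b) (trans (begin
      ⟪ a ⟫ - ⟪ b ⟫                      ≈⟨ trans (+-congˡ (-‿inverseʳ ⟪ d ⟫)) (+-identityʳ _) ⟨
      (⟪ a ⟫ - ⟪ b ⟫) + (⟪ d ⟫ - ⟪ d ⟫)  ≈⟨ diff-+ ⟪ a ⟫ ⟪ b ⟫ ⟪ d ⟫ ⟪ d ⟫ ⟨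
      (⟪ a ⟫ + ⟪ d ⟫) - (⟪ b ⟫ + ⟪ d ⟫)  ≈⟨ +-congʳ (trans (sym (×-homo-+ 1# a d)) (trans (reflexive (≡.cong ⟪_⟫ e)) (×-homo-+ 1# c b))) ⟩
      (⟪ c ⟫ + ⟪ b ⟫) - (⟪ b ⟫ + ⟪ d ⟫)  ≈⟨ +-congˡ (-‿cong (+-comm _ _)) ⟩
      (⟪ c ⟫ + ⟪ b ⟫) - (⟪ d ⟫ + ⟪ b ⟫)  ≈⟨ diff-+ ⟪ c ⟫ ⟪ d ⟫ ⟪ b ⟫ ⟪ b ⟫ ⟩
      (⟪ c ⟫ - ⟪ d ⟫) + (⟪ b ⟫ - ⟪ b ⟫)  ≈⟨ trans (+-congˡ (-‿inverseʳ ⟪ b ⟫)) (+-identityʳ _) ⟩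
      ⟪ c ⟫ - ⟪ d ⟫                      ∎) (sym (value≈ c d))))

  open RingSolver differences (fromCommutativeRing R) morphism equal public
    using (solve; _:=_; _:+_; _:*_; _:-_; :-_; con; Polynomial)

  infix 9 :0 :1
  :0 :1 : ∀ {n} → Polynomial n
  :0 = con (0 , 0)
  :1 = con (1 , 0)

-- Matrices over a finite field and row operations

module Matrices {c ℓ q} (F : FiniteField c ℓ q) where

  open FiniteField F hiding (zero) renaming (refl to ≈-refl; sym to ≈-sym; trans to ≈-trans; Carrier to K; invertible to inv-exists)
  open SemiringSum semiring using (sum; sum-cong-≋; ∑-comm; *-distribˡ-sum; *-distribʳ-sum; sum-replicate-zero)
  open SetoidReasoning ≈-setoid

  infix 4 _≟F_
  _≟F_ : Decidable _≈_
  x ≟F y = map′ (λ e → ≈-trans (≈-sym (strictlyInverseˡ x)) (≈-trans (to-cong e) (strictlyInverseˡ y))) from-cong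
    (from x Fin.≟ from y)
    where open Inverse cardinality

  δ : ∀ {n} → Fin n → Fin n → K
  δ i j = if ⌊ i Fin.≟ j ⌋ then 1# else 0#

  δ-same : ∀ {n} (i : Fin n) → δ i i ≈ 1#
  δ-same i with i Fin.≟ i
  ... | yes _  = ≈-refl
  ... | no i≢i = ⊥-elim (i≢i refl)

  δ-diff : ∀ {n} {i j : Fin n} → ¬ i ≡ j → δ i j ≈ 0#
  δ-diff {i = i} {j} i≢j with i Fin.≟ j
  ... | yes i≡j = ⊥-elim (i≢j i≡j)
  ... | no _    = ≈-refl

  δ-sym : ∀ {n} (i j : Fin n) → δ i j ≈ δ j i
  δ-sym i j with i Fin.≟ j
  ... | yes refl = ≈-sym (δ-same j)
  ... | no i≢j   = ≈-sym (δ-diff λ e → i≢j (≡.sym e))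

  δ-injective : ∀ {m n} {f : Fin m → Fin n} → (∀ {i j} → f i ≡ f j → i ≡ j) → ∀ i j → δ (f i) (f j) ≈ δ i j
  δ-injective f-inj i j with i Fin.≟ j
  ... | yes refl = δ-same _
  ... | no i≢j   = δ-diff λ e → i≢j (f-inj e)

  sum-zero : ∀ {n} {f : Fin n → K} → (∀ i → f i ≈ 0#) → sum f ≈ 0#
  sum-zero {n} f≈0 = ≈-trans (sum-cong-≋ f≈0) (sum-replicate-zero n)

  sum-δˡ : ∀ {n} (i : Fin n) (f : Fin n → K) → sum (λ k → δ i k * f k) ≈ f i
  sum-δˡ zero    f = ≈-trans (+-cong (*-identityˡ _) (sum-zero λ k → zeroˡ (f (suc k)))) (+-identityʳ _)
  sum-δˡ (suc i) f = ≈-trans (+-cong (zeroˡ _) (≈-trans (sum-cong-≋ λ k → *-congʳ (δ-injective Fin.suc-injective i k))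
    (sum-δˡ i (λ k → f (suc k))))) (+-identityˡ _)

  sum-δʳ : ∀ {n} (i : Fin n) (f : Fin n → K) → sum (λ k → f k * δ k i) ≈ f i
  sum-δʳ i f = ≈-trans (sum-cong-≋ λ k → ≈-trans (*-comm _ _) (*-congʳ (δ-sym k i))) (sum-δˡ i f)

  module GLₙ (n : ℕ) where

    private
      _∙_ : Matrix F n → Matrix F n → Matrix F n
      _∙_ = _·_ F {n}
      open Setoid (matrixSetoid F n) using () renaming (_≈_ to _≋_)

    ·-assoc : ∀ X Y Z → ((X ∙ Y) ∙ Z) ≋ (X ∙ (Y ∙ Z))
    ·-assoc X Y Z i j = begin
      sum (λ k → sum (λ l → X i l * Y l k) * Z k j)    ≈⟨ sum-cong-≋ (λ k → *-distribʳ-sum (Z k j) (λ l → X i l * Y l k)) ⟩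
      sum (λ k → sum (λ l → X i l * Y l k * Z k j))    ≈⟨ ∑-comm (λ k l → X i l * Y l k * Z k j) ⟩
      sum (λ l → sum (λ k → X i l * Y l k * Z k j))    ≈⟨ sum-cong-≋ (λ l → sum-cong-≋ λ k → *-assoc (X i l) (Y l k) (Z k j)) ⟩
      sum (λ l → sum (λ k → X i l * (Y l k * Z k j)))  ≈⟨ sum-cong-≋ (λ l → *-distribˡ-sum (X i l) (λ k → Y l k * Z k j)) ⟨
      sum (λ l → X i l * sum (λ k → Y l k * Z k j))    ∎

    ·-cong : ∀ {X X′ Y Y′} → X ≋ X′ → Y ≋ Y′ → (X ∙ Y) ≋ (X′ ∙ Y′)
    ·-cong p q i j = sum-cong-≋ λ k → *-cong (p i k) (q k j)

    ·-identityˡ : ∀ X → (I F ∙ X) ≋ X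
    ·-identityˡ X i j = sum-δˡ i (λ k → X k j)

    ·-identityʳ : ∀ X → (X ∙ I F) ≋ X
    ·-identityʳ X i j = sum-δʳ j (X i)

    open Setoid (matrixSetoid F n) public using () renaming (refl to ≋-refl; sym to ≋-sym; trans to ≋-trans)

    -- Abstract, so that comparing products never unfolds invertibility proofs.
    abstract
      cancel : ∀ {X X′ Y Y′} → (X ∙ X′) ≋ I F → (Y ∙ Y′) ≋ I F → ((X ∙ Y) ∙ (Y′ ∙ X′)) ≋ I F
      cancel {X} {X′} {Y} {Y′} p q = ≋-trans (·-assoc X Y (Y′ ∙ X′))
        (≋-trans (·-cong {X} ≋-refl (≋-trans (≋-sym (·-assoc Y Y′ X′)) (≋-trans (·-cong q ≋-refl) (·-identityˡ X′)))) p)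

    group : Group (c ⊔ ℓ) ℓ
    group = record
      { Carrier = GL F n
      ; _≈_     = Setoid._≈_ (GL-setoid F n)
      ; _∙_     = λ { (mkGL X (X′ , p , p′)) (mkGL Y (Y′ , q , q′)) →
          mkGL (X ∙ Y) (Y′ ∙ X′ , cancel q p , cancel p′ q′) }
      ; ε       = mkGL (I F) (I F , ·-identityˡ (I F) , ·-identityˡ (I F))
      ; _⁻¹     = λ { (mkGL X (X′ , p , p′)) → mkGL X′ (X , p′ , p) }
      ; isGroup = record
        { isMonoid = record
          { isSemigroup = record
            { isMagma = record
              { isEquivalence = Setoid.isEquivalence (GL-setoid F n)
              ; ∙-cong = λ p q → ·-cong p q
              }
            ; assoc = λ X Y Z → ·-assoc (GL.matrix X) (GL.matrix Y) (GL.matrix Z)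
            }
          ; identity = (λ X → ·-identityˡ (GL.matrix X)) , (λ X → ·-identityʳ (GL.matrix X))
          }
        ; inverse = (λ { (mkGL X (X′ , p , p′)) → p }) , (λ { (mkGL X (X′ , p , p′)) → p′ })
        ; ⁻¹-cong = λ { {mkGL X (X′ , p , p′)} {mkGL Y (Y′ , q , q′)} X≋Y →
            ≋-trans (≋-sym (·-identityˡ X′)) (≋-trans (·-cong (≋-sym q) ≋-refl)
              (≋-trans (·-assoc Y′ Y X′) (≋-trans (·-cong {Y′} ≋-refl
                (≋-trans (·-cong (≋-sym X≋Y) ≋-refl) p′)) (·-identityʳ Y′)))) }
        }
      }

    infix 4 _≟_
    _≟_ : Decidable (Group._≈_ group)
    X ≟ Y = Fin.all? λ i → Fin.all? λ j → GL.matrix X i j ≟F GL.matrix Y i j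

module Updates {c ℓ q} (F : FiniteField c ℓ q) (n : ℕ) where

  open FiniteField F hiding (zero) renaming (refl to ≈-refl; sym to ≈-sym; trans to ≈-trans; Carrier to K; invertible to inv-exists)
  open SemiringSum semiring using (sum; sum-cong-≋; ∑-distrib-+; *-distribˡ-sum; *-distribʳ-sum)
  open Solver commutativeRing
  open SetoidReasoning ≈-setoid
  open Matrices F
  open GLₙ n
  open Group group using (_∙_)

  entry : GL F n → Fin n → Fin n → K
  entry = GL.matrix

  -- Rank-one updates I + v ⊗ a. Both kinds of generators have this form, A_xy = I + e_y ⊗ e_x and
  -- M_x = I + (α - 1) e_x ⊗ e_x, and so do the pivoting matrices of the double coset arguments; one
  -- inversion formula serves them all.
  R : (v a : Fin n → K) → Matrix F n
  R v a i j = δ i j + v i * a j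

  R-· : ∀ v a X i j → _·_ F (R v a) X i j ≈ X i j + v i * sum (λ k → a k * X k j)
  R-· v a X i j = begin
    sum (λ k → (δ i k + v i * a k) * X k j)                        ≈⟨ sum-cong-≋ (λ k → ≈-trans (distribʳ _ _ _) (+-congˡ (*-assoc (v i) (a k) (X k j)))) ⟩
    sum (λ k → δ i k * X k j + v i * (a k * X k j))                ≈⟨ ∑-distrib-+ (λ k → δ i k * X k j) _ ⟩
    sum (λ k → δ i k * X k j) + sum (λ k → v i * (a k * X k j))    ≈⟨ +-cong (sum-δˡ i (λ k → X k j)) (≈-sym (*-distribˡ-sum (v i) (λ k → a k * X k j))) ⟩
    X i j + v i * sum (λ k → a k * X k j)                          ∎

  -- I + v ⊗ a is invertible as soon as 1 + a · v is.
  private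
   update : ∀ (v a : Fin n → K) d → d * (1# + sum (λ k → a k * v k)) ≈ 1# → GL F n
   update v a d unit = mkGL (R v a) (R v b , left , right)
     where
     b : Fin n → K
     -- The Sherman-Morrison formula: the inverse is I - d v ⊗ a, where d is the inverse of 1 + a ·
     -- v.
     b j = - d * a j
     s = sum (λ k → a k * v k)
     dot : ∀ a′ b j → sum (λ k → a′ k * R v b k j) ≈ a′ j + sum (λ k → a′ k * v k) * b j
     dot a′ b j = begin
       sum (λ k → a′ k * (δ k j + v k * b j))                       ≈⟨ sum-cong-≋ (λ k → ≈-trans (distribˡ (a′ k) (δ k j) (v k * b j)) (+-congˡ (≈-sym (*-assoc (a′ k) (v k) (b j))))) ⟩
       sum (λ k → a′ k * δ k j + a′ k * v k * b j)                  ≈⟨ ∑-distrib-+ (λ k → a′ k * δ k j) _ ⟩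
       sum (λ k → a′ k * δ k j) + sum (λ k → a′ k * v k * b j)      ≈⟨ +-cong (sum-δʳ j a′) (≈-sym (*-distribʳ-sum (b j) (λ k → a′ k * v k))) ⟩
       a′ j + sum (λ k → a′ k * v k) * b j                          ∎
     bv : sum (λ k → b k * v k) ≈ - d * s
     bv = ≈-trans (sum-cong-≋ λ k → *-assoc (- d) (a k) (v k)) (≈-sym (*-distribˡ-sum (- d) (λ k → a k * v k)))
     left : ∀ i j → _·_ F (R v b) (R v a) i j ≈ δ i j
     left i j = begin
       _                                                            ≈⟨ R-· v b (R v a) i j ⟩
       δ i j + v i * a j + v i * sum (λ k → b k * R v a k j)        ≈⟨ +-congˡ (*-congˡ (≈-trans (dot b a j) (+-congˡ (*-congʳ bv)))) ⟩
       δ i j + v i * a j + v i * (- d * a j + - d * s * a j)        ≈⟨ solve 5 (λ e v a d s → e :+ v :* a :+ v :* (:- d :* a :+ :- d :* s :* a) := e :+ v :* a :* (:1 :- d :* (:1 :+ s))) ≈-refl (δ i j) (v i) (a j) d s ⟩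
       δ i j + v i * a j * (1# - d * (1# + s))                      ≈⟨ +-congˡ (*-congˡ (≈-trans (+-congˡ (-‿cong unit)) (-‿inverseʳ 1#))) ⟩
       δ i j + v i * a j * 0#                                       ≈⟨ ≈-trans (+-congˡ (zeroʳ _)) (+-identityʳ _) ⟩
       δ i j                                                        ∎
     right : ∀ i j → _·_ F (R v a) (R v b) i j ≈ δ i j
     right i j = begin
       _                                                            ≈⟨ R-· v a (R v b) i j ⟩
       δ i j + v i * b j + v i * sum (λ k → a k * R v b k j)        ≈⟨ +-congˡ (*-congˡ (dot a b j)) ⟩
       δ i j + v i * (- d * a j) + v i * (a j + s * (- d * a j))    ≈⟨ solve 5 (λ e v a d s → e :+ v :* (:- d :* a) :+ v :* (a :+ s :* (:- d :* a)) := e :+ v :* a :* (:1 :- d :* (:1 :+ s))) ≈-refl (δ i j) (v i) (a j) d s ⟩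
       δ i j + v i * a j * (1# - d * (1# + s))                      ≈⟨ +-congˡ (*-congˡ (≈-trans (+-congˡ (-‿cong unit)) (-‿inverseʳ 1#))) ⟩
       δ i j + v i * a j * 0#                                       ≈⟨ ≈-trans (+-congˡ (zeroʳ _)) (+-identityʳ _) ⟩
       δ i j                                                        ∎

  abstract
   -- Opaque, because from here on only the entries of I + v ⊗ a matter and not the form of its
   -- inverse.
   rank1 : ∀ (v a : Fin n → K) d → d * (1# + sum (λ k → a k * v k)) ≈ 1# → GL F n
   rank1 = update

   rank1-entry : ∀ v a d unit i j → entry (rank1 v a d unit) i j ≡ R v a i j
   rank1-entry v a d unit i j = refl

  rank1-· : ∀ v a d unit X i j → entry (rank1 v a d unit ∙ X) i j ≈ entry X i j + v i * sum (λ k → a k * entry X k j)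
  rank1-· v a d unit X i j = ≈-trans
    (sum-cong-≋ {n} {λ k → entry (rank1 v a d unit) i k * entry X k j} {λ k → R v a i k * entry X k j}
      λ k → *-congʳ {entry X k j} {entry (rank1 v a d unit) i k} {R v a i k} (reflexive (rank1-entry v a d unit i k)))
    (R-· v a (entry X) i j)

  private
    addRow-unit : ∀ {x y : Fin n} → x ≢ y → 1# * (1# + sum (λ k → δ x k * δ y k)) ≈ 1#
    addRow-unit {x} {y} x≢y = ≈-trans (*-identityˡ _)
      (≈-trans (+-congˡ (≈-trans (sum-δˡ x (δ y)) (δ-diff (x≢y ∘ ≡.sym)))) (+-identityʳ 1#))

  addRow : ∀ x y → x ≢ y → GL F n
  addRow x y x≢y = rank1 (δ y) (δ x) 1# (addRow-unit x≢y)

  addRow-entries : ∀ x y x≢y i j → entry (addRow x y x≢y) i j ≈ δ i j + δ y i * δ x j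
  addRow-entries x y x≢y i j = reflexive (rank1-entry (δ y) (δ x) 1# (addRow-unit x≢y) i j)

  addRow-· : ∀ x y x≢y X i j → entry (addRow x y x≢y ∙ X) i j ≈ entry X i j + δ y i * entry X x j
  addRow-· x y x≢y X i j = ≈-trans (rank1-· (δ y) (δ x) 1# (addRow-unit x≢y) X i j) (+-congˡ (*-congˡ (sum-δˡ x (λ k → entry X k j))))

  addRow-other : ∀ {x y} x≢y X {i} j → y ≢ i → entry (addRow x y x≢y ∙ X) i j ≈ entry X i j
  addRow-other {x} {y} x≢y X {i} j y≢i = ≈-trans (addRow-· x y x≢y X i j)
    (≈-trans (+-congˡ (≈-trans (*-congʳ (δ-diff y≢i)) (zeroˡ _))) (+-identityʳ _))

  addRow-target : ∀ {x y} x≢y X j → entry (addRow x y x≢y ∙ X) y j ≈ entry X y j + entry X x j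
  addRow-target {x} {y} x≢y X j = ≈-trans (addRow-· x y x≢y X y j)
    (+-congˡ (≈-trans (*-congʳ (δ-same y)) (*-identityˡ _)))

  A-entries : ∀ (x y : Fin n) → x ≢ y → ∀ i j → A F x y i j ≈ δ i j + δ y i * δ x j
  A-entries x y x≢y i j with i Fin.≟ j | i Fin.≟ y | j Fin.≟ x
  ... | yes refl | _ | _ = ≈-sym (≈-trans (+-cong ≈-refl (off i)) (+-identityʳ _))
    where
    off : ∀ i → δ y i * δ x i ≈ 0#
    off i with y Fin.≟ i | x Fin.≟ i
    ... | yes refl | yes refl = ⊥-elim (x≢y refl)
    ... | no _     | _        = zeroˡ _
    ... | yes _    | no _     = zeroʳ _
  ... | no i≢j | yes refl | yes refl = ≈-sym (≈-trans (+-identityˡ _) (≈-trans (*-cong (δ-same y) (δ-same x)) (*-identityˡ _)))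
  ... | no i≢j | yes refl | no j≢x = ≈-sym (≈-trans (+-identityˡ _) (≈-trans (*-congˡ (δ-diff (j≢x ∘ ≡.sym))) (zeroʳ _)))
  ... | no i≢j | no i≢y | _ = ≈-sym (≈-trans (+-identityˡ _) (≈-trans (*-congʳ (δ-diff (i≢y ∘ ≡.sym))) (zeroˡ _)))

  A≋addRow : ∀ x y x≢y i j → A F x y i j ≈ entry (addRow x y x≢y) i j
  A≋addRow x y x≢y i j = ≈-trans (A-entries x y x≢y i j) (≈-sym (addRow-entries x y x≢y i j))

  private
    sum-scaled : ∀ b x (f : Fin n → K) → sum (λ k → b * δ x k * f k) ≈ b * f x
    sum-scaled b x f = ≈-trans (sum-cong-≋ (λ k → *-assoc b (δ x k) (f k)))
      (≈-trans (≈-sym (*-distribˡ-sum b (λ k → δ x k * f k))) (*-congˡ (sum-δˡ x f)))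

  private
    scale-unit : ∀ (x : Fin n) β β′ → β′ * β ≈ 1# → β′ * (1# + sum (λ k → (β - 1#) * δ x k * δ x k)) ≈ 1#
    scale-unit x β β′ unit = ≈-trans (*-congˡ (+-congˡ (≈-trans (sum-scaled (β - 1#) x (δ x)) (*-congˡ (δ-same x)))))
      (≈-trans (solve 2 (λ b b′ → b′ :* (:1 :+ (b :- :1) :* :1) := b′ :* b) ≈-refl β β′) unit)

  scale : ∀ (x : Fin n) β β′ → β′ * β ≈ 1# → GL F n
  scale x β β′ unit = rank1 (δ x) (λ j → (β - 1#) * δ x j) β′ (scale-unit x β β′ unit)

  scale-entries : ∀ x β β′ unit i j → entry (scale x β β′ unit) i j ≈ δ i j + δ x i * ((β - 1#) * δ x j)
  scale-entries x β β′ unit i j = reflexive (rank1-entry (δ x) (λ j → (β - 1#) * δ x j) β′ (scale-unit x β β′ unit) i j)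

  scale-· : ∀ x β β′ unit X i j → entry (scale x β β′ unit ∙ X) i j ≈ entry X i j + δ x i * ((β - 1#) * entry X x j)
  scale-· x β β′ unit X i j = ≈-trans (rank1-· (δ x) (λ j → (β - 1#) * δ x j) β′ (scale-unit x β β′ unit) X i j)
    (+-congˡ (*-congˡ (sum-scaled (β - 1#) x (λ k → entry X k j))))

  scale-other : ∀ {x β β′} unit X {i} j → x ≢ i → entry (scale x β β′ unit ∙ X) i j ≈ entry X i j
  scale-other {x} {β} {β′} unit X {i} j x≢i = ≈-trans (scale-· x β β′ unit X i j)
    (≈-trans (+-congˡ (≈-trans (*-congʳ (δ-diff x≢i)) (zeroˡ _))) (+-identityʳ _))

  scale-target : ∀ {x β β′} unit X j → entry (scale x β β′ unit ∙ X) x j ≈ β * entry X x j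
  scale-target {x} {β} {β′} unit X j = ≈-trans (scale-· x β β′ unit X x j)
    (≈-trans (+-congˡ (*-congʳ (δ-same x))) (solve 2 (λ b e → e :+ :1 :* ((b :- :1) :* e) := b :* e) ≈-refl β _))

  private
    update-off : ∀ (x : Fin n) γ {i j} → i ≢ j → δ x i * (γ * δ x j) ≈ 0#
    update-off x γ {i} {j} i≢j with x Fin.≟ i | x Fin.≟ j
    ... | yes refl | yes refl = ⊥-elim (i≢j refl)
    ... | no _     | _        = zeroˡ _
    ... | yes _    | no _     = ≈-trans (*-congˡ (zeroʳ _)) (zeroʳ _)

  scale-diagonal : ∀ x β β′ unit {i j} → i ≢ j → entry (scale x β β′ unit) i j ≈ 0#
  scale-diagonal x β β′ unit {i} {j} i≢j = ≈-trans (scale-entries x β β′ unit i j) (≈-trans (+-cong (δ-diff i≢j) (update-off x (β - 1#) i≢j)) (+-identityʳ 0#))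

  scale-corner : ∀ x β β′ unit → entry (scale x β β′ unit) x x ≈ β
  scale-corner x β β′ unit = ≈-trans (scale-entries x β β′ unit x x) (≈-trans (+-cong (δ-same x) (*-cong (δ-same x) (*-congˡ (δ-same x))))
    (solve 1 (λ b → :1 :+ :1 :* ((b :- :1) :* :1) := b) ≈-refl β))

  -- A column operation. It serves to follow inverses: replacing g by A⁻¹ g replaces g⁻¹ by g⁻¹ A.
  ∙-addRow : ∀ x y x≢y X i j → entry (X ∙ addRow x y x≢y) i j ≈ entry X i j + entry X i y * δ x j
  ∙-addRow x y x≢y X i j = begin
    sum (λ k → entry X i k * entry (addRow x y x≢y) k j)           ≈⟨ sum-cong-≋ (λ k → *-congˡ (addRow-entries x y x≢y k j)) ⟩
    sum (λ k → entry X i k * (δ k j + δ y k * δ x j))              ≈⟨ sum-cong-≋ (λ k → ≈-trans (distribˡ (entry X i k) (δ k j) (δ y k * δ x j)) (+-congˡ (solve 3 (λ a b c → a :* (b :* c) := b :* (a :* c)) ≈-refl (entry X i k) (δ y k) (δ x j)))) ⟩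
    sum (λ k → entry X i k * δ k j + δ y k * (entry X i k * δ x j)) ≈⟨ ∑-distrib-+ (λ k → entry X i k * δ k j) _ ⟩
    sum (λ k → entry X i k * δ k j) + sum (λ k → δ y k * (entry X i k * δ x j)) ≈⟨ +-cong (sum-δʳ j (entry X i)) (sum-δˡ y (λ k → entry X i k * δ x j)) ⟩
    entry X i j + entry X i y * δ x j                              ∎

  M-entries : ∀ (x : Fin n) β i j → M F β x i j ≈ δ i j + δ x i * ((β - 1#) * δ x j)
  M-entries x β i j with i Fin.≟ j
  M-entries x β i j | no i≢j   = ≈-sym (≈-trans (+-identityˡ _) (update-off x (β - 1#) i≢j))
  M-entries x β i j | yes refl with i Fin.≟ x
  ... | yes refl = ≈-sym (≈-trans (+-congˡ (*-cong (δ-same x) (*-congˡ (δ-same x))))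
                     (solve 1 (λ b → :1 :+ :1 :* ((b :- :1) :* :1) := b) ≈-refl β))
  ... | no i≢x   = ≈-sym (≈-trans (+-congˡ (≈-trans (*-congʳ (δ-diff (i≢x ∘ ≡.sym))) (zeroˡ _))) (+-identityʳ _))

  M≋scale : ∀ x β β′ unit i j → M F β x i j ≈ entry (scale x β β′ unit) i j
  M≋scale x β β′ unit i j = ≈-trans (M-entries x β i j) (≈-sym (scale-entries x β β′ unit i j))

-- The subgroups Levi and Stab and their double cosets

module Levels {c ℓ q} (F : FiniteField c ℓ q) (n : ℕ) {s} (S : Pred (GL F n) s) (N : Fin n) where

  open FiniteField F hiding (zero) renaming (refl to ≈-refl; sym to ≈-sym; trans to ≈-trans; Carrier to K; invertible to inv-exists)
  open SemiringSum semiring using (sum)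
  open Solver commutativeRing
  open SetoidReasoning ≈-setoid
  open Matrices F
  open GLₙ n
  open Updates F n
  open Group group using (_∙_; ε; _⁻¹; inverseˡ; inverseʳ; assoc; ∙-congˡ) renaming (_≈_ to _≋_; sym to ≋-sym′)
  open Cayley group _≟_ S

  inverse : ∀ {x} → ¬ x ≈ 0# → ∃[ y ] y * x ≈ 1#
  inverse x≉0 with inv-exists _ x≉0
  ... | y , yx≈1 , _ = y , yx≈1

  inverse≉0 : ∀ {x y} → y * x ≈ 1# → ¬ x ≈ 0#
  inverse≉0 yx≈1 x≈0 = 1≉0 (≈-trans (≈-sym yx≈1) (≈-trans (*-congˡ x≈0) (zeroʳ _)))

  cancel-zero : ∀ {x y z} → y * x ≈ 1# → z * x ≈ 0# → z ≈ 0#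
  cancel-zero {x} {y} {z} yx≈1 zx≈0 = begin
    z            ≈⟨ *-identityʳ z ⟨
    z * 1#       ≈⟨ *-congˡ yx≈1 ⟨
    z * (y * x)  ≈⟨ solve 3 (λ x y z → z :* (y :* x) := y :* (z :* x)) ≈-refl x y z ⟩
    y * (z * x)  ≈⟨ ≈-trans (*-congˡ zx≈0) (zeroʳ y) ⟩
    0#           ∎

  sum-single : ∀ (f : Fin n → K) → (∀ k → k ≢ N → f k ≈ 0#) → sum f ≈ f N
  sum-single f f≈0 = ≈-trans (SemiringSum.sum-cong-≋ semiring lemma) (sum-δˡ N f)
    where
    lemma : ∀ k → f k ≈ δ N k * f k
    lemma k with N Fin.≟ k
    ... | yes _  = ≈-sym (*-identityˡ _)
    ... | no N≢k = ≈-trans (f≈0 k (N≢k ∘ ≡.sym)) (≈-sym (zeroˡ _))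

  -- The parabolic subgroup: the last column is a multiple of a unit vector.
  Stab : Pred (GL F n) ℓ
  Stab X = ∀ k → k ≢ N → entry X k N ≈ 0#

  -- Its Levi subgroup, GL(n-1) × GL(1).
  Levi : Pred (GL F n) ℓ
  Levi X = Stab X × (∀ l → l ≢ N → entry X N l ≈ 0#)

  column-∙ : ∀ X {Y} → Stab Y → ∀ i → entry (X ∙ Y) i N ≈ entry X i N * entry Y N N
  column-∙ X {Y} PY i = sum-single _ λ k k≢N → ≈-trans (*-congˡ (PY k k≢N)) (zeroʳ _)

  row-∙ : ∀ {X} Y → (∀ l → l ≢ N → entry X N l ≈ 0#) → ∀ j → entry (X ∙ Y) N j ≈ entry X N N * entry Y N j
  row-∙ Y PX j = sum-single _ λ k k≢N → ≈-trans (*-congʳ (PX k k≢N)) (zeroˡ _)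

  corner : ∀ {X} → Stab X → entry (X ⁻¹) N N * entry X N N ≈ 1#
  corner {X} PX = ≈-trans (≈-sym (column-∙ (X ⁻¹) {X} PX N)) (≈-trans (inverseˡ X N N) (δ-same N))

  Stab-⁻¹ : ∀ {X} → Stab X → Stab (X ⁻¹)
  Stab-⁻¹ {X} PX k k≢N = cancel-zero (corner {X} PX)
    (≈-trans (≈-sym (column-∙ (X ⁻¹) {X} PX k)) (≈-trans (inverseˡ X k N) (δ-diff k≢N)))

  Stab-∙ : ∀ {X Y} → Stab X → Stab Y → Stab (X ∙ Y)
  Stab-∙ {X} {Y} PX PY k k≢N = ≈-trans (column-∙ X {Y} PY k) (≈-trans (*-congʳ (PX k k≢N)) (zeroˡ _))

  stab : Subgroup ℓ
  stab = record
    { P         = Stab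
    ; resp      = λ X≋Y PX k k≢N → ≈-trans (≈-sym (X≋Y k N)) (PX k k≢N)
    ; ε-closed  = λ k k≢N → δ-diff k≢N
    ; ∙-closed  = λ {X} {Y} → Stab-∙ {X} {Y}
    ; ⁻¹-closed = λ {X} → Stab-⁻¹ {X}
    ; P?        = λ X → Fin.all? λ k → ¬? (k Fin.≟ N) →-dec (entry X k N ≟F 0#)
    }

  levi : Subgroup ℓ
  levi = record
    { P         = Levi
    ; resp      = λ {X} {Y} X≋Y (PX , QX) → Subgroup.resp stab {X} {Y} X≋Y PX , λ l l≢N → ≈-trans (≈-sym (X≋Y N l)) (QX l l≢N)
    ; ε-closed  = Subgroup.ε-closed stab , λ l l≢N → δ-diff (l≢N ∘ ≡.sym)
    ; ∙-closed  = λ {X} {Y} (PX , QX) (PY , QY) → Stab-∙ {X} {Y} PX PY ,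
        λ l l≢N → ≈-trans (row-∙ {X} Y QX l) (≈-trans (*-congˡ (QY l l≢N)) (zeroʳ _))
    ; ⁻¹-closed = λ {X} (PX , QX) → Stab-⁻¹ {X} PX , λ l l≢N → cancel-zero (corner {X} PX)
        (≈-trans (*-comm _ _) (≈-trans (≈-sym (row-∙ {X} (X ⁻¹) QX l)) (≈-trans (inverseʳ X N l) (δ-diff (l≢N ∘ ≡.sym)))))
    ; P?        = λ X → Subgroup.P? stab X ×-dec Fin.all? λ l → ¬? (l Fin.≟ N) →-dec (entry X N l ≟F 0#)
    }

  top : Subgroup ℓ
  top = record { P = λ _ → ⊤ ; resp = λ _ _ → tt ; ε-closed = tt ; ∙-closed = λ _ _ → tt ; ⁻¹-closed = λ _ → tt ; P? = λ _ → yes tt }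

  private
    pivot : ∀ (f : Fin n → K) → ¬ (∀ k → k ≢ N → f k ≈ 0#) → ∃[ k ] k ≢ N × ¬ f k ≈ 0#
    pivot f ¬f≈0 with Fin.¬∀⟶∃¬ n _ (λ k → ¬? (k Fin.≟ N) →-dec (f k ≟F 0#)) ¬f≈0
    ... | k , ¬p = k , (λ k≡N → ¬p λ k≢N → ⊥-elim (k≢N k≡N)) , (λ f≈0 → ¬p λ _ → f≈0)

  addRow-Stab : ∀ {x y} x≢y → x ≢ N → Stab (addRow x y x≢y)
  addRow-Stab {x} {y} x≢y x≢N k k≢N = ≈-trans (addRow-entries x y x≢y k N) (≈-trans (+-cong (δ-diff k≢N) (≈-trans (*-congˡ (δ-diff x≢N)) (zeroʳ _))) (+-identityʳ 0#))

  addRow-Levi : ∀ {x y} x≢y → x ≢ N → y ≢ N → Levi (addRow x y x≢y)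
  addRow-Levi {x} {y} x≢y x≢N y≢N = addRow-Stab x≢y x≢N , λ l l≢N → ≈-trans (addRow-entries x y x≢y N l)
    (≈-trans (+-cong (δ-diff (l≢N ∘ ≡.sym)) (≈-trans (*-congʳ (δ-diff y≢N)) (zeroˡ _))) (+-identityʳ 0#))

  addRow-entry : ∀ {x y} x≢y → entry (addRow x y x≢y) y x ≈ 1#
  addRow-entry {x} {y} x≢y = ≈-trans (addRow-entries x y x≢y y x) (≈-trans (+-cong (δ-diff (x≢y ∘ ≡.sym)) (≈-trans (*-cong (δ-same y) (δ-same x)) (*-identityˡ _))) (+-identityˡ _))

  module AddRow⁻¹ {x y : Fin n} (x≢y : x ≢ y) where

    t T : GL F n
    t = addRow x y x≢y
    T = t ⁻¹

    T-other : ∀ {i} j → y ≢ i → entry T i j ≈ δ i j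
    T-other {i} j y≢i = ≈-trans (≈-sym (addRow-other x≢y T j y≢i)) (inverseʳ t i j)

    T-target : ∀ j → entry T y j + entry T x j ≈ δ y j
    T-target j = ≈-trans (≈-sym (addRow-target x≢y T j)) (inverseʳ t y j)

    -- Row x of t⁻¹ X is row x of X.
    conj : ∀ u i j → entry (t ∙ u ∙ T) i j ≈ entry (u ∙ T) i j + δ y i * entry (u ∙ T) x j
    conj u i j = ≈-trans (assoc t u T i j) (addRow-· x y x≢y (u ∙ T) i j)

    t-· : ∀ X i j → entry (t ∙ X) i j ≈ entry X i j + δ y i * entry X x j
    t-· = addRow-· x y x≢y

  module StabToTop {j : Fin n} (N≢j : N ≢ j) (St : S (addRow N j N≢j)) where

    open AddRow⁻¹ N≢j

    -- u preserves the line of the last column of t⁻¹.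
    Commutes : GL F n → Set (c ⊔ ℓ)
    Commutes u = ∃[ λ′ ] ∀ i → entry (u ∙ T) i N ≈ λ′ * entry T i N

    commutes : ∀ u → Commutes u → Stab (t ∙ u ∙ T)
    commutes u (λ′ , uT) k k≢N = begin
      entry (t ∙ u ∙ T) k N                                    ≈⟨ conj u k N ⟩
      entry (u ∙ T) k N + δ j k * entry (u ∙ T) N N            ≈⟨ +-cong (uT k) (*-congˡ (uT N)) ⟩
      λ′ * entry T k N + δ j k * (λ′ * entry T N N)            ≈⟨ solve 4 (λ l a d b → l :* a :+ d :* (l :* b) := l :* (a :+ d :* b)) ≈-refl λ′ _ (δ j k) _ ⟩
      λ′ * (entry T k N + δ j k * entry T N N)                 ≈⟨ *-congˡ (t-· T k N) ⟨
      λ′ * entry (t ∙ T) k N                                   ≈⟨ *-congˡ (≈-trans (inverseʳ t k N) (δ-diff k≢N)) ⟩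
      λ′ * 0#                                                  ≈⟨ zeroʳ λ′ ⟩
      0#                                                       ∎

    t∉Stab : ¬ Stab t
    t∉Stab Pt = 1≉0 (≈-trans (≈-sym (addRow-entry N≢j)) (Pt j (N≢j ∘ ≡.sym)))

    h₀ : GL F n
    h₀ = addRow j N (N≢j ∘ ≡.sym)

    -- The last column of `T` is e_N - e_j; `h₀` turns it into -e_j, which `t` leaves alone and
    -- which is not on the line of e_N.
    spread : ¬ Stab (t ∙ h₀ ∙ T)
    spread Ph = 1≉0 (begin
      1#                                                       ≈⟨ one ⟨
      entry T N N                                              ≈⟨ +-identityˡ _ ⟨
      0# + entry T N N                                         ≈⟨ +-congʳ jN ⟨
      entry T j N + entry T N N                                ≈⟨ T-target N ⟩
      δ j N                                                    ≈⟨ δ-diff (N≢j ∘ ≡.sym) ⟩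
      0#                                                       ∎)
      where
      one : entry T N N ≈ 1#
      one = ≈-trans (T-other N (N≢j ∘ ≡.sym)) (δ-same N)
      jN : entry T j N ≈ 0#
      jN = begin
        entry T j N                                            ≈⟨ solve 2 (λ a b → a := a :+ (b :+ a) :- (a :+ b)) ≈-refl (entry T j N) (entry T N N) ⟩
        entry T j N + (entry T N N + entry T j N) - (entry T j N + entry T N N) ≈⟨ +-cong (+-cong (≈-sym (addRow-other (N≢j ∘ ≡.sym) T N N≢j)) (≈-sym (addRow-target (N≢j ∘ ≡.sym) T N))) (-‿cong (≈-trans (T-target N) (δ-diff (N≢j ∘ ≡.sym)))) ⟩
        entry (h₀ ∙ T) j N + entry (h₀ ∙ T) N N - 0#           ≈⟨ solve 2 (λ a b → a :+ b :- :0 := a :+ :1 :* b) ≈-refl (entry (h₀ ∙ T) j N) (entry (h₀ ∙ T) N N) ⟩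
        entry (h₀ ∙ T) j N + 1# * entry (h₀ ∙ T) N N           ≈⟨ +-congˡ (*-congʳ (δ-same j)) ⟨
        entry (h₀ ∙ T) j N + δ j j * entry (h₀ ∙ T) N N        ≈⟨ conj h₀ j N ⟨
        entry (t ∙ h₀ ∙ T) j N                                 ≈⟨ Ph j (N≢j ∘ ≡.sym) ⟩
        0#                                                     ∎

    -- Row operations fixing the last unit vector turn the last column y of g
    -- into e_N - e_j once y_j ≠ 0; then t turns it into e_N.
    double-pivot : ∀ g y⁻¹ → y⁻¹ * entry g j N ≈ 1# → ∃[ h ] Stab h × Stab (t ∙ (h ∙ g))
    double-pivot g y⁻¹ y⁻¹y≈1 = h , Ph , Pthg
      where
      y v : Fin n → K
      y k = entry g k N
      -- h = I + v ⊗ e_j sends y to y + y_j v, and v solves h y = e_N - e_j. The determinant 1 + v_j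
      -- equals -1 / y_j, whence the factor - y_j in `unit`.
      v k = (δ N k - δ j k - y k) * y⁻¹
      unit : - y j * (1# + sum (λ k → δ j k * v k)) ≈ 1#
      unit = begin
        - y j * (1# + sum (λ k → δ j k * v k))                 ≈⟨ *-congˡ (+-congˡ (≈-trans (sum-δˡ j v) (*-congʳ (+-congʳ (+-cong (δ-diff N≢j) (-‿cong (δ-same j))))))) ⟩
        - y j * (1# + (0# - 1# - y j) * y⁻¹)                   ≈⟨ solve 2 (λ y y′ → :- y :* (:1 :+ (:0 :- :1 :- y) :* y′) := :- y :+ (:1 :+ y) :* (y′ :* y)) ≈-refl (y j) y⁻¹ ⟩
        - y j + (1# + y j) * (y⁻¹ * y j)                       ≈⟨ +-congˡ (*-congˡ y⁻¹y≈1) ⟩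
        - y j + (1# + y j) * 1#                                ≈⟨ solve 1 (λ y → :- y :+ (:1 :+ y) :* :1 := :1) ≈-refl (y j) ⟩
        1#                                                     ∎
      h = rank1 v (δ j) (- y j) unit
      Ph : Stab h
      Ph k k≢N = ≈-trans (reflexive (rank1-entry v (δ j) (- y j) unit k N))
        (≈-trans (+-cong (δ-diff k≢N) (≈-trans (*-congˡ (δ-diff (N≢j ∘ ≡.sym))) (zeroʳ _))) (+-identityʳ 0#))
      hg : ∀ k → entry (h ∙ g) k N ≈ δ N k - δ j k
      hg k = begin
        entry (h ∙ g) k N                                      ≈⟨ rank1-· v (δ j) (- y j) unit g k N ⟩
        y k + v k * sum (λ l → δ j l * y l)                    ≈⟨ +-congˡ (*-congˡ (sum-δˡ j y)) ⟩
        y k + v k * y j                                        ≈⟨ solve 4 (λ y e y′ z → y :+ (e :- y) :* y′ :* z := y :+ (e :- y) :* (y′ :* z)) ≈-refl (y k) (δ N k - δ j k) y⁻¹ (y j) ⟩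
        y k + (δ N k - δ j k - y k) * (y⁻¹ * y j)              ≈⟨ +-congˡ (*-congˡ y⁻¹y≈1) ⟩
        y k + (δ N k - δ j k - y k) * 1#                       ≈⟨ solve 2 (λ y e → y :+ (e :- y) :* :1 := e) ≈-refl (y k) (δ N k - δ j k) ⟩
        δ N k - δ j k                                          ∎
      Pthg : Stab (t ∙ (h ∙ g))
      Pthg k k≢N = begin
        entry (t ∙ (h ∙ g)) k N                                ≈⟨ t-· (h ∙ g) k N ⟩
        entry (h ∙ g) k N + δ j k * entry (h ∙ g) N N          ≈⟨ +-cong (hg k) (*-congˡ (≈-trans (hg N) (+-cong (δ-same N) (-‿cong (δ-diff (N≢j ∘ ≡.sym)))))) ⟩
        δ N k - δ j k + δ j k * (1# - 0#)                      ≈⟨ solve 2 (λ a b → a :- b :+ b :* (:1 :- :0) := a) ≈-refl (δ N k) (δ j k) ⟩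
        δ N k                                                  ≈⟨ δ-diff (k≢N ∘ ≡.sym) ⟩
        0#                                                     ∎

    double : ∀ g → ¬ Stab g → ∃[ h ] Stab h × Stab (t ∙ (h ∙ g))
    double g ¬Pg = [ dependent , (λ yj≉0 → pivoted g (inverse yj≉0)) ]′ (toSum (entry g j N ≟F 0#))
      where
      pivoted : ∀ g → (∃[ y⁻¹ ] y⁻¹ * entry g j N ≈ 1#) → ∃[ h ] Stab h × Stab (t ∙ (h ∙ g))
      pivoted g (y⁻¹ , eq) = double-pivot g y⁻¹ eq
      dependent : entry g j N ≈ 0# → ∃[ h ] Stab h × Stab (t ∙ (h ∙ g))
      -- If y_j = 0, some y_k with k ≠ N is nonzero because g is outside Stab; adding row k to row j
      -- stays within the factor from Stab and makes y_j nonzero.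
      dependent yj≈0 = absorb (pivoted (e ∙ g) (inverse λ eg≈0 → yk≉0 (begin
          entry g k N                  ≈⟨ +-identityˡ _ ⟨
          0# + entry g k N             ≈⟨ +-congʳ yj≈0 ⟨
          entry g j N + entry g k N    ≈⟨ addRow-target k≢j g N ⟨
          entry (e ∙ g) j N            ≈⟨ eg≈0 ⟩
          0#                           ∎)))
        where
        k = proj₁ (pivot (λ k → entry g k N) ¬Pg)
        k≢N = proj₁ (proj₂ (pivot (λ k → entry g k N) ¬Pg))
        yk≉0 = proj₂ (proj₂ (pivot (λ k → entry g k N) ¬Pg))
        k≢j : k ≢ j
        k≢j k≡j = yk≉0 (≈-trans (reflexive (≡.cong (λ k → entry g k N) k≡j)) yj≈0)
        e = addRow k j k≢j
        absorb : ∃[ h ] Stab h × Stab (t ∙ (h ∙ (e ∙ g))) → ∃[ h ] Stab h × Stab (t ∙ (h ∙ g))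
        absorb (h , Ph , Pthg) = h ∙ e , Stab-∙ {h} {e} Ph (addRow-Stab k≢j k≢N) ,
          Subgroup.resp stab {t ∙ (h ∙ (e ∙ g))} {t ∙ ((h ∙ e) ∙ g)} (∙-congˡ {t} {h ∙ (e ∙ g)} {(h ∙ e) ∙ g} (≋-sym′ {(h ∙ e) ∙ g} {h ∙ (e ∙ g)} (assoc h e g))) Pthg

    stabToTop : ∀ u w → Stab u → Stab w → Commutes u → Commutes w →
      ¬ ε ≋ u → ¬ ε ≋ w → ¬ u ≋ w → HamConn Stab → HamConn (Subgroup.P top)
    stabToTop u w Pu Pw Cu Cw ε≉u ε≉w u≉w = Extension.extension stab top (λ _ → tt) t St tt t∉Stab h₀
      (addRow-Stab (N≢j ∘ ≡.sym) (N≢j ∘ ≡.sym)) spread (λ g _ → double g) u w Pu Pw (commutes u Cu) (commutes w Cw) ε≉u ε≉w u≉w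

    -- A third index k supplies `u` and `w`: entry k of the last column of `T` is 0, so adding row k
    -- to another row fixes this column.
    stabToTop≥3 : ∀ k → k ≢ j → k ≢ N → HamConn Stab → HamConn (Subgroup.P top)
    stabToTop≥3 k k≢j k≢N = stabToTop (addRow k j k≢j) (addRow k N k≢N) (addRow-Stab k≢j k≢N) (addRow-Stab k≢N k≢N)
      (1# , agree k≢j) (1# , agree k≢N)
      (λ e → 1≉0 (≈-trans (≈-sym (addRow-entry k≢j)) (≈-trans (≈-sym (e j k)) (δ-diff (k≢j ∘ ≡.sym)))))
      (λ e → 1≉0 (≈-trans (≈-sym (addRow-entry k≢N)) (≈-trans (≈-sym (e N k)) (δ-diff (k≢N ∘ ≡.sym)))))
      (λ e → 1≉0 (≈-trans (≈-sym (addRow-entry k≢j)) (≈-trans (e j k) (≈-trans (addRow-entries k N k≢N j k)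
        (≈-trans (+-cong (δ-diff (k≢j ∘ ≡.sym)) (≈-trans (*-congʳ (δ-diff N≢j)) (zeroˡ _))) (+-identityʳ 0#))))))
      where
      agree : ∀ {y} (k≢y : k ≢ y) i → entry (addRow k y k≢y ∙ T) i N ≈ 1# * entry T i N
      agree {y} k≢y i = begin
        entry (addRow k y k≢y ∙ T) i N         ≈⟨ addRow-· k y k≢y T i N ⟩
        entry T i N + δ y i * entry T k N      ≈⟨ +-congˡ (*-congˡ (≈-trans (T-other {k} N (k≢j ∘ ≡.sym)) (δ-diff k≢N))) ⟩
        entry T i N + δ y i * 0#               ≈⟨ solve 2 (λ a b → a :+ b :* :0 := :1 :* a) ≈-refl (entry T i N) (δ y i) ⟩
        1# * entry T i N                       ∎

  scale-Levi : ∀ x β β′ unit → Levi (scale x β β′ unit)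
  scale-Levi x β β′ unit = (λ k k≢N → scale-diagonal x β β′ unit k≢N) , λ l l≢N → scale-diagonal x β β′ unit (l≢N ∘ ≡.sym)

  module LeviToStab {i : Fin n} (i≢N : i ≢ N) (St : S (addRow i N i≢N)) where

    open AddRow⁻¹ i≢N

    -- u multiplies rows i and N of t⁻¹ by the same scalar.
    Commutes : GL F n → Set (c ⊔ ℓ)
    Commutes u = ∃[ λ′ ] (∀ j → entry (u ∙ T) N j ≈ λ′ * entry T N j) × (∀ j → entry (u ∙ T) i j ≈ λ′ * entry T i j)

    last-row : ∀ u l → entry (t ∙ u ∙ T) N l ≈ entry (u ∙ T) N l + entry (u ∙ T) i l
    last-row u l = ≈-trans (assoc t u T N l) (addRow-target i≢N (u ∙ T) l)

    Stab-t : Stab t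
    Stab-t = addRow-Stab i≢N i≢N

    commutes : ∀ u → Stab u → Commutes u → Levi (t ∙ u ∙ T)
    commutes u Pu (λ′ , uN , ui) = Stab-∙ {t ∙ u} {T} (Stab-∙ {t} {u} Stab-t Pu) (Stab-⁻¹ {t} Stab-t) , λ l l≢N → begin
      entry (t ∙ u ∙ T) N l                         ≈⟨ last-row u l ⟩
      entry (u ∙ T) N l + entry (u ∙ T) i l         ≈⟨ +-cong (uN l) (ui l) ⟩
      λ′ * entry T N l + λ′ * entry T i l           ≈⟨ distribˡ λ′ (entry T N l) (entry T i l) ⟨
      λ′ * (entry T N l + entry T i l)              ≈⟨ *-congˡ (≈-trans (T-target l) (δ-diff (l≢N ∘ ≡.sym))) ⟩
      λ′ * 0#                                       ≈⟨ zeroʳ λ′ ⟩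
      0#                                            ∎

    t∉Levi : ¬ Levi t
    t∉Levi (_ , Qt) = 1≉0 (≈-trans (≈-sym (addRow-entry i≢N)) (Qt i i≢N))

    -- Rows N and i of `T` are e_N - e_i and e_i. Adding row k to row i and then applying `t` makes
    -- row N equal to e_N + e_k.
    spread-addRow : ∀ {k} (k≢i : k ≢ i) → k ≢ N → ¬ Levi (t ∙ addRow k i k≢i ∙ T)
    spread-addRow {k} k≢i k≢N (_ , Q) = 1≉0 (begin
      1#                                              ≈⟨ +-identityˡ 1# ⟨
      0# + 1#                                         ≈⟨ +-cong (≈-trans (T-target k) (δ-diff (k≢N ∘ ≡.sym))) (≈-trans (T-other k (k≢N ∘ ≡.sym)) (δ-same k)) ⟨
      entry T N k + entry T i k + entry T k k         ≈⟨ +-assoc _ _ _ ⟩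
      entry T N k + (entry T i k + entry T k k)       ≈⟨ +-cong (addRow-other k≢i T k i≢N) (addRow-target k≢i T k) ⟨
      entry (u ∙ T) N k + entry (u ∙ T) i k           ≈⟨ last-row u k ⟨
      entry (t ∙ u ∙ T) N k                           ≈⟨ Q k k≢N ⟩
      0#                                              ∎)
      where u = addRow k i k≢i

    -- Here row N of the conjugate is e_N + (β - 1) e_i.
    spread-scale : ∀ β β′ unit → ¬ β ≈ 1# → ¬ Levi (t ∙ scale i β β′ unit ∙ T)
    spread-scale β β′ unit β≉1 (_ , Q) = β≉1 (begin
      β                                               ≈⟨ solve 1 (λ b → b := (:0 :+ b :* :1 :- :1) :+ :1) ≈-refl β ⟩
      (0# + β * 1# - 1#) + 1#                         ≈⟨ +-congʳ (+-cong (+-cong (≈-trans (T-target i) (δ-diff (i≢N ∘ ≡.sym))) (*-congˡ ii)) (-‿cong ii)) ⟨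
      (entry T N i + entry T i i + β * entry T i i - entry T i i) + 1# ≈⟨ +-congʳ (solve 3 (λ a b c → a :+ b :+ c :* b :- b := a :+ c :* b) ≈-refl (entry T N i) (entry T i i) β) ⟩
      (entry T N i + β * entry T i i) + 1#            ≈⟨ +-congʳ (+-cong (scale-other unit T i i≢N) (scale-target unit T i)) ⟨
      (entry (u ∙ T) N i + entry (u ∙ T) i i) + 1#    ≈⟨ +-congʳ (last-row u i) ⟨
      entry (t ∙ u ∙ T) N i + 1#                      ≈⟨ +-congʳ (Q i i≢N) ⟩
      0# + 1#                                         ≈⟨ +-identityˡ 1# ⟩
      1#                                              ∎)
      where
      u = scale i β β′ unit
      ii : entry T i i ≈ 1#
      ii = ≈-trans (T-other i (i≢N ∘ ≡.sym)) (δ-same i)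

    -- t h maps to Levi g⁻¹ iff rows N and i of h add up to a multiple of row N of g⁻¹.
    double-pivot : ∀ g → Stab g → ∀ r → r * entry (g ⁻¹) N i ≈ 1# → ∃[ h ] Levi h × Levi (t ∙ (h ∙ g))
    double-pivot g Pg r rρ≈1 = h , Lh , Stab-∙ {t} {h ∙ g} Stab-t (Stab-∙ {h} {g} (proj₁ Lh) Pg) , row
      where
      ρ a : Fin n → K
      ρ l = entry (g ⁻¹) N l
      -- Row i of E = I + e_i ⊗ a is ρ with its entry N removed, and D puts ρ_N into the corner, so
      -- rows i and N of D E add up to ρ. The determinant of E is 1 + a_i = ρ_i.
      a l = ρ l - δ i l - δ N l * ρ N
      unit : r * (1# + sum (λ k → a k * δ i k)) ≈ 1#
      unit = begin
        r * (1# + sum (λ k → a k * δ i k))            ≈⟨ *-congˡ (+-congˡ (SemiringSum.sum-cong-≋ semiring λ k → *-comm (a k) (δ i k))) ⟩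
        r * (1# + sum (λ k → δ i k * a k))            ≈⟨ *-congˡ (+-congˡ (≈-trans (sum-δˡ i a) (+-cong (+-congˡ (-‿cong (δ-same i))) (-‿cong (*-congʳ (δ-diff (i≢N ∘ ≡.sym))))))) ⟩
        r * (1# + (ρ i - 1# - 0# * ρ N))              ≈⟨ solve 3 (λ r x y → r :* (:1 :+ (x :- :1 :- :0 :* y)) := r :* x) ≈-refl r (ρ i) (ρ N) ⟩
        r * ρ i                                       ≈⟨ rρ≈1 ⟩
        1#                                            ∎
      unit′ : entry g N N * ρ N ≈ 1#
      unit′ = ≈-trans (*-comm _ _) (corner {g} Pg)
      E D h : GL F n
      E = rank1 (δ i) a r unit
      D = scale N (ρ N) (entry g N N) unit′
      h = D ∙ E
      Eij : ∀ k l → entry E k l ≈ δ k l + δ i k * a l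
      Eij k l = reflexive (rank1-entry (δ i) a r unit k l)
      LE : Levi E
      LE = (λ k k≢N → ≈-trans (Eij k N) (≈-trans (+-cong (δ-diff k≢N) (≈-trans (*-congˡ aN) (zeroʳ _))) (+-identityʳ 0#))) ,
           (λ l l≢N → ≈-trans (Eij N l) (≈-trans (+-cong (δ-diff (l≢N ∘ ≡.sym)) (≈-trans (*-congʳ (δ-diff i≢N)) (zeroˡ _))) (+-identityʳ 0#)))
        where
        aN : a N ≈ 0#
        aN = ≈-trans (+-cong (+-congˡ (-‿cong (δ-diff i≢N))) (-‿cong (*-congʳ (δ-same N))))
          (solve 1 (λ x → x :- :0 :- :1 :* x := :0) ≈-refl (ρ N))
      Lh : Levi h
      Lh = Subgroup.∙-closed levi {D} {E} (scale-Levi N _ _ unit′) LE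
      hρ : ∀ k → entry h N k + entry h i k ≈ ρ k
      hρ k = begin
        entry h N k + entry h i k                     ≈⟨ +-cong (scale-target unit′ E k) (scale-other unit′ E k (i≢N ∘ ≡.sym)) ⟩
        ρ N * entry E N k + entry E i k               ≈⟨ +-cong (*-congˡ (Eij N k)) (Eij i k) ⟩
        ρ N * (δ N k + δ i N * a k) + (δ i k + δ i i * a k) ≈⟨ +-cong (*-congˡ (+-congˡ (*-congʳ (δ-diff i≢N)))) (+-congˡ (*-congʳ (δ-same i))) ⟩
        ρ N * (δ N k + 0# * a k) + (δ i k + 1# * a k) ≈⟨ solve 4 (λ x e d y → x :* (e :+ :0 :* (y :- d :- e :* x)) :+ (d :+ :1 :* (y :- d :- e :* x)) := y) ≈-refl (ρ N) (δ N k) (δ i k) (ρ k) ⟩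
        ρ k                                           ∎
      row : ∀ l → l ≢ N → entry (t ∙ (h ∙ g)) N l ≈ 0#
      row l l≢N = begin
        entry (t ∙ (h ∙ g)) N l                       ≈⟨ addRow-target i≢N (h ∙ g) l ⟩
        entry (h ∙ g) N l + entry (h ∙ g) i l         ≈⟨ SemiringSum.∑-distrib-+ semiring (λ k → entry h N k * entry g k l) (λ k → entry h i k * entry g k l) ⟨
        sum (λ k → entry h N k * entry g k l + entry h i k * entry g k l) ≈⟨ SemiringSum.sum-cong-≋ semiring (λ k → ≈-trans (≈-sym (distribʳ (entry g k l) (entry h N k) (entry h i k))) (*-congʳ (hρ k))) ⟩
        sum (λ k → ρ k * entry g k l)                 ≈⟨ ≈-trans (inverseˡ g N l) (δ-diff (l≢N ∘ ≡.sym)) ⟩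
        0#                                            ∎

    double : ∀ g → Stab g → ¬ Levi g → ∃[ h ] Levi h × Levi (t ∙ (h ∙ g))
    double g Pg ¬Lg = [ dependent , (λ ρ≉0 → pivoted g Pg (inverse ρ≉0)) ]′ (toSum (entry (g ⁻¹) N i ≟F 0#))
      where
      pivoted : ∀ g → Stab g → (∃[ r ] r * entry (g ⁻¹) N i ≈ 1#) → ∃[ h ] Levi h × Levi (t ∙ (h ∙ g))
      pivoted g Pg (r , eq) = double-pivot g Pg r eq
      dependent : entry (g ⁻¹) N i ≈ 0# → ∃[ h ] Levi h × Levi (t ∙ (h ∙ g))
      -- If ρ_i = 0, some ρ_k with k ≠ N is nonzero. Passing from g to e g with e = A_ik⁻¹
      -- multiplies g⁻¹ by A_ik on the right, which adds ρ_k to ρ_i.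
      dependent ρi≈0 = absorb (pivoted (e ∙ g) (Stab-∙ {e} {g} (proj₁ Le) Pg) (inverse λ eg≈0 → ρk≉0 (begin
          entry (g ⁻¹) N k                                   ≈⟨ solve 1 (λ a → a := :0 :+ a :* :1) ≈-refl (entry (g ⁻¹) N k) ⟩
          0# + entry (g ⁻¹) N k * 1#                         ≈⟨ +-cong ρi≈0 (*-congˡ (δ-same i)) ⟨
          entry (g ⁻¹) N i + entry (g ⁻¹) N k * δ i i        ≈⟨ ∙-addRow i k i≢k (g ⁻¹) N i ⟨
          entry (g ⁻¹ ∙ addRow i k i≢k) N i                  ≈⟨ eg≈0 ⟩
          0#                                                 ∎)))
        where
        g⁻¹∉Levi : ¬ (∀ k → k ≢ N → entry (g ⁻¹) N k ≈ 0#)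
        g⁻¹∉Levi Q = ¬Lg (Subgroup.⁻¹-closed levi {g ⁻¹} (Stab-⁻¹ {g} Pg , Q))
        k = proj₁ (pivot (λ k → entry (g ⁻¹) N k) g⁻¹∉Levi)
        k≢N = proj₁ (proj₂ (pivot (λ k → entry (g ⁻¹) N k) g⁻¹∉Levi))
        ρk≉0 = proj₂ (proj₂ (pivot (λ k → entry (g ⁻¹) N k) g⁻¹∉Levi))
        i≢k : i ≢ k
        i≢k i≡k = ρk≉0 (≈-trans (reflexive (≡.cong (λ k → entry (g ⁻¹) N k) (≡.sym i≡k))) ρi≈0)
        e = addRow i k i≢k ⁻¹
        Le : Levi e
        Le = Subgroup.⁻¹-closed levi {addRow i k i≢k} (addRow-Levi i≢k i≢N k≢N)
        absorb : ∃[ h ] Levi h × Levi (t ∙ (h ∙ (e ∙ g))) → ∃[ h ] Levi h × Levi (t ∙ (h ∙ g))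
        absorb (h , Lh , Lthg) = h ∙ e , Subgroup.∙-closed levi {h} {e} Lh Le ,
          Subgroup.resp levi {t ∙ (h ∙ (e ∙ g))} {t ∙ ((h ∙ e) ∙ g)} (∙-congˡ {t} {h ∙ (e ∙ g)} {(h ∙ e) ∙ g} (≋-sym′ {(h ∙ e) ∙ g} {h ∙ (e ∙ g)} (assoc h e g))) Lthg

    leviToStab : ∀ h₀ → Levi h₀ → ¬ Levi (t ∙ h₀ ∙ T) → ∀ u w → Levi u → Levi w → Commutes u → Commutes w →
      ¬ ε ≋ u → ¬ ε ≋ w → ¬ u ≋ w → HamConn Levi → HamConn Stab
    leviToStab h₀ Lh₀ spread u w Lu Lw Cu Cw = Extension.extension levi stab proj₁ t St Stab-t t∉Levi h₀ Lh₀ spread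
      double u w Lu Lw (commutes u (proj₁ Lu) Cu) (commutes w (proj₁ Lw) Cw)

    commutes-addRow : ∀ {x y} (x≢y : x ≢ y) → y ≢ i → y ≢ N → Commutes (addRow x y x≢y)
    commutes-addRow x≢y y≢i y≢N = 1# ,
      (λ j → ≈-trans (addRow-other x≢y T j y≢N) (≈-sym (*-identityˡ _))) ,
      (λ j → ≈-trans (addRow-other x≢y T j y≢i) (≈-sym (*-identityˡ _)))

    commutes-scale : ∀ {x} β β′ unit → x ≢ i → x ≢ N → Commutes (scale x β β′ unit)
    commutes-scale β β′ unit x≢i x≢N = 1# ,
      (λ j → ≈-trans (scale-other unit T j x≢N) (≈-sym (*-identityˡ _))) ,
      (λ j → ≈-trans (scale-other unit T j x≢i) (≈-sym (*-identityˡ _)))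

-- The order of α, and the step from GL(n-1) to GL(n-1) × GL(1)

least : ∀ {p} {P : Pred ℕ p} → Unary.Decidable P → ∀ n → P n → ∃[ m ] P m × (∀ i → i < m → ¬ P i)
least P? zero    p = 0 , p , λ i ()
least {P = P} P? (suc n) p with P? 0
... | yes p₀ = 0 , p₀ , λ i ()
... | no ¬p₀ with least {P = P ∘ suc} (P? ∘ suc) n p
...   | m , pm , below = suc m , pm , λ { zero _ → ¬p₀ ; (suc i) (s<s i<m) → below i i<m }

module Order {c ℓ q} (F : FiniteField c ℓ q) (α : FiniteField.Carrier F) (generates : IsGenerator F α) where

  open FiniteField F hiding (zero) renaming (refl to ≈-refl; sym to ≈-sym; trans to ≈-trans; Carrier to K; invertible to inv-exists)
  open Matrices F
  open Exp semiring using (_^_; ^-homo-*; ^-assocʳ; ^-congˡ)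

  α≉0 : ¬ α ≈ 0#
  α≉0 = proj₁ generates

  abstract
    α⁻¹ : K
    α⁻¹ = proj₁ (inv-exists α α≉0)

    α⁻¹α : α⁻¹ * α ≈ 1#
    α⁻¹α = proj₁ (proj₂ (inv-exists α α≉0))

  private
    α⁻¹≉0 : ¬ α⁻¹ ≈ 0#
    α⁻¹≉0 e = 1≉0 (≈-trans (≈-sym α⁻¹α) (≈-trans (*-congʳ e) (zeroˡ α)))

  abstract
    -- The inverse of α is itself a power α^k, so α^(k+1) = 1; the least such positive exponent is
    -- the order.
    period : ∃[ m ] α ^ suc m ≈ 1# × (∀ i → i < m → ¬ α ^ suc i ≈ 1#)
    period with proj₂ generates α⁻¹ α⁻¹≉0
    ... | k , e = least (λ i → α ^ suc i ≟F 1#) k (≈-trans (*-comm α _) (≈-trans (*-congʳ (≈-sym e)) α⁻¹α))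

  m-1 m : ℕ
  m-1 = proj₁ period
  m = suc m-1

  α^m : α ^ m ≈ 1#
  α^m = proj₁ (proj₂ period)

  α^i≉1 : ∀ i → 0 < i → i < m → ¬ α ^ i ≈ 1#
  α^i≉1 (suc i) _ (s<s i<m) = proj₂ (proj₂ period) i i<m

  1^ : ∀ n → 1# ^ n ≈ 1#
  1^ zero    = ≈-refl
  1^ (suc n) = ≈-trans (*-identityˡ _) (1^ n)

  α^mk : ∀ k → α ^ (k ℕ.* m) ≈ 1#
  α^mk k = ≈-trans (reflexive (≡.cong (α ^_) (ℕ.*-comm k m)))
    (≈-trans (≈-sym (^-assocʳ α m k)) (≈-trans (^-congˡ k α^m) (1^ k)))

  α^% : ∀ k → α ^ k ≈ α ^ (k % m)
  α^% k = ≈-trans (reflexive (≡.cong (α ^_) (m≡m%n+[m/n]*n k m)))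
    (≈-trans (^-homo-* α (k % m) (k / m ℕ.* m)) (≈-trans (*-congˡ (α^mk (k / m))) (*-identityʳ _)))

  log : ∀ x → ¬ x ≈ 0# → ∃[ i ] i < m × x ≈ α ^ i
  log x x≉0 with proj₂ generates x x≉0
  ... | k , e = k % m , m%n<n k m , ≈-trans e (α^% k)

  α^≉0 : ∀ i → ¬ α ^ i ≈ 0#
  α^≉0 zero    e = 1≉0 e
  α^≉0 (suc i) e = α^≉0 i (≈-trans (≈-sym (*-identityˡ _)) (≈-trans (*-congʳ (≈-sym α⁻¹α))
    (≈-trans (*-assoc _ _ _) (≈-trans (*-congˡ e) (zeroʳ _)))))

module Unipotent {c ℓ q} (F : FiniteField c ℓ q) (α : FiniteField.Carrier F) (generates : IsGenerator F α)
  (n : ℕ) {s} (S : Pred (GL F n) s) (N : Fin n) where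

  open FiniteField F hiding (zero) renaming (refl to ≈-refl; sym to ≈-sym; trans to ≈-trans; Carrier to K; invertible to inv-exists)
  open Matrices F
  open Order F α generates
  open Exp semiring using (_^_)
  open GLₙ n
  open Updates F n
  open Levels F n S N
  open Group group using (_∙_; ε; _⁻¹; inverseˡ; inverseʳ) renaming (_≈_ to _≋_)
  open Cayley group _≟_ S

  -- GL(n-1) as a subgroup of GL(n).
  Levi₁ : Pred (GL F n) ℓ
  Levi₁ X = Levi X × entry X N N ≈ 1#

  corner-∙ : ∀ X {Y} → Stab Y → entry (X ∙ Y) N N ≈ entry X N N * entry Y N N
  corner-∙ X {Y} PY = column-∙ X {Y} PY N

  levi₁ : Subgroup ℓ
  levi₁ = record
    { P         = Levi₁
    ; resp      = λ {X} {Y} X≋Y (L , e) → Subgroup.resp levi {X} {Y} X≋Y L , ≈-trans (≈-sym (X≋Y N N)) e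
    ; ε-closed  = Subgroup.ε-closed levi , δ-same N
    ; ∙-closed  = λ {X} {Y} (LX , eX) (LY , eY) → Subgroup.∙-closed levi {X} {Y} LX LY ,
        ≈-trans (corner-∙ X {Y} (proj₁ LY)) (≈-trans (*-cong eX eY) (*-identityˡ 1#))
    ; ⁻¹-closed = λ {X} (LX , eX) → Subgroup.⁻¹-closed levi {X} LX ,
        ≈-trans (≈-sym (*-identityʳ _)) (≈-trans (*-congˡ (≈-sym eX)) (corner {X} (proj₁ LX)))
    ; P?        = λ X → Subgroup.P? levi X ×-dec (entry X N N ≟F 1#)
    }

  module _ (Sb : S (scale N α α⁻¹ α⁻¹α)) where

    private
      b : GL F n
      b = scale N α α⁻¹ α⁻¹α

      Lb : Levi b
      Lb = scale-Levi N α α⁻¹ α⁻¹α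

      normal : ∀ {x} → Levi₁ x → Levi₁ (b ∙ x ∙ b ⁻¹)
      normal {x} (Lx , ex) = Subgroup.∙-closed levi {b ∙ x} {b ⁻¹} (Subgroup.∙-closed levi {b} {x} Lb Lx) Lb⁻¹ ,
        ≈-trans (corner-∙ (b ∙ x) {b ⁻¹} (proj₁ Lb⁻¹)) (≈-trans
          (*-congʳ (≈-trans (corner-∙ b {x} (proj₁ Lx)) (≈-trans (*-congˡ ex) (*-identityʳ _))))
          (≈-trans (*-comm _ _) (corner {b} (proj₁ Lb))))
        where
        Lb⁻¹ : Levi (b ⁻¹)
        Lb⁻¹ = Subgroup.⁻¹-closed levi {b} Lb

      power-Levi : ∀ X i → Levi X → Levi (iterate (b ∙_) X i)
      power-Levi X zero    LX = LX
      power-Levi X (suc i) LX = power-Levi (b ∙ X) i (Subgroup.∙-closed levi {b} {X} Lb LX)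

      power-corner : ∀ X i → entry (iterate (b ∙_) X i) N N ≈ α ^ i * entry X N N
      power-corner X zero    = ≈-sym (*-identityˡ _)
      power-corner X (suc i) = ≈-trans (power-corner (b ∙ X) i)
        (≈-trans (*-congˡ (scale-target α⁻¹α X N)) (≈-trans (≈-sym (*-assoc _ _ _)) (*-congʳ (*-comm _ _))))

      power-corner₁ : ∀ i → entry (iterate (b ∙_) ε i) N N ≈ α ^ i
      power-corner₁ i = ≈-trans (power-corner ε i) (≈-trans (*-congˡ (δ-same N)) (*-identityʳ _))

      -- The cosets of `Levi₁` in `Levi` are told apart by the corner entry, and the corner of b^i
      -- is α^i, so the index of a coset is a discrete logarithm.
      cover : ∀ g → Levi g → ∃[ i ] i < m × Levi₁ (g ∙ iterate (b ∙_) ε i ⁻¹)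
      cover g Lg = i , proj₁ (proj₂ lg) , Subgroup.∙-closed levi {g} {bⁱ ⁻¹} Lg Lbⁱ⁻¹ ,
        ≈-trans (corner-∙ g {bⁱ ⁻¹} (proj₁ Lbⁱ⁻¹)) (≈-trans (*-congʳ (≈-trans (proj₂ (proj₂ lg)) (≈-sym (power-corner₁ i))))
          (≈-trans (*-comm _ _) (corner {bⁱ} (proj₁ Lbⁱ))))
        where
        lg = log (entry g N N) (inverse≉0 (corner {g} (proj₁ Lg)))
        i = proj₁ lg
        bⁱ : GL F n
        bⁱ = iterate (b ∙_) ε i
        Lbⁱ : Levi bⁱ
        Lbⁱ = power-Levi ε i (Subgroup.ε-closed levi)
        Lbⁱ⁻¹ : Levi (bⁱ ⁻¹)
        Lbⁱ⁻¹ = Subgroup.⁻¹-closed levi {bⁱ} Lbⁱ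

      apart : ∀ i → 0 < i → i < suc m-1 → ¬ Levi₁ (iterate (b ∙_) ε i)
      apart i 0<i i<m (_ , e) = α^i≉1 i 0<i i<m (≈-trans (≈-sym (power-corner₁ i)) e)

    levi₁ToLevi : ∀ u w → Levi₁ u → Levi₁ w → ¬ ε ≋ u → ¬ ε ≋ w → ¬ u ≋ w → HamConn Levi₁ → HamConn Levi
    levi₁ToLevi u w Lu Lw ε≉u ε≉w u≉w hc = CosetRow.cosetRow levi₁ levi proj₁ b Sb Lb (λ {x} → normal {x}) m-1
      apart cover u w Lu Lw ε≉u ε≉w u≉w hc

-- GL(n-1) as a group of block matrices

fin-elim : ∀ {k p} {P : Fin (suc k) → Set p} → P (fromℕ k) → (∀ i → P (inject₁ i)) → ∀ i → P i
fin-elim {P = P} p f i with view i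
... | ‵fromℕ       = p
... | ‵inj₁ {i = j} _ = f j

module Embedding {c ℓ q} (F : FiniteField c ℓ q) (k : ℕ) where

  open FiniteField F hiding (zero) renaming (refl to ≈-refl; sym to ≈-sym; trans to ≈-trans; Carrier to K; invertible to inv-exists)
  open SemiringSum semiring using (sum; sum-cong-≋; sum-init-last)
  open Matrices F
  private
    module G = GLₙ k
    module G′ = GLₙ (suc k)
    N = fromℕ k

    extend : Matrix F k → Matrix F (suc k)
    extend B i j = go (view i) (view j)
      where
      go : ∀ {i j : Fin (suc k)} → View i → View j → K
      go ‵fromℕ ‵fromℕ = 1#
      go ‵fromℕ (‵inj₁ _) = 0#
      go (‵inj₁ _) ‵fromℕ = 0#
      go (‵inj₁ {i = i} _) (‵inj₁ {i = j} _) = B i j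

    extend-inner : ∀ B i j → extend B (inject₁ i) (inject₁ j) ≡ B i j
    extend-inner B i j rewrite view-inject₁ i | view-inject₁ j = refl

    extend-row : ∀ B j → extend B N (inject₁ j) ≡ 0#
    extend-row B j rewrite view-fromℕ k | view-inject₁ j = refl

    extend-column : ∀ B i → extend B (inject₁ i) N ≡ 0#
    extend-column B i rewrite view-fromℕ k | view-inject₁ i = refl

    extend-corner : ∀ B → extend B N N ≡ 1#
    extend-corner B rewrite view-fromℕ k = refl

  N≢inject₁ : ∀ {i : Fin k} → fromℕ k ≢ inject₁ i
  N≢inject₁ = Fin.fromℕ≢inject₁

  block-≋ : ∀ {X Y : Matrix F (suc k)} → (∀ i j → X (inject₁ i) (inject₁ j) ≈ Y (inject₁ i) (inject₁ j)) →
    (∀ j → X N (inject₁ j) ≈ Y N (inject₁ j)) → (∀ i → X (inject₁ i) N ≈ Y (inject₁ i) N) → X N N ≈ Y N N →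
    ∀ i j → X i j ≈ Y i j
  block-≋ {X} {Y} inner row column cornr = fin-elim {P = λ i → ∀ j → X i j ≈ Y i j}
    (fin-elim {P = λ j → X N j ≈ Y N j} cornr row)
    (λ i → fin-elim {P = λ j → X (inject₁ i) j ≈ Y (inject₁ i) j} (column i) (inner i))

  private
    split : ∀ (f : Fin (suc k) → K) → sum f ≈ sum (f ∘ inject₁) + f N
    split = sum-init-last

    extend-· : ∀ B C i j → _·_ F (extend B) (extend C) i j ≈ extend (_·_ F B C) i j
    extend-· B C = block-≋
      (λ i j → ≈-trans (split (f (inject₁ i) (inject₁ j))) (≈-trans (+-cong
        (sum-cong-≋ λ l → *-cong (reflexive (extend-inner B i l)) (reflexive (extend-inner C l j)))
        (kill (extend-column B i)))
        (≈-trans (+-identityʳ _) (reflexive (≡.sym (extend-inner (_·_ F B C) i j))))))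
      (λ j → ≈-trans (split (f N (inject₁ j))) (≈-trans (+-cong
        (sum-zero λ l → kill (extend-row B l))
        (kill′ (extend-row C j)))
        (≈-trans (+-identityʳ _) (reflexive (≡.sym (extend-row (_·_ F B C) j))))))
      (λ i → ≈-trans (split (f (inject₁ i) N)) (≈-trans (+-cong
        (sum-zero λ l → kill′ (extend-column C l))
        (kill (extend-column B i)))
        (≈-trans (+-identityʳ _) (reflexive (≡.sym (extend-column (_·_ F B C) i))))))
      (≈-trans (split (f N N)) (≈-trans (+-cong
        (sum-zero λ l → kill (extend-row B l))
        (*-cong (reflexive (extend-corner B)) (reflexive (extend-corner C))))
        (≈-trans (+-identityˡ _) (≈-trans (*-identityˡ _) (reflexive (≡.sym (extend-corner (_·_ F B C))))))))
      where
      f : ∀ i j → Fin (suc k) → K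
      f i j l = extend B i l * extend C l j
      kill : ∀ {x y} → x ≡ 0# → x * y ≈ 0#
      kill {y = y} refl = zeroˡ y
      kill′ : ∀ {x y} → y ≡ 0# → x * y ≈ 0#
      kill′ {x} refl = zeroʳ x

    extend-cong : ∀ {B C} → (∀ i j → B i j ≈ C i j) → ∀ i j → extend B i j ≈ extend C i j
    extend-cong {B} {C} B≋C = block-≋
      (λ i j → ≈-trans (reflexive (extend-inner B i j)) (≈-trans (B≋C i j) (reflexive (≡.sym (extend-inner C i j)))))
      (λ j → reflexive (≡.trans (extend-row B j) (≡.sym (extend-row C j))))
      (λ i → reflexive (≡.trans (extend-column B i) (≡.sym (extend-column C i))))
      (reflexive (≡.trans (extend-corner B) (≡.sym (extend-corner C))))

  -- All generators have the form I + z e_y ⊗ e_x, with z = 1 for row additions and x = y, z = α - 1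
  -- for scalings, so this handles both kinds at once.
  extend-update : ∀ (B : Matrix F k) x y z → (∀ i j → B i j ≈ δ i j + δ y i * (z * δ x j)) →
    ∀ i j → extend B i j ≈ δ i j + δ (inject₁ y) i * (z * δ (inject₁ x) j)
  extend-update B x y z upd = block-≋
    (λ i j → ≈-trans (reflexive (extend-inner B i j)) (≈-trans (upd i j) (≈-sym (+-cong (same i j) (*-cong (same y i) (*-congˡ (same x j)))))))
    (λ j → ≈-trans (reflexive (extend-row B j)) (≈-sym (≈-trans (+-cong (δ-diff N≢inject₁) (≈-trans (*-congʳ (δ-diff (N≢inject₁ ∘ ≡.sym))) (zeroˡ _))) (+-identityʳ 0#))))
    (λ i → ≈-trans (reflexive (extend-column B i)) (≈-sym (≈-trans (+-cong (δ-diff (N≢inject₁ ∘ ≡.sym)) (≈-trans (*-congˡ (≈-trans (*-congˡ (δ-diff (N≢inject₁ ∘ ≡.sym))) (zeroʳ _))) (zeroʳ _))) (+-identityʳ 0#))))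
    (≈-trans (reflexive (extend-corner B)) (≈-sym (≈-trans (+-cong (δ-same N) (≈-trans (*-congʳ (δ-diff (N≢inject₁ ∘ ≡.sym))) (zeroˡ _))) (+-identityʳ 1#))))
    where
    same : ∀ i j → δ (inject₁ i) (inject₁ j) ≈ δ i j
    same = δ-injective Fin.inject₁-injective

  private
    extend-I : ∀ i j → extend (I F) i j ≈ I F i j
    extend-I = block-≋
      (λ i j → ≈-trans (reflexive (extend-inner (I F) i j)) (≈-sym (δ-injective Fin.inject₁-injective i j)))
      (λ j → ≈-trans (reflexive (extend-row (I F) j)) (≈-sym (δ-diff N≢inject₁)))
      (λ i → ≈-trans (reflexive (extend-column (I F) i)) (≈-sym (δ-diff (N≢inject₁ ∘ ≡.sym))))
      (≈-trans (reflexive (extend-corner (I F))) (≈-sym (δ-same N)))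

  embed : GL F k → GL F (suc k)
  embed (mkGL B (B′ , p , p′)) = mkGL (extend B) (extend B′ ,
    (λ i j → ≈-trans (extend-· B′ B i j) (≈-trans (extend-cong p i j) (extend-I i j))) ,
    (λ i j → ≈-trans (extend-· B B′ i j) (≈-trans (extend-cong p′ i j) (extend-I i j))))

  module Transport {s s′} (S : Pred (GL F k) s) (S′ : Pred (GL F (suc k)) s′)
    (S→S′ : ∀ {g} → S g → S′ (embed g)) (α : K) (generates : IsGenerator F α) where

    open Levels F (suc k) S′ N
    open Unipotent F α generates (suc k) S′ N
    open Group G′.group using () renaming (_∙_ to _∙′_; _⁻¹ to _⁻¹′; inverseˡ to inverseˡ′; inverseʳ to inverseʳ′)
    private
      module C = Cayley G.group G._≟_ S
      module C′ = Cayley G′.group G′._≟_ S′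
      V = GL-setoid F k
      V′ = GL-setoid F (suc k)

      embed-Levi₁ : ∀ B → Levi₁ (embed B)
      embed-Levi₁ B = (
        fin-elim {P = λ i → i ≢ N → extend (GL.matrix B) i N ≈ 0#} (λ N≢N → ⊥-elim (N≢N refl)) (λ i _ → reflexive (extend-column _ i)) ,
        fin-elim {P = λ j → j ≢ N → extend (GL.matrix B) N j ≈ 0#} (λ N≢N → ⊥-elim (N≢N refl)) (λ j _ → reflexive (extend-row _ j))) ,
        reflexive (extend-corner (GL.matrix B))

      embed-injective : ∀ {B C} → Setoid._≈_ V′ (embed B) (embed C) → Setoid._≈_ V B C
      embed-injective {B} {C} e i j = ≈-trans (reflexive (≡.sym (extend-inner (GL.matrix B) i j)))
        (≈-trans (e (inject₁ i) (inject₁ j)) (reflexive (extend-inner (GL.matrix C) i j)))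

      -- The block of a product is the product of the blocks, because the last column of the left
      -- factor vanishes above the corner; so the block of the inverse is an inverse of the block.
      restrict : ∀ X → Levi₁ X → GL F k
      restrict X ((PX , QX) , eX) = mkGL (inner X) (inner (X ⁻¹′) , inner-· (X ⁻¹′) X PX′ (inverseˡ′ X) , inner-· X (X ⁻¹′) PX (inverseʳ′ X))
        where
        inner : GL F (suc k) → Matrix F k
        inner X i j = GL.matrix X (inject₁ i) (inject₁ j)
        PX′ : Stab (X ⁻¹′)
        PX′ = C′.Subgroup.⁻¹-closed stab {X} PX
        inner-· : ∀ X Y → Stab X → Setoid._≈_ V′ (X ∙′ Y) (Group.ε G′.group) → ∀ i j → _·_ F (inner X) (inner Y) i j ≈ I F i j
        inner-· X Y PX XY≈I i j = ≈-trans (≈-sym (≈-trans (split (λ l → GL.matrix X (inject₁ i) l * GL.matrix Y l (inject₁ j))) (≈-trans (+-congˡ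
          (≈-trans (*-congʳ (PX (inject₁ i) (N≢inject₁ ∘ ≡.sym))) (zeroˡ _))) (+-identityʳ _))))
          (≈-trans (XY≈I (inject₁ i) (inject₁ j)) (δ-injective Fin.inject₁-injective i j))

      embed-restrict : ∀ X LX → Setoid._≈_ V′ (embed (restrict X LX)) X
      embed-restrict X LX@((PX , QX) , eX) = block-≋
        (λ i j → reflexive (extend-inner _ i j))
        (λ j → ≈-trans (reflexive (extend-row _ j)) (≈-sym (QX _ (N≢inject₁ ∘ ≡.sym))))
        (λ i → ≈-trans (reflexive (extend-column _ i)) (≈-sym (PX _ (N≢inject₁ ∘ ≡.sym))))
        (≈-trans (reflexive (extend-corner _)) (≈-sym eX))

      embed-cong : ∀ {B C} → Setoid._≈_ V B C → Setoid._≈_ V′ (embed B) (embed C)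
      embed-cong = extend-cong

      embed-adj : ∀ {B C} → C.Adj B C → C′.Adj (embed B) (embed C)
      embed-adj {B} {C} (g , Sg , inj₁ e) = embed g , S→S′ Sg , inj₁ λ i j → ≈-trans (extend-cong e i j) (≈-sym (extend-· (GL.matrix g) (GL.matrix B) i j))
      embed-adj {B} {C} (g , Sg , inj₂ e) = embed g , S→S′ Sg , inj₂ λ i j → ≈-trans (extend-cong e i j) (≈-sym (extend-· (GL.matrix g) (GL.matrix C) i j))

    embedded : C.HamConn (λ _ → ⊤ {ℓ}) → C′.HamConn Levi₁
    embedded hc = record
      { elems    = map embed elems
      ; unique   = UniqP.map⁺ V V′ (λ {B} {C} → embed-injective {B} {C}) unique
      ; sound    = λ {v} i → sound′ {v} (MemP.∈-map⁻ V V′ {v} {elems} {embed} i)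
      ; complete = λ {v} Lv → MemP.∈-resp-≈ V′ {map embed elems} {embed (restrict v Lv)} {v} (embed-restrict v Lv) (MemP.∈-map⁺ V V′ {f = embed} (λ {B} {C} → embed-cong {B} {C}) {restrict v Lv} {elems} (complete {restrict v Lv} tt))
      ; path     = λ {x} {y} Lx Ly x≉y → C′.path-resp {embed (restrict x Lx)} {x} {embed (restrict y Ly)} {y} (embed-restrict x Lx) (embed-restrict y Ly)
          (WalkMap.path-map C.cayley C′.cayley embed (λ {B} {C} → embed-cong {B} {C}) (λ {B} {C} → embed-adj {B} {C})
            (path {restrict x Lx} {restrict y Ly} tt tt λ e → x≉y (Setoid.trans V′ {x} {embed (restrict x Lx)} {y} (Setoid.sym V′ {embed (restrict x Lx)} {x} (embed-restrict x Lx))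
              (Setoid.trans V′ {embed (restrict x Lx)} {embed (restrict y Ly)} {y} (embed-cong {restrict x Lx} {restrict y Ly} e) (embed-restrict y Ly)))))
      }
      where
      open C.HamConn hc
      sound′ : ∀ {v} → ∃[ B ] (Mem._∈_ V B elems) × Setoid._≈_ V′ v (embed B) → Levi₁ v
      sound′ {v} (B , _ , e) = C′.Subgroup.resp levi₁ {embed B} {v} (Setoid.sym V′ {v} {embed B} e) (embed-Levi₁ B)

-- The finite case n = 3, q = 2

-- The affine group of the plane over the field with two elements has 24
-- elements; here its matrices are Boolean, and the letters of a word are row
-- additions 0 → 1, 1 → 0 and i → 2.
module BooleanModel where

  Bits : Set
  Bits = Vec (Vec Bool 3) 3

  Letter : Set
  Letter = Fin 3

  infix 4 _≟B_
  _≟B_ : DecidableEquality Bits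
  _≟B_ = Vec.≡-dec (Vec.≡-dec Bool._≟_)

  open DecMembership _≟B_ using (_∈?_)
  open Membershipₚ using (_∈_)
  open DecUnique _≟B_ using (unique?)
  open Uniqueₚ using (Unique)
  open Membershipₚ using () renaming (_∈_ to _∈ₛ_)

  identity : Bits
  identity = (true ∷ false ∷ false ∷ []) ∷ (false ∷ true ∷ false ∷ []) ∷ (false ∷ false ∷ true ∷ []) ∷ []

  source target : Fin 2 → Letter → Fin 3
  source i 0F = 0F
  source i 1F = 1F
  source i 2F = inject₁ i
  target i 0F = 1F
  target i 1F = 0F
  target i 2F = 2F

  source≢target : ∀ i o → source i o ≢ target i o
  source≢target 0F 2F ()
  source≢target 1F 2F ()
  source≢target i 0F ()
  source≢target i 1F ()

  act : Fin 2 → Letter → Bits → Bits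
  act i o m = updateAt m (target i o) (zipWith _xor_ (lookup m (source i o)))

  module _ {a} {A : Set a} (f : Letter → A → A) where
    trace : A → List Letter → List A
    trace x []      = x ∷ []
    trace x (o ∷ w) = x ∷ trace (f o x) w

    final : A → List Letter → A
    final x []      = x
    final x (o ∷ w) = final (f o x) w

  -- A word is stored as a ternary number, least significant digit first; it will have 23 letters,
  -- the steps between 24 vertices.
  decode : ℕ → ℕ → List Letter
  decode zero    n = []
  decode (suc k) n = n mod 3 ∷ decode k (n / 3)

  abstract

    -- Hamilton paths from the identity to every other vertex for i = 0, found by
    -- computer; the case i = 1 is obtained by exchanging the first two indices.
    codes : List ℕ
    codes = 69052384828 ∷ 81514215813 ∷ 18870796830 ∷ 81125910159 ∷ 19474343220 ∷ 23084522319 ∷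
      71899503933 ∷ 35540258601 ∷ 75387232542 ∷ 56471873358 ∷ 82236555510 ∷ 58552149837 ∷
      74625689316 ∷ 35529864735 ∷ 11906616819 ∷ 13017269460 ∷ 35539266648 ∷ 56471553219 ∷
      75386299485 ∷ 55323472020 ∷ 56471856996 ∷ 81211307430 ∷ 19482840957 ∷ []

    exchange : Letter → Letter
    exchange 0F = 1F
    exchange 1F = 0F
    exchange 2F = 2F

    words : Fin 2 → List (List Letter)
    words 0F = map (decode 23) codes
    words 1F = map (map exchange ∘ decode 23) codes

    -- The path of the first code also serves to enumerate the group.
    word₀ : Fin 2 → List Letter
    word₀ 0F = decode 23 69052384828
    word₀ 1F = map exchange (decode 23 69052384828)

  walkOf : Fin 2 → List Letter → List Bits
  walkOf i = trace (act i) identity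

  affine : Fin 2 → List Bits
  affine i = walkOf i (word₀ i)

  Hamiltonian : Fin 2 → Bits → List Letter → Set
  Hamiltonian i m w = final (act i) identity w ≡ m × Unique (walkOf i w) ×
    All (_∈ affine i) (walkOf i w) × All (_∈ walkOf i w) (affine i)

  hamiltonian? : ∀ i m → Unary.Decidable (Hamiltonian i m)
  hamiltonian? i m w = (final (act i) identity w ≟B m) ×-dec (unique? (walkOf i w) ×-dec
    (All.all? (_∈? affine i) (walkOf i w) ×-dec All.all? (_∈? walkOf i w) (affine i)))

  fixes : Bits → Set
  fixes m = lookup (lookup m 0F) 2F ≡ false × lookup (lookup m 1F) 2F ≡ false

  fixes? : Unary.Decidable fixes
  fixes? m = (lookup (lookup m 0F) 2F Bool.≟ false) ×-dec (lookup (lookup m 1F) 2F Bool.≟ false)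

  bits : (a b c d e g : Bool) → Bits
  bits a b c d e g = (a ∷ b ∷ false ∷ []) ∷ (c ∷ d ∷ false ∷ []) ∷ (e ∷ g ∷ true ∷ []) ∷ []

  -- The upper left blocks of rank two.
  squares : List (Bool × Bool × Bool × Bool)
  squares = (true , false , false , true) ∷ (true , false , true , true) ∷ (true , true , false , true) ∷
    (true , true , true , false) ∷ (false , true , true , false) ∷ (false , true , true , true) ∷ []

  contains : Fin 2 → (Bool × Bool × Bool × Bool) → Set
  contains i (a , b , c , d) = All (_∈ affine i)
    (bits a b c d false false ∷ bits a b c d false true ∷ bits a b c d true false ∷ bits a b c d true true ∷ [])

  contains? : ∀ i → Unary.Decidable (contains i)
  contains? i (a , b , c , d) = All.all? (_∈? affine i) _

  abstract

    hamiltonian : ∀ i → All (λ m → m ≡ identity ⊎ Any (Hamiltonian i m) (words i)) (affine i)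
    hamiltonian 0F = from-yes (All.all? (λ m → (m ≟B identity) ⊎-dec Any.any? (hamiltonian? 0F m) (words 0F)) (affine 0F))
    hamiltonian 1F = from-yes (All.all? (λ m → (m ≟B identity) ⊎-dec Any.any? (hamiltonian? 1F m) (words 1F)) (affine 1F))

    affine-unique : ∀ i → Unique (affine i)
    affine-unique 0F = from-yes (unique? (affine 0F))
    affine-unique 1F = from-yes (unique? (affine 1F))

    affine-fixes : ∀ i → All fixes (affine i)
    affine-fixes 0F = from-yes (All.all? fixes? (affine 0F))
    affine-fixes 1F = from-yes (All.all? fixes? (affine 1F))

    contains-squares : ∀ i → All (contains i) squares
    contains-squares 0F = from-yes (All.all? (contains? 0F) squares)
    contains-squares 1F = from-yes (All.all? (contains? 1F) squares)

  affine-complete : ∀ i {a b c d} → (a , b , c , d) ∈ₛ squares → ∀ e g → bits a b c d e g ∈ affine i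
  affine-complete i sq e g with All.lookup (contains-squares i) sq
  affine-complete i sq false false | p₁ ∷ p₂ ∷ p₃ ∷ p₄ ∷ [] = p₁
  affine-complete i sq false true  | p₁ ∷ p₂ ∷ p₃ ∷ p₄ ∷ [] = p₂
  affine-complete i sq true  false | p₁ ∷ p₂ ∷ p₃ ∷ p₄ ∷ [] = p₃
  affine-complete i sq true  true  | p₁ ∷ p₂ ∷ p₃ ∷ p₄ ∷ [] = p₄

module TwoElementField {c ℓ q} (F : FiniteField c ℓ q)
  (unit≈1 : ∀ x → ¬ FiniteField._≈_ F x (FiniteField.0# F) → FiniteField._≈_ F x (FiniteField.1# F)) where

  open FiniteField F hiding (zero) renaming (refl to ≈-refl; sym to ≈-sym; trans to ≈-trans; Carrier to K; invertible to inv-exists)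
  open Matrices F
  open Solver commutativeRing

  1+1≈0 : 1# + 1# ≈ 0#
  1+1≈0 = [ (λ e → e) , (λ ne → ⊥-elim (1≉0 (≈-trans (solve 1 (λ x → x := (x :+ x) :- x) ≈-refl 1#)
    (≈-trans (+-congʳ (unit≈1 _ ne)) (-‿inverseʳ 1#))))) ]′ (toSum ((1# + 1#) ≟F 0#))

  ⟦_⟧ : Bool → K
  ⟦ b ⟧ = if b then 1# else 0#

  ⟦⟧-injective : ∀ a b → ⟦ a ⟧ ≈ ⟦ b ⟧ → a ≡ b
  ⟦⟧-injective true  true  e = refl
  ⟦⟧-injective false false e = refl
  ⟦⟧-injective true  false e = ⊥-elim (1≉0 e)
  ⟦⟧-injective false true  e = ⊥-elim (1≉0 (≈-sym e))

  ⟦⟧-xor : ∀ a b → ⟦ a xor b ⟧ ≈ ⟦ b ⟧ + ⟦ a ⟧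
  ⟦⟧-xor false b     = ≈-sym (+-identityʳ _)
  ⟦⟧-xor true  false = ≈-sym (+-identityˡ _)
  ⟦⟧-xor true  true  = ≈-sym 1+1≈0

  bit : ∀ x → ∃[ b ] x ≈ ⟦ b ⟧
  bit x = [ (λ e → false , e) , (λ ne → true , unit≈1 x ne) ]′ (toSum (x ≟F 0#))

  module _ {s} (S : Pred (GL F 3) s) (i : Fin 2) where

    open BooleanModel
    open GLₙ 3
    open Updates F 3
    open Levels F 3 S 2F
    open Group group using (_∙_; ε; _⁻¹; inverseʳ) renaming (_≈_ to _≋_)
    open Cayley group _≟_ S

    letter : Letter → GL F 3
    letter o = addRow (source i o) (target i o) (source≢target i o)

    private
      V = GL-setoid F 3
      module V = Setoid V
      open Mem V using () renaming (_∈_ to _∈V_)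
      open Membershipₚ using (_∈_)
      open Uniqueₚ using (Unique)
      open Uniq V using () renaming (Unique to UniqueV)

      -- The field is abstract and does not compute, so the facts verified for Boolean matrices are
      -- carried over along this relation.
      Rep : GL F 3 → Bits → Set ℓ
      Rep X m = ∀ k l → entry X k l ≈ ⟦ lookup (lookup m k) l ⟧

      rep-ε : Rep ε identity
      rep-ε 0F 0F = ≈-refl
      rep-ε 0F 1F = ≈-refl
      rep-ε 0F 2F = ≈-refl
      rep-ε 1F 0F = ≈-refl
      rep-ε 1F 1F = ≈-refl
      rep-ε 1F 2F = ≈-refl
      rep-ε 2F 0F = ≈-refl
      rep-ε 2F 1F = ≈-refl
      rep-ε 2F 2F = ≈-refl

      rep-unique : ∀ {X m m′} → Rep X m → Rep X m′ → m ≡ m′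
      rep-unique {m = m} {m′} r r′ = lookup-ext λ k → lookup-ext λ l → ⟦⟧-injective _ _ (≈-trans (≈-sym (r k l)) (r′ k l))
        where
        lookup-ext : ∀ {a} {A : Set a} {n} {xs ys : Vec A n} → (∀ k → lookup xs k ≡ lookup ys k) → xs ≡ ys
        lookup-ext {xs = xs} {ys} p = ≡.trans (≡.sym (Vec.tabulate∘lookup xs))
          (≡.trans (Vec.tabulate-cong p) (Vec.tabulate∘lookup ys))

      rep-≋ : ∀ {X Y m} → Rep X m → Rep Y m → X ≋ Y
      rep-≋ r r′ k l = ≈-trans (r k l) (≈-sym (r′ k l))

      rep-resp : ∀ {X Y m} → X ≋ Y → Rep X m → Rep Y m
      rep-resp X≋Y r k l = ≈-trans (≈-sym (X≋Y k l)) (r k l)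

      rep-act : ∀ o {X m} → Rep X m → Rep (letter o ∙ X) (act i o m)
      rep-act o {X} {m} r k l = by (k Fin.≟ t)
        where
        x = source i o
        t = target i o
        f = zipWith _xor_ (lookup m x)
        by : Dec (k ≡ t) → entry (letter o ∙ X) k l ≈ ⟦ lookup (lookup (updateAt m t f) k) l ⟧
        by (no k≢t) = ≈-trans (addRow-other (source≢target i o) X l (k≢t ∘ ≡.sym)) (≈-trans (r k l)
          (reflexive (≡.cong (λ v → ⟦ lookup v l ⟧) (≡.sym (Vec.lookup∘updateAt′ k t k≢t m)))))
        by (yes refl) = ≈-trans (addRow-target (source≢target i o) X l) (≈-trans (+-cong (r t l) (r x l))
          (≈-trans (≈-sym (⟦⟧-xor (lookup (lookup m x) l) (lookup (lookup m t) l)))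
          (reflexive (≡.trans (≡.cong ⟦_⟧ (≡.sym (Vec.lookup-zipWith _xor_ l (lookup m x) (lookup m t))))
            (≡.cong (λ v → ⟦ lookup v l ⟧) (≡.sym (Vec.lookup∘updateAt t m)))))))

      step′ : Letter → GL F 3 → GL F 3
      step′ o X = letter o ∙ X

      rep-trace : ∀ w {X m} → Rep X m → Pointwise Rep (trace step′ X w) (trace (act i) m w)
      rep-trace []      r = r ∷ []
      rep-trace (o ∷ w) {X} {m} r = r ∷ rep-trace w {letter o ∙ X} {act i o m} (rep-act o {X} {m} r)

      rep-final : ∀ w {X m} → Rep X m → Rep (final step′ X w) (final (act i) m w)
      rep-final []      r = r
      rep-final (o ∷ w) {X} {m} r = rep-final w {letter o ∙ X} {act i o m} (rep-act o {X} {m} r)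

      find : ∀ {Xs ms} → Pointwise Rep Xs ms → ∀ {X} → X ∈V Xs → ∃[ m ] m ∈ ms × Rep X m
      find (_∷_ {x = Y} {y = m} r _) {X} (here X≋Y) = m , here refl , rep-resp {Y} {X} {m} (V.sym {X} {Y} X≋Y) r
      find (_ ∷ rs) {X} (there j) with find rs {X} j
      ... | m , m∈ , r = m , there m∈ , r

      find⁻ : ∀ {Xs ms} → Pointwise Rep Xs ms → ∀ {X m} → m ∈ ms → Rep X m → X ∈V Xs
      find⁻ (_∷_ {x = Y} {y = m} r _) {X} (here refl) r′ = here (rep-≋ {X} {Y} {m} r′ r)
      find⁻ (_ ∷ rs) {X} (there j) r′ = there (find⁻ rs {X} j r′)

      unique-trace : ∀ {Xs ms} → Pointwise Rep Xs ms → Unique ms → UniqueV Xs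
      unique-trace []       []       = []
      unique-trace {X ∷ Xs} {m ∷ ms} (r ∷ rs) (m∉ ∷ u) = MemP.∉⇒All[≉] V {x = X} {xs = Xs} fresh ∷ unique-trace rs u
        where
        fresh : ¬ X ∈V Xs
        fresh j with find rs {X} j
        ... | m′ , m′∈ , r′ = All.lookup m∉ m′∈ (rep-unique {X} r r′)

      elements : List (GL F 3)
      elements = trace step′ ε (word₀ i)

      reps : Pointwise Rep elements (affine i)
      reps = rep-trace (word₀ i) {ε} {identity} rep-ε

      sound : ∀ {X} → X ∈V elements → Stab X
      sound {X} j = stable (find reps {X} j)
        where
        stable : ∃[ m ] m ∈ affine i × Rep X m → Stab X
        stable (m , m∈ , r) 0F _   = ≈-trans (r 0F 2F) (reflexive (≡.cong ⟦_⟧ (proj₁ (All.lookup (affine-fixes i) m∈))))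
        stable (m , m∈ , r) 1F _   = ≈-trans (r 1F 2F) (reflexive (≡.cong ⟦_⟧ (proj₂ (All.lookup (affine-fixes i) m∈))))
        stable (m , m∈ , r) 2F 2≢2 = ⊥-elim (2≢2 refl)

      -- A zero row, or two equal rows, would be inherited by the identity matrix.
      no-zero-row : ∀ X k → ¬ (∀ l → entry X k l ≈ 0#)
      no-zero-row X k z = 1≉0 (≈-trans (≈-sym (δ-same k)) (≈-trans (≈-sym (inverseʳ X k k))
        (sum-zero λ l → ≈-trans (*-congʳ {entry (X ⁻¹) l k} (z l)) (zeroˡ (entry (X ⁻¹) l k)))))

      no-equal-rows : ∀ X → ¬ (∀ l → entry X 0F l ≈ entry X 1F l)
      no-equal-rows X e = 1≉0 (≈-trans (≈-sym (inverseʳ X 0F 0F)) (≈-trans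
        (SemiringSum.sum-cong-≋ semiring {3} {λ l → entry X 0F l * entry (X ⁻¹) l 0F}
          {λ l → entry X 1F l * entry (X ⁻¹) l 0F} (λ l → *-congʳ (e l)))
        (inverseʳ X 1F 0F)))

      complete-rep : ∀ X → Stab X → ∃[ m ] m ∈ affine i × Rep X m
      complete-rep X PX = bits a₀ b₀ c₀ d₀ e₀ g₀ , affine-complete i (square a₀ b₀ c₀ d₀ (pa , pb , pc , pd)) e₀ g₀ , rep
        where
        a₀ = proj₁ (bit (entry X 0F 0F)) ; pa = proj₂ (bit (entry X 0F 0F))
        b₀ = proj₁ (bit (entry X 0F 1F)) ; pb = proj₂ (bit (entry X 0F 1F))
        c₀ = proj₁ (bit (entry X 1F 0F)) ; pc = proj₂ (bit (entry X 1F 0F))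
        d₀ = proj₁ (bit (entry X 1F 1F)) ; pd = proj₂ (bit (entry X 1F 1F))
        e₀ = proj₁ (bit (entry X 2F 0F)) ; pe = proj₂ (bit (entry X 2F 0F))
        g₀ = proj₁ (bit (entry X 2F 1F)) ; pg = proj₂ (bit (entry X 2F 1F))
        rep : Rep X (bits a₀ b₀ c₀ d₀ e₀ g₀)
        rep 0F 0F = pa
        rep 0F 1F = pb
        rep 0F 2F = PX 0F λ ()
        rep 1F 0F = pc
        rep 1F 1F = pd
        rep 1F 2F = PX 1F λ ()
        rep 2F 0F = pe
        rep 2F 1F = pg
        rep 2F 2F = unit≈1 _ (inverse≉0 (corner {X} PX))
        Block = λ a b c d → entry X 0F 0F ≈ ⟦ a ⟧ × entry X 0F 1F ≈ ⟦ b ⟧ × entry X 1F 0F ≈ ⟦ c ⟧ × entry X 1F 1F ≈ ⟦ d ⟧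
        row₀ : ∀ c d → Block false false c d → (false , false , c , d) ∈ squares
        row₀ c d (p , p′ , _) = ⊥-elim (no-zero-row X 0F λ { 0F → p ; 1F → p′ ; 2F → PX 0F λ () })
        row₁ : ∀ a b → Block a b false false → (a , b , false , false) ∈ squares
        row₁ a b (_ , _ , p , p′) = ⊥-elim (no-zero-row X 1F λ { 0F → p ; 1F → p′ ; 2F → PX 1F λ () })
        rows : ∀ a b → Block a b a b → (a , b , a , b) ∈ squares
        rows a b (p , p′ , r , r′) = ⊥-elim (no-equal-rows X λ
          { 0F → ≈-trans p (≈-sym r) ; 1F → ≈-trans p′ (≈-sym r′)
          ; 2F → ≈-trans (PX 0F λ ()) (≈-sym (PX 1F λ ())) })
        -- Of the sixteen possible blocks ten have a zero row or two equal rows; the other six are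
        -- those in `squares`.
        square : ∀ a b c d → Block a b c d → (a , b , c , d) ∈ squares
        square false false c     d     h = row₀ c d h
        square a     b     false false h = row₁ a b h
        square true  true  true  true  h = rows true true h
        square true  false true  false h = rows true false h
        square false true  false true  h = rows false true h
        square true  false false true  h = here refl
        square true  false true  true  h = there (here refl)
        square true  true  false true  h = there (there (here refl))
        square true  true  true  false h = there (there (there (here refl)))
        square false true  true  false h = there (there (there (there (here refl))))
        square false true  true  true  h = there (there (there (there (there (here refl)))))

    module _ (S-letter : ∀ o → S (letter o)) where

      walk-trace : ∀ w X → Walk X (final step′ X w) (trace step′ X w)
      walk-trace []      X = stop (V.refl {X}) (V.refl {X})
      walk-trace (o ∷ w) X = step (V.refl {X}) (adj-gen X (S-letter o)) (walk-trace w (letter o ∙ X))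

      affinePath : ∀ {X m} → m ∈ affine i → Rep X m → ¬ ε ≋ X → Path elements ε X
      affinePath {X} {m} m∈ r ε≉X = build (All.lookup (hamiltonian i) m∈)
        where
        along : ∃ (Hamiltonian i m) → Path elements ε X
        build : m ≡ identity ⊎ Any (Hamiltonian i m) (words i) → Path elements ε X
        build (inj₁ refl) = ⊥-elim (ε≉X (rep-≋ {ε} {X} {identity} rep-ε r))
        build (inj₂ a) = along (Any.satisfied a)
        along (w , end , u , inside , covers) = path-resp {ε} {ε} {final step′ ε w} {X} (V.refl {ε}) end≋X
                (trace step′ ε w , walk-trace w ε , unique-↭ (unique-trace tr u) (unique-trace reps (affine-unique i)) (λ {Y} → to {Y}) (λ {Y} → from {Y}))
          where
          tr = rep-trace w {ε} {identity} rep-ε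
          end≋X : final step′ ε w ≋ X
          end≋X = rep-≋ {final step′ ε w} {X} {m} (subst (Rep (final step′ ε w)) end (rep-final w {ε} {identity} rep-ε)) r
          to : ∀ {Y} → Y ∈V trace step′ ε w → Y ∈V elements
          to {Y} j = let (m′ , m′∈ , r′) = find tr {Y} j in find⁻ reps {Y} (All.lookup inside m′∈) r′
          from : ∀ {Y} → Y ∈V elements → Y ∈V trace step′ ε w
          from {Y} j = let (m′ , m′∈ , r′) = find reps {Y} j in find⁻ tr {Y} (All.lookup covers m′∈) r′

      stabPath : HamConn Stab
      stabPath = fromIdentity stab elements (unique-trace reps (affine-unique i)) (λ {X} → sound {X})
        (λ {X} PX → let (m , m∈ , r) = complete-rep X PX in find⁻ reps {X} m∈ r)
        (λ X PX → let (m , m∈ , r) = complete-rep X PX in affinePath {X} {m} m∈ r)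

-- Parity of discrete logarithms and the spiral

xor-same : ∀ b → b xor b ≡ false
xor-same true  = refl
xor-same false = refl

odd-*ˡ : ∀ c → odd c ≡ true → ∀ j → odd (j ℕ.* c) ≡ odd j
odd-*ˡ c oc zero    = refl
odd-*ˡ c oc (suc j) = ≡.trans (odd-+ c (j ℕ.* c)) (≡.trans (≡.cong (_xor odd (j ℕ.* c)) oc) (≡.cong not (odd-*ˡ c oc j)))

odd-*-even : ∀ c → odd c ≡ false → ∀ j → odd (j ℕ.* c) ≡ false
odd-*-even c ec zero    = refl
odd-*-even c ec (suc j) = ≡.trans (odd-+ c (j ℕ.* c)) (≡.trans (≡.cong (_xor odd (j ℕ.* c)) ec) (odd-*-even c ec j))

odd-% : ∀ k m .{{_ : ℕ.NonZero m}} → odd m ≡ false → odd (k % m) ≡ odd k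
odd-% k m em = ≡.sym (≡.trans (≡.cong odd (m≡m%n+[m/n]*n k m)) (≡.trans (odd-+ (k % m) (k / m ℕ.* m))
  (≡.trans (≡.cong (odd (k % m) xor_) (odd-*-even m em (k / m))) (Bool.xor-identityʳ _))))

-- Stated for an arbitrary generator because both α and α⁻¹ are used: exchanging the two torus
-- directions inverts the multiplier.
record Primitive {c ℓ q} (F : FiniteField c ℓ q) (m : ℕ) (A A′ : FiniteField.Carrier F) : Set (c ⊔ ℓ) where

  open FiniteField F hiding (zero) renaming (sym to ≈-sym; trans to ≈-trans; Carrier to K)
  open Exp semiring using (_^_)

  field
    A′A    : A′ * A ≈ 1#
    A^m    : A ^ m ≈ 1#
    order  : ∀ i → 0 < i → i < m → ¬ A ^ i ≈ 1#
    logᴬ   : ∀ x → ¬ x ≈ 0# → ∃[ i ] i < m × x ≈ A ^ i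

  A≉0 : ¬ A ≈ 0#
  A≉0 e = 1≉0 (≈-trans (≈-sym A′A) (≈-trans (*-congˡ e) (zeroʳ A′)))

  generate : ∀ x → ¬ x ≈ 0# → ∃[ i ] x ≈ A ^ i
  generate x x≉0 = let (i , _ , e) = logᴬ x x≉0 in i , e

module Parity {c ℓ q} {F : FiniteField c ℓ q} {g g′ : FiniteField.Carrier F} {n : ℕ}
  (prim : Primitive F (suc (suc n)) g g′) (even : odd n ≡ false) where

  open FiniteField F hiding (zero) renaming (refl to ≈-refl; sym to ≈-sym; trans to ≈-trans; Carrier to K; invertible to inv-exists)
  open Primitive prim using () renaming (A≉0 to g≉0; generate to generates; A^m to g^m; order to g-order)
  open Exp semiring using (_^_)
  open Exp semiring using (^-homo-*; ^-assocʳ; ^-congˡ)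
  open RingProperties ring using (-‿distribˡ-*; -‿distribʳ-*; -‿involutive)
  open Matrices F using (_≟F_)
  open Solver commutativeRing
  open Perm ≈-setoid using (_↭_; ↭-refl; ↭-sym; ↭-trans)
  open Mem ≈-setoid using (_∈_)
  open Uniq ≈-setoid using (Unique)

  m : ℕ
  m = suc (suc n)

  odd-m : odd m ≡ false
  odd-m = ≡.trans (Bool.not-involutive (odd n)) even

  odd-m-1 : odd (suc n) ≡ true
  odd-m-1 = ≡.cong not even

  1^ : ∀ k → 1# ^ k ≈ 1#
  1^ zero    = ≈-refl
  1^ (suc k) = ≈-trans (*-identityˡ _) (1^ k)

  g^m* : ∀ k → g ^ (k ℕ.* m) ≈ 1#
  g^m* k = ≈-trans (reflexive (≡.cong (g ^_) (ℕ.*-comm k m))) (≈-trans (≈-sym (^-assocʳ g m k)) (≈-trans (^-congˡ k g^m) (1^ k)))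

  -- Up to sign, x is a power of g with exponent of parity e; if -1 is not a
  -- square then both parities occur for every unit.
  Par : Bool → K → Set ℓ
  Par e x = ∃[ k ] odd k ≡ e × (x ≈ g ^ k ⊎ - x ≈ g ^ k)

  par-cong : ∀ {e x y} → x ≈ y → Par e x → Par e y
  par-cong p (k , o , inj₁ r) = k , o , inj₁ (≈-trans (≈-sym p) r)
  par-cong p (k , o , inj₂ r) = k , o , inj₂ (≈-trans (-‿cong (≈-sym p)) r)

  par-neg : ∀ {e x} → Par e x → Par e (- x)
  par-neg (k , o , inj₁ r) = k , o , inj₂ (≈-trans (-‿involutive _) r)
  par-neg (k , o , inj₂ r) = k , o , inj₁ r

  par-* : ∀ {e e′ x y} → Par e x → Par e′ y → Par (e xor e′) (x * y)
  par-* {x = x} {y} (k , refl , r) (l , refl , r′) = k ℕ.+ l , odd-+ k l , sign r r′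
    where
    eq : ∀ {x y} → x ≈ g ^ k → y ≈ g ^ l → x * y ≈ g ^ (k ℕ.+ l)
    eq p p′ = ≈-trans (*-cong p p′) (≈-sym (^-homo-* g k l))
    sign : x ≈ g ^ k ⊎ - x ≈ g ^ k → y ≈ g ^ l ⊎ - y ≈ g ^ l → x * y ≈ g ^ (k ℕ.+ l) ⊎ - (x * y) ≈ g ^ (k ℕ.+ l)
    sign (inj₁ p) (inj₁ p′) = inj₁ (eq p p′)
    sign (inj₁ p) (inj₂ p′) = inj₂ (≈-trans (-‿distribʳ-* x y) (eq p p′))
    sign (inj₂ p) (inj₁ p′) = inj₂ (≈-trans (-‿distribˡ-* x y) (eq p p′))
    sign (inj₂ p) (inj₂ p′) = inj₁ (≈-trans (solve 2 (λ x y → x :* y := (:- x) :* (:- y)) ≈-refl x y) (eq p p′))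

  par-one : Par false 1#
  par-one = 0 , refl , inj₁ ≈-refl

  par-cases : ∀ x → ¬ x ≈ 0# → Par true x ⊎ Par false x
  par-cases x x≉0 with generates x x≉0
  ... | k , e = split (odd k) refl
    where
    split : ∀ b → odd k ≡ b → Par true x ⊎ Par false x
    split true  o = inj₁ (k , o , inj₁ e)
    split false o = inj₂ (k , o , inj₁ e)

  -- Exponents may be reduced modulo m, so the search is finite.
  Par? : ∀ e x → Dec (Par e x)
  Par? e x = map′ (λ (k , _ , p) → k , p) reduced
    (ℕ.anyUpTo? (λ k → (odd k Bool.≟ e) ×-dec ((x ≟F g ^ k) ⊎-dec (- x ≟F g ^ k))) m)
    where
    reduced : Par e x → ∃[ k ] k < m × odd k ≡ e × (x ≈ g ^ k ⊎ - x ≈ g ^ k)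
    reduced (k , o , p) = k % m , m%n<n k m , ≡.trans (odd-% k m odd-m) o ,
      Sum.map (λ r → ≈-trans r low) (λ r → ≈-trans r low) p
      where
      low : g ^ k ≈ g ^ (k % m)
      low = ≈-trans (reflexive (≡.cong (g ^_) (m≡m%n+[m/n]*n k m))) (≈-trans (^-homo-* g (k % m) (k / m ℕ.* m))
        (≈-trans (*-congˡ (g^m* (k / m))) (*-identityʳ _)))

  power≉0 : ∀ k → ¬ g ^ k ≈ 0#
  power≉0 zero    e = 1≉0 e
  power≉0 (suc k) e = power≉0 k (≈-trans (≈-sym (≈-trans (≈-sym (*-assoc _ _ _)) (≈-trans (*-congʳ (proj₁ (proj₂ (inv-exists g g≉0)))) (*-identityˡ _))))
    (≈-trans (*-congˡ e) (zeroʳ (proj₁ (inv-exists g g≉0)))))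

  par≉0 : ∀ {e x} → Par e x → ¬ x ≈ 0#
  par≉0 (k , _ , inj₁ r) x≈0 = power≉0 k (≈-trans (≈-sym r) x≈0)
  par≉0 (k , _ , inj₂ r) x≈0 = power≉0 k (≈-trans (≈-sym r) (≈-trans (-‿cong x≈0) (solve 0 (:- :0 := :0) ≈-refl)))

  -- One of g and its inverse has, up to sign, an odd distance from 1.
  record Spiral : Set (c ⊔ ℓ) where
    field
      γ γ⁻¹     : K
      inverse   : γ * γ⁻¹ ≈ 1#
      odd-γ     : Par true γ
      odd-γ⁻¹   : Par true γ⁻¹
      odd-γ-1   : Par true (γ - 1#)
      γ^m       : γ ^ m ≈ 1#
      order     : ∀ i → 0 < i → i < m → ¬ γ ^ i ≈ 1#
      reaches   : ∀ x y → ¬ x ≈ 0# → ¬ y ≈ 0# → ∃[ k ] k < m × x ≈ γ ^ k * y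

  private
    h : K
    h = g ^ suc n

    gh : g * h ≈ 1#
    gh = g^m

    hg^ : ∀ k → h ^ k * g ^ k ≈ 1#
    hg^ zero    = *-identityˡ 1#
    hg^ (suc k) = ≈-trans (solve 4 (λ h x g y → (h :* x) :* (g :* y) := (g :* h) :* (x :* y)) ≈-refl h (h ^ k) g (g ^ k))
      (≈-trans (*-cong gh (hg^ k)) (*-identityˡ 1#))

    ratio : ∀ x y → ¬ x ≈ 0# → ¬ y ≈ 0# → ∃[ k ] x ≈ g ^ k * y
    ratio x y x≉0 y≉0 with inv-exists y y≉0
    ... | z , zy≈1 , _ with generates (x * z) (λ xz≈0 → x≉0 (≈-trans (≈-sym (≈-trans (*-assoc x z y) (≈-trans (*-congˡ zy≈1) (*-identityʳ x)))) (≈-trans (*-congʳ xz≈0) (zeroˡ y))))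
    ...   | k , e = k , ≈-trans (≈-sym (≈-trans (*-assoc x z y) (≈-trans (*-congˡ zy≈1) (*-identityʳ x)))) (*-congʳ e)

    reduce-power : ∀ γ → γ ^ m ≈ 1# → ∀ k → γ ^ k ≈ γ ^ (k % m)
    reduce-power γ γ^m k = ≈-trans (reflexive (≡.cong (γ ^_) (m≡m%n+[m/n]*n k m))) (≈-trans (^-homo-* γ (k % m) (k / m ℕ.* m))
      (≈-trans (*-congˡ (≈-trans (reflexive (≡.cong (γ ^_) (ℕ.*-comm (k / m) m))) (≈-trans (≈-sym (^-assocʳ γ m (k / m)))
        (≈-trans (^-congˡ (k / m) γ^m) (1^ (k / m)))))) (*-identityʳ _)))

    h^m : h ^ m ≈ 1#
    h^m = ≈-trans (^-assocʳ g (suc n) m) (g^m* (suc n))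

    odd-g : Par true g
    odd-g = 1 , refl , inj₁ (≈-sym (*-identityʳ g))

    odd-h : Par true h
    odd-h = suc n , odd-m-1 , inj₁ ≈-refl

    g-1≉0 : ¬ g - 1# ≈ 0#
    g-1≉0 e = g-order 1 z<s (s<s z<s) (≈-trans (*-identityʳ g) (≈-trans (solve 1 (λ g → g := (g :- :1) :+ :1) ≈-refl g)
      (≈-trans (+-congʳ e) (+-identityˡ 1#))))

  abstract

    spiral-exists : Spiral
    spiral-exists with par-cases (g - 1#) g-1≉0
    ... | inj₁ o = record
      { γ = g ; γ⁻¹ = h ; inverse = gh ; odd-γ = odd-g ; odd-γ⁻¹ = odd-h ; odd-γ-1 = o ; γ^m = g^m ; order = g-order
      ; reaches = λ x y x≉0 y≉0 → let (k , e) = ratio x y x≉0 y≉0 in k % m , m%n<n k m , ≈-trans e (*-congʳ (reduce-power g g^m k)) }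
    -- Here h = g⁻¹ = g^(m-1) is odd and h - 1 = -(g - 1) h, so an even g - 1 makes h - 1 odd.
    ... | inj₂ o = record
      { γ = h ; γ⁻¹ = g ; inverse = ≈-trans (*-comm h g) gh ; odd-γ = odd-h ; odd-γ⁻¹ = odd-g
      ; odd-γ-1 = par-cong (≈-trans (-‿cong (≈-trans (distribʳ h g (- 1#)) (+-congʳ gh))) (solve 1 (λ h → :- (:1 :+ (:- :1) :* h) := h :- :1) ≈-refl h))
          (par-neg (par-* o odd-h))
      ; γ^m = h^m
      ; order = λ i 0<i i<m e → g-order i 0<i i<m (≈-trans (≈-sym (*-identityˡ _)) (≈-trans (*-congʳ (≈-sym e)) (hg^ i)))
      ; reaches = λ x y x≉0 y≉0 → let (k , e) = ratio y x y≉0 x≉0 in k % m , m%n<n k m ,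
          ≈-trans (≈-sym (≈-trans (*-congʳ (hg^ k)) (*-identityˡ x))) (≈-trans (*-assoc _ _ _)
            (≈-trans (*-congˡ (≈-sym e)) (*-congʳ (reduce-power h h^m k)))) }

  module SpiralLists (sp : Spiral) where

    open Spiral sp

    geometric : ℕ → K → List K
    geometric zero    τ = []
    geometric (suc k) τ = τ ∷ geometric k (γ * τ)

    γ^suc : ∀ i τ → γ ^ i * (γ * τ) ≈ γ ^ suc i * τ
    γ^suc i τ = solve 3 (λ x g t → x :* (g :* t) := (g :* x) :* t) ≈-refl (γ ^ i) γ τ

    ∈geometric⁺ : ∀ {k} i τ {x} → i < k → x ≈ γ ^ i * τ → x ∈ geometric k τ
    ∈geometric⁺ zero    τ z<s       e = here (≈-trans e (*-identityˡ τ))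
    ∈geometric⁺ (suc i) τ (s<s i<k) e = there (∈geometric⁺ i (γ * τ) i<k (≈-trans e (≈-sym (γ^suc i τ))))

    ∈geometric⁻ : ∀ k τ {x} → x ∈ geometric k τ → ∃[ i ] i < k × x ≈ γ ^ i * τ
    ∈geometric⁻ (suc k) τ (here e) = 0 , z<s , ≈-trans e (≈-sym (*-identityˡ τ))
    ∈geometric⁻ (suc k) τ (there p) with ∈geometric⁻ k (γ * τ) p
    ... | i , i<k , e = suc i , s<s i<k , ≈-trans e (γ^suc i τ)

    geometric-unique : ∀ k τ → ¬ τ ≈ 0# → k ≤ m → Unique (geometric k τ)
    geometric-unique zero    τ _   _   = []
    geometric-unique (suc k) τ τ≉0 k<m = MemP.∉⇒All[≉] ≈-setoid fresh ∷
      geometric-unique k (γ * τ) γτ≉0 (ℕ.≤-trans (ℕ.n≤1+n k) k<m)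
      where
      γτ≉0 : ¬ γ * τ ≈ 0#
      γτ≉0 e = τ≉0 (≈-trans (≈-sym (*-identityˡ τ)) (≈-trans (*-congʳ (≈-sym inverse))
        (≈-trans (solve 3 (λ g h t → (g :* h) :* t := h :* (g :* t)) ≈-refl γ γ⁻¹ τ) (≈-trans (*-congˡ e) (zeroʳ _)))))
      fresh : ¬ τ ∈ geometric k (γ * τ)
      fresh p with ∈geometric⁻ k (γ * τ) p | inv-exists τ τ≉0
      ... | i , i<k , e | z , _ , τz≈1 = order (suc i) z<s (ℕ.≤-trans (s<s i<k) k<m)
            (≈-trans (≈-sym (*-identityʳ _)) (≈-trans (*-congˡ (≈-sym τz≈1)) (≈-trans (≈-sym (*-assoc _ _ _))
              (≈-trans (*-congʳ (≈-trans (≈-sym (γ^suc i τ)) (≈-sym e))) τz≈1))))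

    geometric-∷ʳ : ∀ k τ → geometric k τ ++ [ γ ^ k * τ ] ↭ geometric (suc k) τ
    geometric-∷ʳ zero    τ = Perm.prep (*-identityˡ τ) ↭-refl
    geometric-∷ʳ (suc k) τ = Perm.prep ≈-refl (↭-trans
      (PermP.++⁺ˡ ≈-setoid (geometric k (γ * τ)) (Perm.prep (≈-sym (γ^suc k τ)) ↭-refl)) (geometric-∷ʳ k (γ * τ)))

    -- All units in the order γ u, γ² u, ..., γ^m u; the last one is written as `u`, since the walk
    -- ends or turns off in its torus.
    spiralTo : K → List K
    spiralTo u = geometric (suc n) (γ * u) ++ [ u ]

    spiral-end : ∀ u → γ ^ suc n * (γ * u) ≈ u
    spiral-end u = ≈-trans (γ^suc (suc n) u) (≈-trans (*-congʳ γ^m) (*-identityˡ u))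

    γ≉0 : ∀ {u} → ¬ u ≈ 0# → ¬ γ * u ≈ 0#
    γ≉0 {u} u≉0 e = u≉0 (≈-trans (≈-sym (*-identityˡ u)) (≈-trans (*-congʳ (≈-sym inverse))
      (≈-trans (solve 3 (λ g h t → (g :* h) :* t := h :* (g :* t)) ≈-refl γ γ⁻¹ u) (≈-trans (*-congˡ e) (zeroʳ _)))))

    spiralTo-geometric : ∀ u → spiralTo u ↭ geometric m (γ * u)
    spiralTo-geometric u = ↭-trans (PermP.++⁺ˡ ≈-setoid (geometric (suc n) (γ * u))
      (Perm.prep (≈-sym (spiral-end u)) ↭-refl)) (geometric-∷ʳ (suc n) (γ * u))

    spiralTo-unique : ∀ {u} → ¬ u ≈ 0# → Unique (spiralTo u)
    spiralTo-unique {u} u≉0 = PermP.Unique-resp-↭ ≈-setoid (↭-sym (spiralTo-geometric u))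
      (geometric-unique m (γ * u) (γ≉0 u≉0) ℕ.≤-refl)

    spiralTo-complete : ∀ {u x} → ¬ u ≈ 0# → ¬ x ≈ 0# → x ∈ spiralTo u
    spiralTo-complete {u} {x} u≉0 x≉0 with reaches x (γ * u) x≉0 (γ≉0 u≉0)
    ... | k , k<m , e = PermP.∈-resp-↭ ≈-setoid (↭-sym (spiralTo-geometric u)) (∈geometric⁺ k (γ * u) k<m e)

    spiralTo-sound : ∀ {u x} → ¬ u ≈ 0# → x ∈ spiralTo u → ¬ x ≈ 0#
    spiralTo-sound {u} {x} u≉0 x∈ x≈0 with ∈geometric⁻ m (γ * u) (PermP.∈-resp-↭ ≈-setoid (spiralTo-geometric u) x∈)
    ... | i , _ , e = nonzero i (≈-trans (≈-sym e) x≈0)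
      where
      nonzero : ∀ i → ¬ γ ^ i * (γ * u) ≈ 0#
      nonzero zero    e = γ≉0 u≉0 (≈-trans (≈-sym (*-identityˡ _)) e)
      nonzero (suc i) e = nonzero i (≈-trans (≈-sym (*-identityˡ _)) (≈-trans (*-congʳ (≈-sym inverse))
        (≈-trans (solve 4 (λ g h t y → (g :* h) :* (t :* y) := h :* ((g :* t) :* y)) ≈-refl γ γ⁻¹ (γ ^ i) (γ * u)) (≈-trans (*-congˡ e) (zeroʳ _)))))

    -- Every s ≠ 0 is a sum of an even and an odd element, as s = γ⁻¹ s + (1 - γ⁻¹) s.
    even-odd-sum : ∀ s → ¬ s ≈ 0# → ∃[ u ] Par false u × Par true (s - u)
    even-odd-sum s s≉0 = [ (λ o → γ⁻¹ * s , par-* odd-γ⁻¹ o , par-cong (≈-sym diff) (par-* even-diff o)) ,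
        (λ e → s - γ⁻¹ * s , par-cong (≈-sym diff) (par-* even-diff e) ,
               par-cong (solve 2 (λ s x → x := s :- (s :- x)) ≈-refl s (γ⁻¹ * s)) (par-* odd-γ⁻¹ e)) ]′ (par-cases s s≉0)
      where
      even-diff : Par false ((γ - 1#) * γ⁻¹)
      even-diff = par-* odd-γ-1 odd-γ⁻¹
      diff : s - γ⁻¹ * s ≈ (γ - 1#) * γ⁻¹ * s
      diff = ≈-trans (+-congʳ (≈-trans (≈-sym (*-identityˡ s)) (*-congʳ (≈-sym inverse))))
        (solve 3 (λ g h s → g :* h :* s :- h :* s := (g :- :1) :* h :* s) ≈-refl γ γ⁻¹ s)

-- Walks through the tori T u_s when the order of α is even

xor-not : ∀ p → p xor not p ≡ true
xor-not true  = refl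
xor-not false = refl

-- Heights of the two parts into which a torus of m = n + 2 rows is cut when it is visited twice.
-- `cylinder` needs two rows; a single row suffices for m = 2, where it is one edge. The first part
-- is kept low because `return-path` can only end outside of it.
cut cut′ : ℕ → ℕ
cut zero     = 1
cut (suc n)  = 2
cut′ zero    = 1
cut′ (suc n) = suc n

cut-sum : ∀ n → cut n ℕ.+ cut′ n ≡ suc (suc n)
cut-sum zero    = refl
cut-sum (suc n) = refl

cut>0 : ∀ n → 0 < cut n
cut>0 zero    = z<s
cut>0 (suc n) = z<s

cut′>0 : ∀ n → 0 < cut′ n
cut′>0 zero    = z<s
cut′>0 (suc n) = z<s

module _ {c ℓ q} (F : FiniteField c ℓ q) {c′ ℓ′} (G : Group c′ ℓ′) where

  open FiniteField F using (_≈_; 0#) renaming (Carrier to K)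
  open Group G using (_∙_; ε) renaming (Carrier to C; _≈_ to _≋_; setoid to V)

  module _ {s′} (_≟_ : Decidable _≋_) (S : Pred C s′) where

    -- A list of the vertices aⁱ bʲ u_s and the Hamilton paths through it that start at ε.
    record Sweep (m k₁ : ℕ) (Par : Bool → K → Set ℓ) (node : ℕ → ℕ → K → C) : Set (c ⊔ ℓ ⊔ c′ ⊔ ℓ′ ⊔ s′) where

      open Cayley G _≟_ S using (Path)
      open Mem V using (_∈_)
      open Uniq V using (Unique)

      field
        all          : List C
        all-complete : ∀ {v} → (∃[ i ] ∃[ j ] ∃[ s ] i < m × j < m × v ≋ node i j s) → v ∈ all
        all-sound    : ∀ {v} → v ∈ all → ∃[ i ] ∃[ j ] ∃[ s ] i < m × j < m × v ≋ node i j s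
        all-unique   : (∀ {i j s i′ j′ t} → i < m → j < m → i′ < m → j′ < m → node i j s ≋ node i′ j′ t → i ≡ i′ × j ≡ j′ × s ≈ t) → Unique all
        walk-even    : ∀ i j s → ¬ s ≈ 0# → odd (i ℕ.+ j) ≡ false → Path all ε (node i j s)
        walk-odd     : ∀ i j s → Par false s → odd (i ℕ.+ j) ≡ true → Path all ε (node i j s)
        walk-odd⁻¹   : ∀ i j s → Par true s → odd (i ℕ.+ j) ≡ true → ∃[ z ] node i j s ∙ z ≋ ε × Path all ε z
        return-path  : ∀ i j s → s ≈ 0# → k₁ ≤ j → j < m → Path all ε (node i j s)

-- Elements aⁱ bʲ u_s with a, b of even order m; a step by u_1 moves between the
-- tori ⟨a, b⟩ u_s and preserves the parity of i + j, while the steps a and b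
-- change it.
module BorelWalk {c ℓ q} {F : FiniteField c ℓ q} {g g′ : FiniteField.Carrier F} {n : ℕ}
  (prim : Primitive F (suc (suc n)) g g′) (even : odd n ≡ false)
  {c′ ℓ′ s′} (G : Group c′ ℓ′) (_≟_ : Decidable (Group._≈_ G)) (S : Pred (Group.Carrier G) s′) where

  open FiniteField F hiding (zero) renaming (refl to ≈-refl; sym to ≈-sym; trans to ≈-trans; Carrier to K; invertible to inv-exists)
  open Exp semiring using (_^_; ^-homo-*)
  open Parity prim even
  open SpiralLists spiral-exists
  open Spiral spiral-exists
  open Matrices F using (_≟F_)
  open Solver commutativeRing
  open Group G using (_∙_; ε) renaming (Carrier to C; _≈_ to _≋_; refl to ≋-refl; sym to ≋-sym; trans to ≋-trans; setoid to V; reflexive to ≋-reflexive; ∙-congˡ to ∙-congˡ′)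
  open Cayley G _≟_ S
  open Tori G _≟_ S
  open Perm V using (_↭_; ↭-refl; ↭-sym; ↭-trans; ↭-reflexive)
  open PermP V using (++⁺; ++⁺ʳ; ++⁺ˡ; shifts; ++-comm)
  open Mem ≈-setoid using (_∈_)
  open Uniq ≈-setoid using (Unique)
  private module PF = Perm ≈-setoid

  open GroupProperties G using () renaming (\\-leftDividesʳ to cancelˡ)

  module _ {a b : C} (a-step : Steps a) (b-step : Steps b) (comm : Commute a b)
    (a^m : ∀ x → pow a (suc (suc n)) x ≋ x) (b^m : ∀ x → pow b (suc (suc n)) x ≋ x)
    (u : K → C) (u-cong : ∀ {s t} → s ≈ t → u s ≋ u t) (u-step : Steps (u 1#)) (u-zero : u 0# ≋ ε)
    (e : ℕ) (odd-e : odd e ≡ true)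
    (law : ∀ i j s t → u s ∙ pow a i (pow b j (u t)) ≋ pow a i (pow b j (u (s * g ^ (i ℕ.+ j ℕ.* e) + t)))) where

    open Cylinder a-step b-step comm n a^m using (row; rows; rows-cong; rows-rotate; around)
    open CylinderPaths a-step b-step comm n a^m using (cylinder)
    open CylinderLists a-step b-step comm n a^m

    node : ℕ → ℕ → K → C
    node i j s = pow a i (pow b j (u s))

    node-cong : ∀ i j {s t} → s ≈ t → node i j s ≋ node i j t
    node-cong i j p = pow-cong a i (pow-cong b j (u-cong p))

    pow-m* : ∀ {a} → (∀ x → pow a m x ≋ x) → ∀ k x → pow a (k ℕ.* m) x ≋ x
    pow-m* a^m zero    x = ≋-refl
    pow-m* {a} a^m (suc k) x = ≋-trans (pow-+ a m (k ℕ.* m) x) (≋-trans (a^m _) (pow-m* a^m k x))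

    pow-% : ∀ {a} → (∀ x → pow a m x ≋ x) → ∀ k x → pow a (k % m) x ≋ pow a k x
    pow-% {a} a^m k x = ≋-trans (pow-cong a (k % m) (≋-sym (pow-m* a^m (k / m) x)))
      (≋-trans (≋-sym (pow-+ a (k % m) (k / m ℕ.* m) x)) (≋-reflexive (≡.cong (λ k → pow a k x) (≡.sym (m≡m%n+[m/n]*n k m)))))

    pow-pow : ∀ i j x → pow a i (pow b j x) ≋ pow b j (pow a i x)
    pow-pow i zero    x = ≋-refl
    pow-pow i (suc j) x = ≋-trans (pow-swap comm i (pow b j x)) (∙-congˡ′ (pow-pow i j x))

    -- The exponent k - i, up to a multiple of m.
    infixl 6 _⊝_
    _⊝_ : ℕ → ℕ → ℕ
    k ⊝ i = (k ℕ.+ i ℕ.* suc n) % m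

    pow-⊝ : ∀ {a} → (∀ x → pow a m x ≋ x) → ∀ k i x → pow a (k ⊝ i) (pow a i x) ≋ pow a k x
    pow-⊝ {a} a^m k i x = ≋-trans (pow-% a^m (k ℕ.+ i ℕ.* suc n) (pow a i x)) (≋-trans (≋-sym (pow-+ a (k ℕ.+ i ℕ.* suc n) i x))
      (≋-trans (≋-reflexive (≡.cong (λ k → pow a k x) arith)) (≋-trans (pow-+ a k (i ℕ.* m) x) (pow-cong a k (pow-m* a^m i x)))))
      where
      arith : k ℕ.+ i ℕ.* suc n ℕ.+ i ≡ k ℕ.+ i ℕ.* m
      arith = ≡.trans (ℕ.+-assoc k (i ℕ.* suc n) i) (≡.cong (k ℕ.+_) (≡.trans (ℕ.+-comm (i ℕ.* suc n) i) (≡.sym (ℕ.*-suc i (suc n)))))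

    odd-⊝ : ∀ k i → odd (k ⊝ i) ≡ odd k xor odd i
    odd-⊝ k i = ≡.trans (odd-% (k ℕ.+ i ℕ.* suc n) m odd-m) (≡.trans (odd-+ k (i ℕ.* suc n)) (≡.cong (odd k xor_) (odd-*ˡ (suc n) odd-m-1 i)))

    node-shift : ∀ i j i′ j′ s → pow a (i′ ⊝ i) (pow b (j′ ⊝ j) (node i j s)) ≋ node i′ j′ s
    node-shift i j i′ j′ s = ≋-trans (pow-cong a (i′ ⊝ i) (≋-trans (≋-sym (pow-pow i (j′ ⊝ j) (pow b j (u s)))) (pow-cong a i (pow-⊝ b^m j′ j (u s)))))
      (pow-⊝ a^m i′ i (pow b j′ (u s)))

    rows-+ : ∀ k l x → rows (k ℕ.+ l) x ↭ rows k x ++ rows l (pow b k x)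
    rows-+ zero    l x = ↭-refl
    rows-+ (suc k) l x = ↭-trans (++⁺ˡ (row x) (↭-trans (rows-+ k l (b ∙ x)) (++⁺ˡ (rows k (b ∙ x)) (rows-cong l (pow-suc b k x)))))
      (↭-reflexive (≡.sym (++-assoc (row x) (rows k (b ∙ x)) _)))

    rows-b : ∀ x → rows m (b ∙ x) ↭ rows m x
    rows-b x = ↭-trans (↭-reflexive (≡.cong (λ k → rows k (b ∙ x)) (ℕ.+-comm 1 (suc n))))
      (↭-trans (rows-+ (suc n) 1 (b ∙ x)) (↭-trans (++-comm (rows (suc n) (b ∙ x)) _)
        (++⁺ʳ (rows (suc n) (b ∙ x)) (↭-trans (rows-cong 1 (≋-trans (pow-suc b (suc n) x) (b^m x))) (↭-reflexive (++-identityʳ (row x)))))))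

    rows-pow-a : ∀ k i x → rows k (pow a i x) ↭ rows k x
    rows-pow-a k zero    x = ↭-refl
    rows-pow-a k (suc i) x = ↭-trans (rows-rotate k (pow a i x)) (rows-pow-a k i x)

    rows-pow-b : ∀ i x → rows m (pow b i x) ↭ rows m x
    rows-pow-b zero    x = ↭-refl
    rows-pow-b (suc i) x = ↭-trans (rows-b (pow b i x)) (rows-pow-b i x)

    T : K → List C
    T s = rows m (node 0 0 s)

    T-cong : ∀ {s t} → s ≈ t → T s ↭ T t
    T-cong p = rows-cong m (node-cong 0 0 p)

    Traversable : ℕ → Set _
    Traversable K = ∀ r p → r < K → p < m → odd (p ℕ.+ r) ≡ true → ∀ x → Path (rows K x) x (pow a p (pow b r x))

    traverse≥2 : ∀ k → Traversable (2 ℕ.+ k)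
    traverse≥2 k r p r<K p<m o x = cylinder k r p r<K p<m (inj₁ o) x

    traverse₁ : n ≡ 0 → Traversable 1
    traverse₁ refl zero    zero    _ _ () x
    traverse₁ refl zero    (suc zero) _ _ _ x = path-↭ (↭-reflexive (≡.sym (++-identityʳ (row x))))
      (path-resp ≋-refl (≋-trans (∙-congˡ′ (≋-sym (a^m x))) (cancelˡ a (a ∙ x))) (around x))
    traverse₁ refl zero    (suc (suc p)) _ (s<s (s<s ())) _ x
    traverse₁ refl (suc r) p (s<s ()) _ _ x

    k₁ k₂ : ℕ
    k₁ = cut n
    k₂ = cut′ n

    k₁+k₂ : k₁ ℕ.+ k₂ ≡ m
    k₁+k₂ = cut-sum n

    traverse-k₁ : Traversable k₁
    traverse-k₁ = by n refl
      where
      by : ∀ n′ → n′ ≡ n → Traversable (cut n′)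
      by zero    eq = traverse₁ (≡.sym eq)
      by (suc _) _  = traverse≥2 0

    traverse-k₂ : Traversable k₂
    traverse-k₂ = by n refl
      where
      by : ∀ n′ → n′ ≡ n → Traversable (cut′ n′)
      by zero          eq = traverse₁ (≡.sym eq)
      -- m = 3 would leave a single triangle as second part, but m is even.
      by (suc zero)    eq = ⊥-elim (true≢false (≡.trans (≡.cong odd eq) even))
        where
        true≢false : ¬ true ≡ false
        true≢false ()
      by (suc (suc k)) _  = traverse≥2 k

    traverse-m : Traversable m
    traverse-m = traverse≥2 n

    Opposite : ℕ → ℕ → ℕ → ℕ → Set
    Opposite i j i′ j′ = odd (i ℕ.+ j) xor odd (i′ ℕ.+ j′) ≡ true

    opposite-⊝ : ∀ i j i′ j′ → Opposite i j i′ j′ → odd ((i′ ⊝ i) ℕ.+ (j′ ⊝ j)) ≡ true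
    opposite-⊝ i j i′ j′ o = ≡.trans (odd-+ (i′ ⊝ i) (j′ ⊝ j)) (≡.trans (≡.cong₂ _xor_ (odd-⊝ i′ i) (odd-⊝ j′ j))
      (≡.trans (lemma (odd i) (odd j) (odd i′) (odd j′)) (≡.trans (≡.sym (≡.cong₂ _xor_ (odd-+ i j) (odd-+ i′ j′))) o)))
      where
      lemma : ∀ p q p′ q′ → (p′ xor p) xor (q′ xor q) ≡ (p xor q) xor (p′ xor q′)
      lemma p q p′ q′ = ≡.trans (≡.cong₂ _xor_ (Bool.xor-comm p′ p) (Bool.xor-comm q′ q))
        (≡.trans (Bool.xor-assoc p p′ (q xor q′)) (≡.trans (≡.cong (p xor_) (≡.trans (≡.sym (Bool.xor-assoc p′ q q′))
          (≡.trans (≡.cong (_xor q′) (Bool.xor-comm p′ q)) (Bool.xor-assoc q p′ q′)))) (≡.sym (Bool.xor-assoc p q (p′ xor q′)))))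

    within : ∀ K → Traversable K → ∀ i j i′ j′ s → (j′ ⊝ j) < K → Opposite i j i′ j′ →
      Path (rows K (node 0 j s)) (node i j s) (node i′ j′ s)
    within K tr i j i′ j′ s r<K o = path-↭ (rows-pow-a K i (pow b j (u s)))
      (path-resp ≋-refl (node-shift i j i′ j′ s)
        (tr (j′ ⊝ j) (i′ ⊝ i) r<K (m%n<n (i′ ℕ.+ i ℕ.* suc n) m) (opposite-⊝ i j i′ j′ o) (node i j s)))

    full : ∀ i j i′ j′ s → Opposite i j i′ j′ → Path (T s) (node i j s) (node i′ j′ s)
    full i j i′ j′ s o = path-↭ (rows-pow-b j (u s)) (within m traverse-m i j i′ j′ s (m%n<n (j′ ℕ.+ j ℕ.* suc n) m) o)

    ⊝-+ : ∀ r j → r < m → (j ℕ.+ r) ⊝ j ≡ r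
    ⊝-+ r j r<m = ≡.trans (≡.cong (_% m) arith) (≡.trans ([m+kn]%n≡m%n r j m) (m<n⇒m%n≡m r<m))
      where
      arith : j ℕ.+ r ℕ.+ j ℕ.* suc n ≡ r ℕ.+ j ℕ.* m
      arith = ≡.trans (≡.cong (ℕ._+ j ℕ.* suc n) (ℕ.+-comm j r)) (≡.trans (ℕ.+-assoc r j (j ℕ.* suc n)) (≡.cong (r ℕ.+_) (≡.sym (ℕ.*-suc j (suc n)))))

    -- A step by u_1 adds g^(i + j e) to the third coordinate. With ±(t - s) = g^k an edge exists as
    -- soon as i + j e = k modulo m, which can be solved for i in any row j; as e and m - 1 are odd,
    -- i + j gets the parity of k.
    link : ∀ {p s t} → Par p (t - s) → ∀ j → ∃[ i ] odd (i ℕ.+ j) ≡ p × Adj (node i j s) (node i j t)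
    link {p} {s} {t} (k , odd-k , sign) j = i , parity , edge sign
      where
      c₀ i : ℕ
      c₀ = e ℕ.* suc n
      i = k ℕ.+ j ℕ.* c₀
      odd-c : odd c₀ ≡ true
      odd-c = ≡.trans (odd-*ˡ (suc n) odd-m-1 e) odd-e
      parity : odd (i ℕ.+ j) ≡ p
      parity = ≡.trans (odd-+ i j) (≡.trans (≡.cong (_xor odd j) (≡.trans (odd-+ k (j ℕ.* c₀)) (≡.cong (odd k xor_) (odd-*ˡ c₀ odd-c j))))
        (≡.trans (Bool.xor-assoc (odd k) (odd j) (odd j)) (≡.trans (≡.cong (odd k xor_) (xor-same (odd j))) (≡.trans (Bool.xor-identityʳ _) odd-k))))
      arith : i ℕ.+ j ℕ.* e ≡ k ℕ.+ (j ℕ.* e) ℕ.* m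
      arith = ≡.trans (ℕ.+-assoc k (j ℕ.* c₀) (j ℕ.* e)) (≡.cong (k ℕ.+_) (≡.trans (ℕ.+-comm (j ℕ.* c₀) (j ℕ.* e))
        (≡.trans (≡.cong (j ℕ.* e ℕ.+_) (≡.sym (ℕ.*-assoc j e (suc n)))) (≡.sym (ℕ.*-suc (j ℕ.* e) (suc n))))))
      g^ : g ^ (i ℕ.+ j ℕ.* e) ≈ g ^ k
      g^ = ≈-trans (reflexive (≡.cong (g ^_) arith)) (≈-trans (^-homo-* g k ((j ℕ.* e) ℕ.* m)) (≈-trans (*-congˡ (g^m* (j ℕ.* e))) (*-identityʳ _)))
      moves : ∀ {x y} → y - x ≈ g ^ k → Adj (node i j x) (node i j y)
      moves {x} {y} d = adj-resp ≋-refl (≋-trans (law i j 1# x) (node-cong i j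
        (≈-trans (+-congʳ (≈-trans (*-identityˡ _) (≈-trans g^ (≈-sym d)))) (solve 2 (λ x y → (y :- x) :+ x := y) ≈-refl x y))))
        (u-step (node i j x))
      edge : t - s ≈ g ^ k ⊎ - (t - s) ≈ g ^ k → Adj (node i j s) (node i j t)
      edge (inj₁ d) = moves d
      edge (inj₂ d) = adj-sym (moves (≈-trans (solve 2 (λ s t → s :- t := :- (t :- s)) ≈-refl s t) d))

    concatMap-↭ : ∀ (B : K → List C) → (∀ {s t} → s ≈ t → B s ↭ B t) → ∀ {l l′} → l PF.↭ l′ → concatMap B l ↭ concatMap B l′
    concatMap-↭ B B-cong (PF.refl p) = pointwise p
      where
      pointwise : ∀ {l l′} → Pointwise _≈_ l l′ → concatMap B l ↭ concatMap B l′
      pointwise []       = ↭-refl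
      pointwise (p ∷ ps) = ++⁺ (B-cong p) (pointwise ps)
    concatMap-↭ B B-cong (PF.prep p q) = ++⁺ (B-cong p) (concatMap-↭ B B-cong q)
    concatMap-↭ B B-cong (PF.swap {x = x} {y} p p′ q) = ↭-trans (shifts (B x) (B y))
      (++⁺ (B-cong p′) (++⁺ (B-cong p) (concatMap-↭ B B-cong q)))
    concatMap-↭ B B-cong (PF.trans q r) = ↭-trans (concatMap-↭ B B-cong q) (concatMap-↭ B B-cong r)

    all : List C
    all = T 0# ++ concatMap T (spiralTo 1#)

    all-↭ : ∀ {v} → ¬ v ≈ 0# → T 0# ++ concatMap T (spiralTo v) ↭ all
    all-↭ v≉0 = ++⁺ˡ (T 0#) (concatMap-↭ T T-cong (SetoidLists.unique-↭ ≈-setoid (spiralTo-unique v≉0) (spiralTo-unique 1≉0)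
      (λ x∈ → spiralTo-complete 1≉0 (spiralTo-sound v≉0 x∈)) (λ x∈ → spiralTo-complete v≉0 (spiralTo-sound 1≉0 x∈))))

    -- Walks that enter the spiral in row j₁ and stay in it; the tori that are
    -- visited twice are split into k₁ rows from row j₁ on and k₂ rows from row j₂ on.
    module Rows (j₁ : ℕ) where

      j₂ : ℕ
      j₂ = k₁ ℕ.+ j₁

      P Q : K → List C
      P s = rows k₁ (node 0 j₁ s)
      Q s = rows k₂ (node 0 j₂ s)

      P++Q : ∀ s → P s ++ Q s ↭ T s
      P++Q s = ↭-trans (++⁺ˡ (P s) (rows-cong k₂ (pow-+ b k₁ j₁ (u s)))) (↭-trans (↭-sym (rows-+ k₁ k₂ (node 0 j₁ s)))
        (↭-trans (↭-reflexive (≡.cong (λ k → rows k (node 0 j₁ s)) k₁+k₂)) (rows-pow-b j₁ (u s))))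

      Q-cong : ∀ {s t} → s ≈ t → Q s ↭ Q t
      Q-cong p = rows-cong k₂ (node-cong 0 j₂ p)

      same-row : ∀ j → j ⊝ j ≡ 0
      same-row j = ≡.trans (≡.cong (_⊝ j) (≡.sym (ℕ.+-identityʳ j))) (⊝-+ 0 j z<s)

      in-P : ∀ i i′ s → Opposite i j₁ i′ j₁ → Path (P s) (node i j₁ s) (node i′ j₁ s)
      in-P i i′ s = within k₁ traverse-k₁ i j₁ i′ j₁ s (subst (_< k₁) (≡.sym (same-row j₁)) (cut>0 n))

      in-Q : ∀ i i′ s → Opposite i j₂ i′ j₂ → Path (Q s) (node i j₂ s) (node i′ j₂ s)
      in-Q i i′ s = within k₂ traverse-k₂ i j₂ i′ j₂ s (subst (_< k₂) (≡.sym (same-row j₂)) (cut′>0 n))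

      Visit : (K → List C) → Set _
      Visit B = ∀ i i′ s → Opposite i j₁ i′ j₁ → Path (B s) (node i j₁ s) (node i′ j₁ s)

      -- Only the first k₁ rows of the torus of t are visited.
      halve : K → (K → List C) → K → List C
      halve t B s with s ≟F t
      ... | yes _ = P s
      ... | no  _ = B s

      visit-T : Visit T
      visit-T i i′ s = full i j₁ i′ j₁ s

      visit-halve : ∀ t {B} → Visit B → Visit (halve t B)
      visit-halve t visit i i′ s o with s ≟F t
      ... | yes _ = in-P i i′ s o
      ... | no  _ = visit i i′ s o

      halve-other : ∀ t B {s} → ¬ s ≈ t → halve t B s ≡ B s
      halve-other t B {s} s≉t with s ≟F t
      ... | yes p = ⊥-elim (s≉t p)
      ... | no  _ = refl

      halve-same : ∀ t B {s} → s ≈ t → halve t B s ≡ P s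
      halve-same t B {s} s≈t with s ≟F t
      ... | yes _ = refl
      ... | no ¬p = ⊥-elim (¬p s≈t)

      halve-all : ∀ t B {l} → ¬ t ∈ l → concatMap (halve t B) l ≡ concatMap B l
      halve-all t B {[]}    t∉ = refl
      halve-all t B {s ∷ l} t∉ = ≡.cong₂ _++_ (halve-other t B λ s≈t → t∉ (here (≈-sym s≈t))) (halve-all t B λ t∈ → t∉ (there t∈))

      -- Without repetitions the torus of `t` occurs just once in the list, so adding its missing
      -- part restores exactly one block.
      complete-halve : ∀ t B {l} → Unique l → t ∈ l → (∀ {s} → s ≈ t → B s ↭ T s) →
        concatMap (halve t B) l ++ Q t ↭ concatMap B l
      complete-halve t B {s ∷ l} (s∉ ∷ ul) (here t≈s) Bt = ↭-trans
        (↭-reflexive (≡.cong (_++ Q t) (≡.cong₂ _++_ (halve-same t B (≈-sym t≈s)) (halve-all t B t∉l))))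
        (↭-trans (↭-reflexive (++-assoc (P s) (concatMap B l) (Q t))) (↭-trans (++⁺ˡ (P s) (++-comm (concatMap B l) (Q t)))
          (↭-trans (↭-reflexive (≡.sym (++-assoc (P s) (Q t) (concatMap B l))))
            (++⁺ʳ (concatMap B l) (↭-trans (++⁺ˡ (P s) (Q-cong t≈s)) (↭-trans (P++Q s) (↭-sym (Bt (≈-sym t≈s)))))))))
        where
        t∉l : ¬ t ∈ l
        t∉l t∈ = MemP.All[≉]⇒∉ ≈-setoid s∉ (MemP.∈-resp-≈ ≈-setoid t≈s t∈)
      complete-halve t B {s ∷ l} (s∉ ∷ ul) (there t∈) Bt = ↭-trans
        (↭-reflexive (≡.trans (++-assoc (halve t B s) (concatMap (halve t B) l) (Q t))
          (≡.cong (_++ (concatMap (halve t B) l ++ Q t)) (halve-other t B λ s≈t → MemP.All[≉]⇒∉ ≈-setoid s∉ (MemP.∈-resp-≈ ≈-setoid (≈-sym s≈t) t∈)))))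
        (++⁺ˡ (B s) (complete-halve t B ul t∈ Bt))

      flips : ℕ → Bool → Bool
      flips zero    p = p
      flips (suc k) p = flips k (not p)

      -- A torus entered at parity p is left at the opposite parity, and the crossing from τ to γ τ
      -- happens at the parity of (γ - 1) τ. One step multiplies this difference by the odd γ, so
      -- the condition required for the next torus holds again with p negated.
      along : ∀ {B} → Visit B → ∀ k τ i p {R y} → odd (i ℕ.+ j₁) ≡ p → Par (not p) ((γ - 1#) * τ) →
        (∀ i′ τ′ → τ′ ≈ γ ^ k * τ → odd (i′ ℕ.+ j₁) ≡ flips k p → Path R (node i′ j₁ τ′) y) →
        Path (concatMap B (geometric k τ) ++ R) (node i j₁ τ) y
      along visit zero    τ i p o par continue = continue i τ (≈-sym (*-identityˡ τ)) o
      along {B} visit (suc k) τ i p {R} o par continue = path-↭ (↭-reflexive (≡.sym (++-assoc (B τ) (concatMap B (geometric k (γ * τ))) R)))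
        (path-++ (visit i i₁ τ (≡.trans (≡.cong₂ _xor_ o o₁) (xor-not p)))
          edge (along visit k (γ * τ) i₁ (not p) o₁ par′ λ i′ τ′ eq → continue i′ τ′ (≈-trans eq (γ^suc k τ))))
        where
        l = link {not p} {τ} {γ * τ} (par-cong (solve 2 (λ g t → (g :- :1) :* t := g :* t :- t) ≈-refl γ τ) par) j₁
        i₁ = proj₁ l
        o₁ = proj₁ (proj₂ l)
        edge = proj₂ (proj₂ l)
        par′ : Par (not (not p)) ((γ - 1#) * (γ * τ))
        par′ = par-cong (solve 2 (λ g t → g :* ((g :- :1) :* t) := (g :- :1) :* (g :* t)) ≈-refl γ τ) (par-* odd-γ par)

      flips-odd : ∀ k p → flips k p ≡ odd k xor p
      flips-odd zero    p = refl
      flips-odd (suc k) p = ≡.trans (flips-odd k (not p)) (lemma (odd k) p)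
        where
        lemma : ∀ x y → x xor not y ≡ not x xor y
        lemma true  y = Bool.not-involutive y
        lemma false y = refl

      -- For even v the first difference γ v - 0 is odd, and so is the vertex at which the spiral is
      -- entered. The m - 1 crossings that follow are odd in number, so the torus of v is entered at
      -- an even vertex.
      spiralWalk : ∀ {B} → Visit B → ∀ {X R y} v → Par false v →
        (∀ i → odd (i ℕ.+ j₁) ≡ true → Path X ε (node i j₁ 0#)) →
        (∀ i → odd (i ℕ.+ j₁) ≡ false → Path R (node i j₁ v) y) →
        Path (X ++ (concatMap B (geometric (suc n) (γ * v)) ++ R)) ε y
      spiralWalk visit {X} {R} {y} v pv start continue = path-++ (start i₀ o₀) edge
        (along visit (suc n) (γ * v) i₀ true o₀ (par-* odd-γ-1 odd-γv) λ i′ τ′ eq o′ →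
          path-resp (node-cong i′ j₁ (≈-sym (≈-trans eq (spiral-end v)))) ≋-refl
            (continue i′ (≡.trans o′ (≡.trans (flips-odd (suc n) true) (≡.cong (_xor true) odd-m-1)))))
        where
        odd-γv : Par true (γ * v)
        odd-γv = par-* odd-γ pv
        l = link {true} {0#} {γ * v} (par-cong (solve 1 (λ x → x := x :- :0) ≈-refl (γ * v)) odd-γv) j₁
        i₀ = proj₁ l
        o₀ = proj₁ (proj₂ l)
        edge = proj₂ (proj₂ l)

      spiral-blocks : ∀ B v R → B v ≡ T v → concatMap B (geometric (suc n) (γ * v)) ++ (T v ++ R) ≡ concatMap B (spiralTo v) ++ R
      spiral-blocks B v R Bv = ≡.trans (≡.sym (++-assoc (concatMap B l) (T v) R)) (≡.cong (_++ R) (≡.sym (≡.trans (concatMap-++ B l [ v ])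
        (≡.cong (concatMap B l ++_) (≡.trans (++-identityʳ (B v)) Bv)))))
        where l = geometric (suc n) (γ * v)

      -- Change of row inside the torus of v, then an edge to the torus of w.
      turn : ∀ {v w R y} → Par true (w - v) → (∀ i → odd (i ℕ.+ j₂) ≡ true → Path R (node i j₂ w) y) →
        ∀ i → odd (i ℕ.+ j₁) ≡ false → Path (T v ++ R) (node i j₁ v) y
      turn {v} {w} par continue i o = path-++ (full i j₁ i′ j₂ v (≡.cong₂ _xor_ o o′)) edge (continue i′ o′)
        where
        l = link {true} {v} {w} par j₂
        i′ = proj₁ l
        o′ = proj₁ (proj₂ l)
        edge = proj₂ (proj₂ l)

      -- The continuation of `turn` through a torus whose lower part was used by the spiral: the
      -- walk stays in row j₂ and leaves at parity `p`.
      second : ∀ p {v w R y} → Par p (w - v) → (∀ i → odd (i ℕ.+ j₂) ≡ p → Path R (node i j₂ w) y) →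
        ∀ i → odd (i ℕ.+ j₂) ≡ not p → Path (Q v ++ R) (node i j₂ v) y
      second p {v} {w} par continue i o = path-++ (in-Q i i′ v (≡.trans (≡.cong₂ _xor_ o o′) (not-xor p))) edge (continue i′ o′)
        where
        not-xor : ∀ p → not p xor p ≡ true
        not-xor true  = refl
        not-xor false = refl
        l = link {p} {v} {w} par j₂
        i′ = proj₁ l
        o′ = proj₁ (proj₂ l)
        edge = proj₂ (proj₂ l)

    ε≋node : ∀ {s} → s ≈ 0# → ε ≋ node 0 0 s
    ε≋node s≈0 = ≋-trans (≋-sym u-zero) (u-cong (≈-sym s≈0))

    start-full : ∀ j i → odd (i ℕ.+ j) ≡ true → Path (T 0#) ε (node i j 0#)
    start-full j i o = path-resp (≋-sym (ε≋node ≈-refl)) ≋-refl (full 0 0 i j 0# o)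

    -- Each torus is traversed once. The even `s` comes last in the spiral, so its torus is entered
    -- at an even vertex and the walk ends at an odd one.
    walk-odd : ∀ i j s → Par false s → odd (i ℕ.+ j) ≡ true → Path all ε (node i j s)
    walk-odd i j s ps o = path-↭ (↭-trans (++⁺ˡ (T 0#) (↭-reflexive
        (≡.trans (≡.cong (concatMap T (geometric (suc n) (γ * s)) ++_) (≡.sym (++-identityʳ (T s)))) (≡.trans (spiral-blocks T s [] refl) (++-identityʳ _)))))
        (all-↭ (par≉0 ps)))
      (spiralWalk visit-T s ps (start-full 0) λ i′ o′ → full i′ 0 i j s (≡.cong₂ _xor_ o′ o))
      where open Rows 0

    -- An even end calls for one more traversal, so the torus of s is visited twice: its lower part
    -- when the spiral passes s, its upper part at the end, entered at an odd vertex from the torus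
    -- of an even v with s - v odd.
    walk-even : ∀ i j s → ¬ s ≈ 0# → odd (i ℕ.+ j) ≡ false → Path all ε (node i j s)
    walk-even i j s s≉0 ev = path-↭ perm
          (spiralWalk (visit-halve s visit-T) v pv (start-full j₁) (turn ps-v λ i′ o′ →
            path-resp ≋-refl end (in-Q i′ i s (≡.trans (≡.cong₂ _xor_ o′ ev′) refl))))
      where
      -- This starting row makes j₂ = j + m, that is row j again: the second visit begins in the row
      -- of the end vertex.
      open Rows (k₂ ℕ.+ j)
      j₁ = k₂ ℕ.+ j
      v = proj₁ (even-odd-sum s s≉0)
      pv = proj₁ (proj₂ (even-odd-sum s s≉0))
      ps-v = proj₂ (proj₂ (even-odd-sum s s≉0))
      j₂≡ : k₁ ℕ.+ (k₂ ℕ.+ j) ≡ j ℕ.+ m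
      j₂≡ = ≡.trans (≡.sym (ℕ.+-assoc k₁ k₂ j)) (≡.trans (≡.cong (ℕ._+ j) k₁+k₂) (ℕ.+-comm m j))
      end : node i j₂ s ≋ node i j s
      end = pow-cong a i (≋-trans (≋-reflexive (≡.cong (λ k → pow b k (u s)) j₂≡)) (≋-trans (pow-+ b j m (u s)) (pow-cong b j (b^m (u s)))))
      ev′ : odd (i ℕ.+ j₂) ≡ false
      ev′ = ≡.trans (≡.cong (λ k → odd (i ℕ.+ k)) j₂≡) (≡.trans (≡.cong odd (≡.sym (ℕ.+-assoc i j m))) (≡.trans (odd-+ (i ℕ.+ j) m)
        (≡.trans (≡.cong₂ _xor_ ev odd-m) refl)))
      v≉0 = par≉0 pv
      v≉s : ¬ v ≈ s
      v≉s v≈s = par≉0 ps-v (≈-trans (+-congˡ (-‿cong v≈s)) (-‿inverseʳ s))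
      perm : T 0# ++ (concatMap (halve s T) (geometric (suc n) (γ * v)) ++ (T v ++ Q s)) ↭ all
      perm = ↭-trans (++⁺ˡ (T 0#) (↭-trans (↭-reflexive (spiral-blocks (halve s T) v (Q s) (halve-other s T v≉s)))
        (complete-halve s T (spiralTo-unique v≉0) (spiralTo-complete v≉0 s≉0) λ _ → ↭-refl))) (all-↭ v≉0)

    module Return where

      open Rows 0

      start-half : ∀ i → odd (i ℕ.+ 0) ≡ true → Path (P 0#) ε (node i 0 0#)
      start-half i o = path-resp (≋-sym (ε≋node ≈-refl)) ≋-refl (in-P 0 i 0# o)

      finish-half : ∀ p i j s → s ≈ 0# → k₁ ≤ j → j < m → odd (i ℕ.+ j) ≡ not p →
        ∀ i′ → odd (i′ ℕ.+ j₂) ≡ p → Path (Q 0#) (node i′ j₂ 0#) (node i j s)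
      finish-half p i j s s≈0 k₁≤j j<m o i′ o′ = path-resp ≋-refl (node-cong i j (≈-sym s≈0))
        (within k₂ traverse-k₂ i′ j₂ i j 0# (subst (_< k₂) (≡.sym row≡) r<k₂) (≡.trans (≡.cong₂ _xor_ o′ o) (xor-not p)))
        where
        r = j ℕ.∸ k₁
        k₁+r : k₁ ℕ.+ r ≡ j
        k₁+r = ℕ.m+[n∸m]≡n k₁≤j
        r<k₂ : r < k₂
        r<k₂ = ℕ.+-cancelˡ-< k₁ r k₂ (subst (ℕ._< k₁ ℕ.+ k₂) (≡.sym k₁+r) (subst (j <_) (≡.sym k₁+k₂) j<m))
        row≡ : j ⊝ j₂ ≡ r
        row≡ = ≡.trans (≡.cong₂ _⊝_ (≡.sym k₁+r) (ℕ.+-identityʳ k₁)) (⊝-+ r k₁ (ℕ.≤-<-trans (ℕ.m∸n≤m j k₁) j<m))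

      -- P 0 ++ (L ++ (R ++ Q 0)) is rearranged so that the two halves of T 0 meet.
      close : ∀ {L} → P 0# ++ (L ++ Q 0#) ↭ T 0# ++ L
      close {L} = ↭-trans (++⁺ˡ (P 0#) (++-comm L (Q 0#))) (↭-trans (↭-reflexive (≡.sym (++-assoc (P 0#) (Q 0#) L))) (++⁺ʳ L (P++Q 0#)))

      minus-zero : ∀ {p x} → Par p x → Par p (0# - x)
      minus-zero px = par-cong (solve 1 (λ x → :- x := :0 :- x) ≈-refl _) (par-neg px)

      -- The last tori are those of v, 1 and 0. The differences 1 - v and 0 - 1 are odd and even, so
      -- the upper part of T 0 is entered at an even vertex.
      return-odd : ∀ i j s → s ≈ 0# → k₁ ≤ j → j < m → odd (i ℕ.+ j) ≡ true → Path all ε (node i j s)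
      return-odd i j s s≈0 k₁≤j j<m o = path-↭ perm
            (spiralWalk (visit-halve 1# visit-T) v pv start-half (turn p1-v
              (second false (minus-zero par-one) (finish-half false i j s s≈0 k₁≤j j<m o))))
        where
        v = proj₁ (even-odd-sum 1# 1≉0)
        pv = proj₁ (proj₂ (even-odd-sum 1# 1≉0))
        p1-v = proj₂ (proj₂ (even-odd-sum 1# 1≉0))
        v≉0 = par≉0 pv
        v≉1 : ¬ v ≈ 1#
        v≉1 e = par≉0 p1-v (≈-trans (+-congˡ (-‿cong e)) (-‿inverseʳ 1#))
        l = geometric (suc n) (γ * v)
        perm : P 0# ++ (concatMap (halve 1# T) l ++ (T v ++ (Q 1# ++ Q 0#))) ↭ all
        perm = ↭-trans (++⁺ˡ (P 0#) (↭-reflexive (≡.trans (spiral-blocks (halve 1# T) v (Q 1# ++ Q 0#) (halve-other 1# T v≉1))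
          (≡.sym (++-assoc (concatMap (halve 1# T) (spiralTo v)) (Q 1#) (Q 0#))))))
          (↭-trans close (↭-trans (++⁺ˡ (T 0#) (complete-halve 1# T (spiralTo-unique v≉0) (spiralTo-complete v≉0 1≉0) λ _ → ↭-refl)) (all-↭ v≉0)))

      -- Now the upper part of T 0 must be entered at an odd vertex. If 1 is odd up to sign, that is
      -- if -1 is not a square, T 0 follows directly on T 1. Otherwise the last tori are those of v,
      -- γ - 1, γ and 0, with differences odd, even, odd; here v ≠ γ because 1 = v γ⁻¹ would be odd.
      return-even : ∀ i j s → s ≈ 0# → k₁ ≤ j → j < m → odd (i ℕ.+ j) ≡ false → Path all ε (node i j s)
      return-even i j s s≈0 k₁≤j j<m ev = [ both , generic ]′ (toSum (Par? true 1#))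
        where
        finish = finish-half true i j s s≈0 k₁≤j j<m ev
        both : Par true 1# → Path all ε (node i j s)
        both p1 = path-↭ perm (spiralWalk visit-T 1# par-one start-half (turn (minus-zero p1) finish))
         where
         perm : P 0# ++ (concatMap T (geometric (suc n) (γ * 1#)) ++ (T 1# ++ Q 0#)) ↭ all
         perm = ↭-trans (++⁺ˡ (P 0#) (↭-reflexive (spiral-blocks T 1# (Q 0#) refl))) close
        generic : ¬ Par true 1# → Path all ε (node i j s)
        generic ¬p1 = path-↭ perm
                (spiralWalk (visit-halve γ (visit-halve d visit-T)) v pv start-half (turn pd-v
                  (second false (par-cong (solve 1 (λ g → :1 := g :- (g :- :1)) ≈-refl γ) par-one)
                    (second true (minus-zero odd-γ) finish))))
         where
          d = γ - 1#
          v = proj₁ (even-odd-sum d (par≉0 odd-γ-1))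
          pv = proj₁ (proj₂ (even-odd-sum d (par≉0 odd-γ-1)))
          pd-v = proj₂ (proj₂ (even-odd-sum d (par≉0 odd-γ-1)))
          v≉0 = par≉0 pv
          v≉d : ¬ v ≈ d
          v≉d e = par≉0 pd-v (≈-trans (+-congˡ (-‿cong e)) (-‿inverseʳ d))
          v≉γ : ¬ v ≈ γ
          v≉γ e = ¬p1 (par-cong inverse (par-* (par-cong e pv) odd-γ⁻¹))
          γ≉d : ¬ γ ≈ d
          γ≉d e = 1≉0 (≈-trans (solve 1 (λ g → :1 := g :- (g :- :1)) ≈-refl γ) (≈-trans (+-congˡ (-‿cong (≈-sym e))) (-‿inverseʳ γ)))
          B = halve γ (halve d T)
          l = geometric (suc n) (γ * v)
          Bγ : ∀ {s} → s ≈ γ → halve d T s ↭ T s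
          Bγ s≈γ = ↭-reflexive (halve-other d T λ s≈d → γ≉d (≈-trans (≈-sym s≈γ) s≈d))
          perm : P 0# ++ (concatMap B l ++ (T v ++ (Q d ++ (Q γ ++ Q 0#)))) ↭ all
          perm = ↭-trans (++⁺ˡ (P 0#) (↭-reflexive (≡.trans
              (spiral-blocks B v (Q d ++ (Q γ ++ Q 0#)) (≡.trans (halve-other γ (halve d T) v≉γ) (halve-other d T v≉d)))
              (≡.trans (≡.cong (concatMap B (spiralTo v) ++_) (≡.sym (++-assoc (Q d) (Q γ) (Q 0#))))
                (≡.sym (++-assoc (concatMap B (spiralTo v)) (Q d ++ Q γ) (Q 0#)))))))
            (↭-trans close (↭-trans (++⁺ˡ (T 0#)
              (↭-trans (++⁺ˡ (concatMap B (spiralTo v)) (++-comm (Q d) (Q γ)))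
              (↭-trans (↭-reflexive (≡.sym (++-assoc (concatMap B (spiralTo v)) (Q γ) (Q d))))
              (↭-trans (++⁺ʳ (Q d) (complete-halve γ (halve d T) (spiralTo-unique v≉0) (spiralTo-complete v≉0 (par≉0 odd-γ)) Bγ))
                (complete-halve d T (spiralTo-unique v≉0) (spiralTo-complete v≉0 (par≉0 odd-γ-1)) λ _ → ↭-refl)))))
              (all-↭ v≉0)))

      return-path : ∀ i j s → s ≈ 0# → k₁ ≤ j → j < m → Path all ε (node i j s)
      return-path i j s s≈0 k₁≤j j<m = by (odd (i ℕ.+ j)) refl
        where
        by : ∀ p → odd (i ℕ.+ j) ≡ p → Path all ε (node i j s)
        by true  = return-odd i j s s≈0 k₁≤j j<m
        by false = return-even i j s s≈0 k₁≤j j<m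

    -- Inverting a vertex turns the sign-sensitive case of walk-odd into the other one.
    walk-odd⁻¹ : ∀ i j s → Par true s → odd (i ℕ.+ j) ≡ true → ∃[ z ] node i j s ∙ z ≋ ε × Path all ε z
    walk-odd⁻¹ i j s ps o = node i′ j′ t , product ,
      walk-odd i′ j′ t (par-neg (par-* ps (i′ ℕ.+ j′ ℕ.* e , odd-exp , inj₁ ≈-refl))) odd′
      where
      i′ j′ : ℕ
      i′ = i ℕ.* suc n
      j′ = j ℕ.* suc n
      t = - (s * g ^ (i′ ℕ.+ j′ ℕ.* e))
      odd′ : odd (i′ ℕ.+ j′) ≡ true
      odd′ = ≡.trans (odd-+ i′ j′) (≡.trans (≡.cong₂ _xor_ (odd-*ˡ (suc n) odd-m-1 i) (odd-*ˡ (suc n) odd-m-1 j)) (≡.trans (≡.sym (odd-+ i j)) o))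
      odd-exp : odd (i′ ℕ.+ j′ ℕ.* e) ≡ true
      odd-exp = ≡.trans (odd-+ i′ (j′ ℕ.* e)) (≡.trans (≡.cong (odd i′ xor_) (odd-*ˡ e odd-e j′)) (≡.trans (≡.sym (odd-+ i′ j′)) odd′))
      back : ∀ {a} → (∀ x → pow a m x ≋ x) → ∀ k x → pow a k (pow a (k ℕ.* suc n) x) ≋ x
      back {a} a^m k x = ≋-trans (≋-sym (pow-+ a k (k ℕ.* suc n) x)) (≋-trans (≋-reflexive (≡.cong (λ l → pow a l x) (≡.sym (ℕ.*-suc k (suc n))))) (pow-m* a^m k x))
      product : node i j s ∙ node i′ j′ t ≋ ε
      product = ≋-trans (pow-∙ a i _ _) (≋-trans (pow-cong a i (≋-trans (pow-∙ b j _ _) (pow-cong b j (≋-trans (law i′ j′ s t)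
        (≋-trans (node-cong i′ j′ (-‿inverseʳ _)) (pow-pow i′ j′ (u 0#)))))))
        (≋-trans (pow-cong a i (back b^m j (pow a i′ (u 0#)))) (≋-trans (back a^m i (u 0#)) u-zero)))

    Coordinates : C → Set _
    Coordinates v = ∃[ i ] ∃[ j ] ∃[ s ] i < m × j < m × v ≋ node i j s

    private
      module V∈ = Mem V

      ∈T⁻ : ∀ {v} s → v V∈.∈ T s → ∃[ i ] ∃[ j ] i < m × j < m × v ≋ node i j s
      ∈T⁻ s = ∈rows⁻ m (u s)

    all-complete : ∀ {v} → Coordinates v → v V∈.∈ all
    all-complete {v} (i , j , s , i<m , j<m , p) with s ≟F 0#
    ... | yes s≈0 = MemP.∈-++⁺ˡ V (∈rows⁺ i j (u 0#) i<m j<m (≋-trans p (node-cong i j s≈0)))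
    ... | no  s≉0 = MemP.∈-++⁺ʳ V (T 0#) (MemP.∈-concatMap⁺ ≈-setoid V (any (spiralTo-complete 1≉0 s≉0)))
      where
      any : ∀ {l} → s ∈ l → Any (λ t → v V∈.∈ T t) l
      any (here s≈t) = here (∈rows⁺ i j (u _) i<m j<m (≋-trans p (node-cong i j s≈t)))
      any (there q)  = there (any q)

    all-sound : ∀ {v} → v V∈.∈ all → Coordinates v
    all-sound {v} p with MemP.∈-++⁻ V (T 0#) p
    ... | inj₁ q = let (i , j , i<m , j<m , r) = ∈T⁻ 0# q in i , j , 0# , i<m , j<m , r
    ... | inj₂ q = any (MemP.∈-concatMap⁻ ≈-setoid V {xs = spiralTo 1#} q)
      where
      any : ∀ {l} → Any (λ t → v V∈.∈ T t) l → Coordinates v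
      any (here {x = s} q) = let (i , j , i<m , j<m , r) = ∈T⁻ s q in i , j , s , i<m , j<m , r
      any (there q) = any q

    module _ (injective : ∀ {i j s i′ j′ t} → i < m → j < m → i′ < m → j′ < m → node i j s ≋ node i′ j′ t → i ≡ i′ × j ≡ j′ × s ≈ t) where

      private
        module V! = Uniq V

        T-unique : ∀ s → V!.Unique (T s)
        T-unique s = rows-unique m (u s) λ i<m r<m i′<m r′<m p → let (p₁ , p₂ , _) = injective i<m r<m i′<m r′<m p in p₁ , p₂

        T-disjoint : ∀ {s t} → ¬ s ≈ t → ∀ {v} → ¬ (v V∈.∈ T s × v V∈.∈ T t)
        T-disjoint {s} {t} s≉t (p , p′) with ∈T⁻ s p | ∈T⁻ t p′
        ... | i , j , i<m , j<m , q | i′ , j′ , i′<m , j′<m , q′ =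
              s≉t (proj₂ (proj₂ (injective i<m j<m i′<m j′<m (≋-trans (≋-sym q) q′))))

        concat-unique : ∀ l → Unique l → V!.Unique (concatMap T l)
        concat-unique []      _         = []
        concat-unique (s ∷ l) (s∉ ∷ ul) = UniqP.++⁺ V (T-unique s) (concat-unique l ul) λ (p , p′) →
          apart s∉ p (MemP.∈-concatMap⁻ ≈-setoid V {xs = l} p′)
          where
          apart : ∀ {l v} → All (λ t → ¬ s ≈ t) l → v V∈.∈ T s → Any (λ t → v V∈.∈ T t) l → ⊥
          apart (s≉t ∷ _) p (here q)  = T-disjoint s≉t (p , q)
          apart (_ ∷ s∉)  p (there q) = apart s∉ p q

      all-unique : V!.Unique all
      all-unique = concat-unique (0# ∷ spiralTo 1#)
        (MemP.∉⇒All[≉] ≈-setoid (λ 0∈ → spiralTo-sound 1≉0 0∈ ≈-refl) ∷ spiralTo-unique 1≉0)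

    sweep : Sweep F G _≟_ S m k₁ Par node
    sweep = record
      { all          = all
      ; all-complete = all-complete
      ; all-sound    = all-sound
      ; all-unique   = all-unique
      ; walk-even    = walk-even
      ; walk-odd     = walk-odd
      ; walk-odd⁻¹   = walk-odd⁻¹
      ; return-path  = Return.return-path
      }

-- Torus coordinates on triangular matrices

-- A group of matrices that differ from the identity only in two rows, with
-- entries (p, 0) and (r, d) there.
record Triangular {c ℓ q} (F : FiniteField c ℓ q) {c′ ℓ′} (G : Group c′ ℓ′) (t : Level) : Set (c ⊔ ℓ ⊔ c′ ⊔ ℓ′ ⊔ lsuc t) where

  open FiniteField F using (_≈_; 0#; 1#; _*_; _+_) renaming (Carrier to K)
  open Group G using (_∙_; ε) renaming (Carrier to C; _≈_ to _≋_)

  field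
    Shape          : C → K → K → K → Set t
    shape-resp     : ∀ {X Y p r d} → X ≋ Y → Shape X p r d → Shape Y p r d
    shape-≋        : ∀ {X Y p r d p′ r′ d′} → Shape X p r d → Shape Y p′ r′ d′ → p ≈ p′ → r ≈ r′ → d ≈ d′ → X ≋ Y
    shape-entries  : ∀ {X Y p r d p′ r′ d′} → Shape X p r d → Shape Y p′ r′ d′ → X ≋ Y → p ≈ p′ × r ≈ r′ × d ≈ d′
    shape-ε        : Shape ε 1# 0# 1#
    scale₀ scaleₙ  : (A A′ : K) → A′ * A ≈ 1# → C
    shape-scale₀   : ∀ {A A′} (A′A : A′ * A ≈ 1#) {X p r d} → Shape X p r d → Shape (scale₀ A A′ A′A ∙ X) (A * p) r d
    shape-scaleₙ   : ∀ {A A′} (A′A : A′ * A ≈ 1#) {X p r d} → Shape X p r d → Shape (scaleₙ A A′ A′A ∙ X) p (A * r) (A * d)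
    u              : K → C
    shape-u∙       : ∀ s {X p r d} → Shape X p r d → Shape (u s ∙ X) p (s * p + r) d

module TriangularPaths {c ℓ q} (F : FiniteField c ℓ q) (α : FiniteField.Carrier F) (generates : IsGenerator F α)
  (k : ℕ) (m≡ : Order.m F α generates ≡ suc (suc k))
  {c′ ℓ′ s′ t} (G : Group c′ ℓ′) (_≟_ : Decidable (Group._≈_ G)) (S : Pred (Group.Carrier G) s′) (triangular : Triangular F G t) where

  open FiniteField F hiding (zero) renaming (refl to ≈-refl; sym to ≈-sym; trans to ≈-trans; Carrier to K; invertible to inv-exists)
  open Exp semiring using (_^_; ^-homo-*; ^-assocʳ; ^-congˡ)
  open Solver commutativeRing
  open Matrices F using (_≟F_)
  open Order F α generates hiding (m; period)
  open Group G using (_∙_; ε; identityˡ; identityʳ) renaming (Carrier to C; _≈_ to _≋_; refl to ≋-refl; sym to ≋-sym; trans to ≋-trans; setoid to V; assoc to ∙-assoc; ∙-congʳ to ∙-congʳ′)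
  open GroupProperties G using (inverseʳ-unique)
  open Cayley G _≟_ S hiding (iterate)
  open Tori G _≟_ S
  open Triangular triangular
  open Mem V using () renaming (_∈_ to _∈V_)
  open Uniq V using (Unique)

  m : ℕ
  m = suc (suc k)

  private
    inverse≉0 : ∀ {x y} → y * x ≈ 1# → ¬ x ≈ 0#
    inverse≉0 yx≈1 x≈0 = 1≉0 (≈-trans (≈-sym yx≈1) (≈-trans (*-congˡ x≈0) (zeroʳ _)))

  inverse-power : ∀ {A B} → B * A ≈ 1# → ∀ i → B ^ i * A ^ i ≈ 1#
  inverse-power BA zero    = *-identityˡ 1#
  inverse-power {A} {B} BA (suc i) = ≈-trans (solve 4 (λ b x a y → (b :* x) :* (a :* y) := (b :* a) :* (x :* y)) ≈-refl B (B ^ i) A (A ^ i))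
    (≈-trans (*-cong BA (inverse-power BA i)) (*-identityˡ 1#))

  primitive-α : Primitive F m α α⁻¹
  primitive-α = record
    { A′A   = α⁻¹α
    ; A^m   = subst (λ l → α ^ l ≈ 1#) m≡ α^m
    ; order = λ i 0<i i<m → α^i≉1 i 0<i (subst (i <_) (≡.sym m≡) i<m)
    ; logᴬ  = λ x x≉0 → let (i , i<m , e) = log x x≉0 in i , subst (i <_) m≡ i<m , e
    }

  αα⁻¹ : α * α⁻¹ ≈ 1#
  αα⁻¹ = ≈-trans (*-comm α α⁻¹) α⁻¹α

  primitive-α⁻¹ : Primitive F m α⁻¹ α
  primitive-α⁻¹ = record
    { A′A   = αα⁻¹
    ; A^m   = ≈-trans (≈-sym (*-identityʳ _)) (≈-trans (*-congˡ (≈-sym P.A^m)) (inverse-power α⁻¹α m))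
    ; order = λ i 0<i i<m e → P.order i 0<i i<m (≈-trans (≈-sym (*-identityˡ _)) (≈-trans (*-congʳ (≈-sym e)) (inverse-power α⁻¹α i)))
    ; logᴬ  = λ x x≉0 → [x] x (inv-exists x x≉0)
    }
    where
    module P = Primitive primitive-α
    [x] : ∀ x → ∃[ y ] y * x ≈ 1# × x * y ≈ 1# → ∃[ i ] i < m × x ≈ α⁻¹ ^ i
    [x] x (y , yx , xy) = let (i , i<m , e) = P.logᴬ y (inverse≉0 xy) in
      i , i<m , ≈-trans (≈-sym (*-identityˡ x)) (≈-trans (*-congʳ (≈-sym (inverse-power α⁻¹α i)))
        (≈-trans (solve 3 (λ b y x → (b :* y) :* x := b :* (y :* x)) ≈-refl (α⁻¹ ^ i) (α ^ i) x)
        (≈-trans (*-congˡ (≈-trans (*-congʳ (≈-sym e)) yx)) (*-identityʳ _))))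

  power-injective : ∀ {A A′} → Primitive F m A A′ → ∀ {i j} → i < m → j < m → A ^ i ≈ A ^ j → i ≡ j
  power-injective {A} {A′} pr {i} {j} i<m j<m e = ℕ.≤-antisym (ℕ.≮⇒≥ λ j<i → apart j<i i<m (≈-sym e)) (ℕ.≮⇒≥ λ i<j → apart i<j j<m e)
    where
    apart : ∀ {i j} → i < j → j < m → ¬ A ^ i ≈ A ^ j
    apart {i} {j} i<j j<m e = Primitive.order pr (j ℕ.∸ i) (ℕ.m<n⇒0<n∸m i<j) (ℕ.≤-<-trans (ℕ.m∸n≤m j i) j<m)
      (≈-trans (≈-sym (*-identityˡ _)) (≈-trans (*-congʳ (≈-sym (inverse-power (Primitive.A′A pr) i))) (≈-trans (*-assoc _ _ _)
        (≈-trans (*-congˡ (≈-trans (≈-sym (^-homo-* A i (j ℕ.∸ i))) (≈-trans (reflexive (≡.cong (A ^_) (ℕ.m+[n∸m]≡n (ℕ.<⇒≤ i<j)))) (≈-sym e))))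
          (inverse-power (Primitive.A′A pr) i)))))


  module _ {A A′ : K} (A′A : A′ * A ≈ 1#) where

    shape-pow₀ : ∀ i {X p r d} → Shape X p r d → ∃[ p′ ] p′ ≈ A ^ i * p × Shape (pow (scale₀ A A′ A′A) i X) p′ r d
    shape-pow₀ zero    h = _ , ≈-sym (*-identityˡ _) , h
    shape-pow₀ (suc i) h = let (_ , e , h′) = shape-pow₀ i h in _ , ≈-trans (*-congˡ e) (≈-sym (*-assoc _ _ _)) , shape-scale₀ A′A h′

    shape-powₙ : ∀ j {X p r d} → Shape X p r d → ∃₂ λ r′ d′ → r′ ≈ A ^ j * r × d′ ≈ A ^ j * d × Shape (pow (scaleₙ A A′ A′A) j X) p r′ d′
    shape-powₙ zero    h = _ , _ , ≈-sym (*-identityˡ _) , ≈-sym (*-identityˡ _) , h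
    shape-powₙ (suc j) h = let (_ , _ , e , e′ , h′) = shape-powₙ j h in
      _ , _ , ≈-trans (*-congˡ e) (≈-sym (*-assoc _ _ _)) , ≈-trans (*-congˡ e′) (≈-sym (*-assoc _ _ _)) , shape-scaleₙ A′A h′

    private
      period : ∀ {a} → pow a m ε ≋ ε → ∀ x → pow a m x ≋ x
      period {a} e x = ≋-trans (pow-cong a m (≋-sym (identityˡ x))) (≋-trans (≋-sym (pow-∙ a m ε x)) (≋-trans (∙-congʳ′ e) (identityˡ x)))

    period₀ : A ^ m ≈ 1# → ∀ x → pow (scale₀ A A′ A′A) m x ≋ x
    period₀ A^m = let (_ , e , h) = shape-pow₀ m shape-ε in period (shape-≋ h shape-ε (≈-trans e (≈-trans (*-identityʳ _) A^m)) ≈-refl ≈-refl)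

    periodₙ : A ^ m ≈ 1# → ∀ x → pow (scaleₙ A A′ A′A) m x ≋ x
    periodₙ A^m = let (_ , _ , e , e′ , h) = shape-powₙ m shape-ε in
      period (shape-≋ h shape-ε ≈-refl (≈-trans e (zeroʳ _)) (≈-trans e′ (≈-trans (*-identityʳ _) A^m)))

    module _ (AA′ : A * A′ ≈ 1#) where

      private
        undo : ∀ x → A * (A′ * x) ≈ x
        undo x = ≈-trans (≈-sym (*-assoc _ _ _)) (≈-trans (*-congʳ AA′) (*-identityˡ x))

        inverse-step : ∀ {a a′} → Steps a → a ∙ a′ ≋ ε → Steps a′
        inverse-step st e = step-inverse st λ x → ≋-trans (≋-sym (∙-assoc _ _ x)) (≋-trans (∙-congʳ′ e) (identityˡ x))

      step₀⁻¹ : Steps (scale₀ A A′ A′A) → Steps (scale₀ A′ A AA′)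
      step₀⁻¹ st = inverse-step st (shape-≋ (shape-scale₀ A′A (shape-resp (identityʳ _) (shape-scale₀ AA′ shape-ε))) shape-ε (undo 1#) ≈-refl ≈-refl)

      stepₙ⁻¹ : Steps (scaleₙ A A′ A′A) → Steps (scaleₙ A′ A AA′)
      stepₙ⁻¹ st = inverse-step st (shape-≋ (shape-scaleₙ A′A (shape-resp (identityʳ _) (shape-scaleₙ AA′ shape-ε))) shape-ε ≈-refl (undo 0#) (undo 1#))

  shape-u : ∀ s → ∃[ r ] r ≈ s × Shape (u s) 1# r 1#
  shape-u s = _ , solve 1 (λ s → s :* :1 :+ :0 := s) ≈-refl s , shape-resp (identityʳ (u s)) (shape-u∙ s shape-ε)

  u-cong : ∀ {s t} → s ≈ t → u s ≋ u t
  u-cong {s} {t} e = let (_ , es , h) = shape-u s ; (_ , et , h′) = shape-u t in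
    shape-≋ h h′ ≈-refl (≈-trans es (≈-trans e (≈-sym et))) ≈-refl

  u-zero : u 0# ≋ ε
  u-zero = let (_ , e , h) = shape-u 0# in shape-≋ h shape-ε ≈-refl e ≈-refl

  module _ {A A′ B B′ : K} (A′A : A′ * A ≈ 1#) (B′B : B′ * B ≈ 1#) where

    private
      a = scale₀ A A′ A′A
      b = scaleₙ B B′ B′B

    scales-commute : Commute a b
    scales-commute = shape-≋ (shape-scale₀ A′A (shape-resp (identityʳ b) (shape-scaleₙ B′B shape-ε)))
      (shape-scaleₙ B′B (shape-resp (identityʳ a) (shape-scale₀ A′A shape-ε))) ≈-refl ≈-refl ≈-refl

    Entries : ℕ → ℕ → K → C → Set _
    Entries i j s X = ∃[ p ] ∃[ r ] ∃[ d ] p ≈ A ^ i × r ≈ B ^ j * s × d ≈ B ^ j × Shape X p r d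

    entries : ∀ i j s → Entries i j s (pow a i (pow b j (u s)))
    entries i j s = let (_ , e , h) = shape-u s ; (_ , _ , er , ed , h′) = shape-powₙ B′B j h ; (_ , ep , h″) = shape-pow₀ A′A i h′ in
      _ , _ , _ , ≈-trans ep (*-identityʳ _) , ≈-trans er (*-congˡ e) , ≈-trans ed (*-identityʳ _) , h″

    entries′ : ∀ i j s → Entries i j s (pow b j (pow a i (u s)))
    entries′ i j s = let (_ , e , h) = shape-u s ; (_ , ep , h′) = shape-pow₀ A′A i h ; (_ , _ , er , ed , h″) = shape-powₙ B′B j h′ in
      _ , _ , _ , ≈-trans ep (*-identityʳ _) , ≈-trans er (*-congˡ e) , ≈-trans ed (*-identityʳ _) , h″

    entries-≋ : ∀ {i j s X Y} → Entries i j s X → Entries i j s Y → X ≋ Y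
    entries-≋ (_ , _ , _ , ep , er , ed , h) (_ , _ , _ , ep′ , er′ , ed′ , h′) =
      shape-≋ h h′ (≈-trans ep (≈-sym ep′)) (≈-trans er (≈-sym er′)) (≈-trans ed (≈-sym ed′))

    entries-u∙ : ∀ {i j t X} s T → B ^ j * T ≈ A ^ i → Entries i j t X → Entries i j (s * T + t) (u s ∙ X)
    entries-u∙ {i} {j} {t} s T e (_ , _ , _ , ep , er , ed , h) = _ , _ , _ , ep ,
      ≈-trans (+-cong (*-congˡ (≈-trans ep (≈-sym e))) er) (solve 4 (λ s b w t → s :* (b :* w) :+ b :* t := b :* (s :* w :+ t)) ≈-refl s (B ^ j) T t) ,
      ed , shape-u∙ s h

    -- `T` is the factor that s picks up when u_s moves to the right of the torus element, namely
    -- A^i / B^j; it is given by an equation to avoid division.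
    node-law : ∀ i j s t T → B ^ j * T ≈ A ^ i → u s ∙ pow a i (pow b j (u t)) ≋ pow a i (pow b j (u (s * T + t)))
    node-law i j s t T e = entries-≋ {i} {j} {s * T + t} (entries-u∙ {i} {j} {t} s T e (entries i j t)) (entries i j (s * T + t))

    node-law′ : ∀ i j s t T → B ^ j * T ≈ A ^ i → u s ∙ pow b j (pow a i (u t)) ≋ pow b j (pow a i (u (s * T + t)))
    node-law′ i j s t T e = entries-≋ {i} {j} {s * T + t} (entries-u∙ {i} {j} {t} s T e (entries′ i j t)) (entries′ i j (s * T + t))

  module Coordinates {A A′ B B′ : K} (pA : Primitive F m A A′) (pB : Primitive F m B B′) where

    private
      module A = Primitive pA
      module B = Primitive pB
      a = scale₀ A A′ A.A′A
      b = scaleₙ B B′ B.A′A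

      undo : ∀ j x → B′ ^ j * (B ^ j * x) ≈ x
      undo j x = ≈-trans (≈-sym (*-assoc _ _ _)) (≈-trans (*-congʳ (inverse-power B.A′A j)) (*-identityˡ x))

    Located : C → K → K → K → Set _
    Located X p r d = ∃[ i ] ∃[ j ] ∃[ σ ] i < m × j < m × p ≈ A ^ i × d ≈ B ^ j × σ ≈ B′ ^ j * r × Entries A.A′A B.A′A i j σ X

    coordinates : ∀ {X p r d} → Shape X p r d → ¬ p ≈ 0# → ¬ d ≈ 0# → Located X p r d
    coordinates {X} {p} {r} {d} h p≉0 d≉0 =
      let (i , i<m , ei) = A.logᴬ p p≉0 ; (j , j<m , ej) = B.logᴬ d d≉0 in
      i , j , B′ ^ j * r , i<m , j<m , ei , ej , ≈-refl , _ , _ , _ , ei ,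
      ≈-sym (≈-trans (solve 3 (λ x y z → x :* (y :* z) := (y :* x) :* z) ≈-refl (B ^ j) (B′ ^ j) r)
        (≈-trans (*-congʳ (inverse-power B.A′A j)) (*-identityˡ r))) , ej , h

    entries-injective : ∀ {i j s i′ j′ t X Y} → i < m → j < m → i′ < m → j′ < m →
      Entries A.A′A B.A′A i j s X → Entries A.A′A B.A′A i′ j′ t Y → X ≋ Y → i ≡ i′ × j ≡ j′ × s ≈ t
    entries-injective {i} {j} {s} {i′} {j′} {t} i<m j<m i′<m j′<m (_ , _ , _ , ep , er , ed , h) (_ , _ , _ , ep′ , er′ , ed′ , h′) X≋Y = i≡ , j≡ , s≈
      where
      same = shape-entries h h′ X≋Y
      i≡ = power-injective pA i<m i′<m (≈-trans (≈-sym ep) (≈-trans (proj₁ same) ep′))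
      j≡ = power-injective pB j<m j′<m (≈-trans (≈-sym ed) (≈-trans (proj₂ (proj₂ same)) ed′))
      s≈ : s ≈ t
      s≈ = ≈-trans (≈-sym (undo j s)) (≈-trans (*-congˡ (≈-trans (≈-sym er) (≈-trans (proj₁ (proj₂ same))
        (≈-trans er′ (*-congʳ (reflexive (≡.cong (B ^_) (≡.sym j≡)))))))) (undo j t))

    injective : ∀ {i j s i′ j′ t} → i < m → j < m → i′ < m → j′ < m →
      pow a i (pow b j (u s)) ≋ pow a i′ (pow b j′ (u t)) → i ≡ i′ × j ≡ j′ × s ≈ t
    injective {i} {j} {s} {i′} {j′} {t} i<m j<m i′<m j′<m = entries-injective {i} {j} {s} {i′} {j′} {t} i<m j<m i′<m j′<m
      (entries A.A′A B.A′A i j s) (entries A.A′A B.A′A i′ j′ t)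

    injective′ : ∀ {i j s i′ j′ t} → i < m → j < m → i′ < m → j′ < m →
      pow b i (pow a j (u s)) ≋ pow b i′ (pow a j′ (u t)) → i ≡ i′ × j ≡ j′ × s ≈ t
    injective′ {i} {j} {s} {i′} {j′} {t} i<m j<m i′<m j′<m e =
      let (p , q , r) = entries-injective {j} {i} {s} {j′} {i′} {t} j<m i<m j′<m i′<m (entries′ A.A′A B.A′A j i s) (entries′ A.A′A B.A′A j′ i′ t) e in q , p , r

  module EvenOrder (even : odd k ≡ false) {t : C} (St : S t) (t≋u : t ≋ u 1#)
    (S₀ : S (scale₀ α α⁻¹ α⁻¹α)) (Sₙ : S (scaleₙ α α⁻¹ α⁻¹α)) where

    private
      u-step : Steps (u 1#)
      u-step = step-resp t≋u (step-gen St)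
      step₀ : Steps (scale₀ α α⁻¹ α⁻¹α)
      step₀ = step-gen S₀
      stepₙ : Steps (scaleₙ α α⁻¹ α⁻¹α)
      stepₙ = step-gen Sₙ
      module Pα = Primitive primitive-α
      module Pβ = Primitive primitive-α⁻¹

    period-+ : ∀ {P} → P ^ m ≈ 1# → ∀ j → P ^ j * P ^ (j ℕ.* suc k) ≈ 1#
    period-+ {P} P^m j = ≈-trans (≈-sym (^-homo-* P j (j ℕ.* suc k))) (≈-trans (reflexive (≡.cong (P ^_) (≡.trans (≡.sym (ℕ.*-suc j (suc k))) (ℕ.*-comm j m))))
      (≈-trans (≈-sym (^-assocʳ P m j)) (≈-trans (^-congˡ j P^m) (1^ j))))

    -- The four slopes write the quotient of the torus entries in the form g^(i + j e): e is m - 1,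
    -- standing for -1, if both directions multiply by the same element, and 1 if they multiply by
    -- inverse ones. In the last two the roles of the directions are exchanged, so that g becomes
    -- `Q`.
    slope₁ : ∀ {P} → P ^ m ≈ 1# → ∀ i j → P ^ j * P ^ (i ℕ.+ j ℕ.* suc k) ≈ P ^ i
    slope₁ {P} P^m i j = ≈-trans (*-congˡ (^-homo-* P i (j ℕ.* suc k))) (≈-trans (solve 3 (λ x y z → x :* (y :* z) := y :* (x :* z)) ≈-refl (P ^ j) (P ^ i) (P ^ (j ℕ.* suc k)))
      (≈-trans (*-congˡ (period-+ P^m j)) (*-identityʳ _)))

    slope₂ : ∀ {P Q} → Q * P ≈ 1# → ∀ i j → Q ^ j * P ^ (i ℕ.+ j ℕ.* 1) ≈ P ^ i
    slope₂ {P} {Q} QP i j = ≈-trans (*-congˡ (≈-trans (reflexive (≡.cong (λ l → P ^ (i ℕ.+ l)) (ℕ.*-identityʳ j))) (^-homo-* P i j)))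
      (≈-trans (solve 3 (λ x y z → x :* (y :* z) := y :* (x :* z)) ≈-refl (Q ^ j) (P ^ i) (P ^ j)) (≈-trans (*-congˡ (inverse-power QP j)) (*-identityʳ _)))

    slope₃ : ∀ {P Q} → Q * P ≈ 1# → Q ^ m ≈ 1# → ∀ i j → P ^ i * Q ^ (i ℕ.+ j ℕ.* suc k) ≈ P ^ j
    slope₃ {P} {Q} QP Q^m i j = ≈-trans (*-congˡ (^-homo-* Q i (j ℕ.* suc k))) (≈-trans (solve 3 (λ p q r → p :* (q :* r) := (q :* p) :* r) ≈-refl (P ^ i) (Q ^ i) (Q ^ (j ℕ.* suc k)))
      (≈-trans (*-congʳ (≈-trans (inverse-power QP i) (≈-sym (inverse-power QP j)))) (≈-trans (solve 3 (λ q p r → (q :* p) :* r := p :* (q :* r)) ≈-refl (Q ^ j) (P ^ j) (Q ^ (j ℕ.* suc k)))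
      (≈-trans (*-congˡ (period-+ Q^m j)) (*-identityʳ _)))))

    slope₄ : ∀ {P Q} → Q * P ≈ 1# → ∀ i j → P ^ i * Q ^ (i ℕ.+ j ℕ.* 1) ≈ Q ^ j
    slope₄ {P} {Q} QP i j = ≈-trans (*-congˡ (≈-trans (reflexive (≡.cong (λ l → Q ^ (i ℕ.+ l)) (ℕ.*-identityʳ j))) (^-homo-* Q i j)))
      (≈-trans (solve 3 (λ p q r → p :* (q :* r) := (q :* p) :* r) ≈-refl (P ^ i) (Q ^ i) (Q ^ j)) (≈-trans (*-congʳ (inverse-power QP i)) (*-identityˡ _)))

    odd-k : odd (suc k) ≡ true
    odd-k = ≡.cong not even

    private
      module Parα = Parity primitive-α even
      module Parβ = Parity primitive-α⁻¹ even
      a = scale₀ α α⁻¹ α⁻¹α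
      b = scaleₙ α α⁻¹ α⁻¹α
      a⁻¹ = scale₀ α⁻¹ α αα⁻¹
      b⁻¹ = scaleₙ α⁻¹ α αα⁻¹

      SweepBy : (Bool → K → Set ℓ) → C → C → Set _
      SweepBy Par x y = Sweep F G _≟_ S m (cut k) Par (λ i j s → pow x i (pow y j (u s)))

      -- The torus may be swept in four ways: by rows or by columns, forwards or backwards.
      sweep₁ : SweepBy Parα.Par a b
      sweep₁ = BorelWalk.sweep primitive-α even G _≟_ S step₀ stepₙ
        (scales-commute α⁻¹α α⁻¹α) (period₀ α⁻¹α Pα.A^m) (periodₙ α⁻¹α Pα.A^m) u u-cong u-step u-zero (suc k) odd-k
        (λ i j s t → node-law α⁻¹α α⁻¹α i j s t (α ^ (i ℕ.+ j ℕ.* suc k)) (slope₁ Pα.A^m i j))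

      sweep₂ : SweepBy Parα.Par a b⁻¹
      sweep₂ = BorelWalk.sweep primitive-α even G _≟_ S step₀ (stepₙ⁻¹ α⁻¹α αα⁻¹ stepₙ)
        (scales-commute α⁻¹α αα⁻¹) (period₀ α⁻¹α Pα.A^m) (periodₙ αα⁻¹ Pβ.A^m) u u-cong u-step u-zero 1 refl
        (λ i j s t → node-law α⁻¹α αα⁻¹ i j s t (α ^ (i ℕ.+ j ℕ.* 1)) (slope₂ α⁻¹α i j))

      sweep₃ : SweepBy Parβ.Par b a
      sweep₃ = BorelWalk.sweep primitive-α⁻¹ even G _≟_ S stepₙ step₀
        (≋-sym (scales-commute α⁻¹α α⁻¹α)) (periodₙ α⁻¹α Pα.A^m) (period₀ α⁻¹α Pα.A^m) u u-cong u-step u-zero (suc k) odd-k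
        (λ i j s t → node-law′ α⁻¹α α⁻¹α j i s t (α⁻¹ ^ (i ℕ.+ j ℕ.* suc k)) (slope₃ α⁻¹α Pβ.A^m i j))

      sweep₄ : SweepBy Parβ.Par b a⁻¹
      sweep₄ = BorelWalk.sweep primitive-α⁻¹ even G _≟_ S stepₙ (step₀⁻¹ α⁻¹α αα⁻¹ step₀)
        (≋-sym (scales-commute αα⁻¹ α⁻¹α)) (periodₙ α⁻¹α Pα.A^m) (period₀ αα⁻¹ Pβ.A^m) u u-cong u-step u-zero 1 refl
        (λ i j s t → node-law′ αα⁻¹ α⁻¹α j i s t (α⁻¹ ^ (i ℕ.+ j ℕ.* 1)) (slope₄ α⁻¹α i j))

      module E₁ = Sweep sweep₁
      module E₂ = Sweep sweep₂
      module E₃ = Sweep sweep₃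
      module E₄ = Sweep sweep₄

    module _ {p} (H : Subgroup p)
      (to-shape : ∀ {X} → Subgroup.P H X → ∃[ e ] ∃[ r ] ∃[ d ] Shape X e r d × ¬ e ≈ 0# × ¬ d ≈ 0#)
      (from-shape : ∀ {X e r d} → Shape X e r d → ¬ e ≈ 0# → ¬ d ≈ 0# → Subgroup.P H X) where

      open Subgroup H

      private
        power≉0 : ∀ {A A′} → Primitive F m A A′ → ∀ i → ¬ A ^ i ≈ 0#
        power≉0 pr i = inverse≉0 (inverse-power (Primitive.A′A pr) i)

        from-entries : ∀ {A A′ B B′} (pA : Primitive F m A A′) (pB : Primitive F m B B′) {i j s X} →
          Entries (Primitive.A′A pA) (Primitive.A′A pB) i j s X → P X
        from-entries pA pB {i} {j} (_ , _ , _ , ep , _ , ed , h) = from-shape h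
          (λ e → power≉0 pA i (≈-trans (≈-sym ep) e)) (λ e → power≉0 pB j (≈-trans (≈-sym ed) e))

        module C₁ = Coordinates primitive-α primitive-α
        module C₂ = Coordinates primitive-α primitive-α⁻¹
        module C₄ = Coordinates primitive-α⁻¹ primitive-α

        sound₁ : ∀ {v} → v ∈V E₁.all → P v
        sound₁ v∈ = let (i , j , s , _ , _ , e) = E₁.all-sound v∈ in
          resp (≋-sym e) (from-entries primitive-α primitive-α {i} {j} {s} (entries α⁻¹α α⁻¹α i j s))

        sound₂ : ∀ {v} → v ∈V E₂.all → P v
        sound₂ v∈ = let (i , j , s , _ , _ , e) = E₂.all-sound v∈ in
          resp (≋-sym e) (from-entries primitive-α primitive-α⁻¹ {i} {j} {s} (entries α⁻¹α αα⁻¹ i j s))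

        sound₃ : ∀ {v} → v ∈V E₃.all → P v
        sound₃ v∈ = let (j , i , s , _ , _ , e) = E₃.all-sound v∈ in
          resp (≋-sym e) (from-entries primitive-α primitive-α {i} {j} {s} (entries′ α⁻¹α α⁻¹α i j s))

        sound₄ : ∀ {v} → v ∈V E₄.all → P v
        sound₄ v∈ = let (j , i , s , _ , _ , e) = E₄.all-sound v∈ in
          resp (≋-sym e) (from-entries primitive-α⁻¹ primitive-α {i} {j} {s} (entries′ αα⁻¹ α⁻¹α i j s))

        complete₁ : ∀ {v} → P v → v ∈V E₁.all
        complete₁ Pv = let (_ , _ , _ , h , p≉0 , d≉0) = to-shape Pv ; (i , j , s , i<m , j<m , _ , _ , _ , en) = C₁.coordinates h p≉0 d≉0 in
          E₁.all-complete (i , j , s , i<m , j<m , entries-≋ α⁻¹α α⁻¹α {i} {j} {s} en (entries α⁻¹α α⁻¹α i j s))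

        complete₂ : ∀ {v} → P v → v ∈V E₂.all
        complete₂ Pv = let (_ , _ , _ , h , p≉0 , d≉0) = to-shape Pv ; (i , j , s , i<m , j<m , _ , _ , _ , en) = C₂.coordinates h p≉0 d≉0 in
          E₂.all-complete (i , j , s , i<m , j<m , entries-≋ α⁻¹α αα⁻¹ {i} {j} {s} en (entries α⁻¹α αα⁻¹ i j s))

        complete₃ : ∀ {v} → P v → v ∈V E₃.all
        complete₃ Pv = let (_ , _ , _ , h , p≉0 , d≉0) = to-shape Pv ; (i , j , s , i<m , j<m , _ , _ , _ , en) = C₁.coordinates h p≉0 d≉0 in
          E₃.all-complete (j , i , s , j<m , i<m , entries-≋ α⁻¹α α⁻¹α {i} {j} {s} en (entries′ α⁻¹α α⁻¹α i j s))

        complete₄ : ∀ {v} → P v → v ∈V E₄.all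
        complete₄ Pv = let (_ , _ , _ , h , p≉0 , d≉0) = to-shape Pv ; (i , j , s , i<m , j<m , _ , _ , _ , en) = C₄.coordinates h p≉0 d≉0 in
          E₄.all-complete (j , i , s , j<m , i<m , entries-≋ αα⁻¹ α⁻¹α {i} {j} {s} en (entries′ αα⁻¹ α⁻¹α i j s))

        unique₁ : Unique E₁.all
        unique₁ = E₁.all-unique λ {i} {j} {s} {i′} {j′} {t} → C₁.injective {i} {j} {s} {i′} {j′} {t}

        convert : ∀ {l x y} → Unique l → (∀ {v} → v ∈V l → P v) → (∀ {v} → P v → v ∈V l) → Path l x y → Path E₁.all x y
        convert ul sound complete = path-↭ (unique-↭ ul unique₁ (λ v∈ → complete₁ (sound v∈)) (λ v∈ → complete (sound₁ v∈)))

        -- The remaining case, i + j odd and s odd, is settled by inversion: a path from ε to g⁻¹,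
        -- translated by g and reversed, runs from ε to g.
        generic : ∀ i j s {g} → P g → g ≋ pow a i (pow b j (u s)) → ¬ s ≈ 0# → Path E₁.all ε g
        generic i j s {g} Pg g≋ s≉0 = by (odd (i ℕ.+ j)) refl
          where
          open Parα using (Par; par-cases)
          by : ∀ b → odd (i ℕ.+ j) ≡ b → Path E₁.all ε g
          by false o = path-resp ≋-refl (≋-sym g≋) (E₁.walk-even i j s s≉0 o)
          by true  o = [ turn , (λ ps → path-resp ≋-refl (≋-sym g≋) (E₁.walk-odd i j s ps o)) ]′ (par-cases s s≉0)
            where
            turn : Par true s → Path E₁.all ε g
            turn ps = let (z , e , w) = E₁.walk-odd⁻¹ i j s ps o
                          gz = ≋-trans (∙-congʳ′ g≋) e in
              path-reverse (path-↭ (translate H E₁.all unique₁ sound₁ complete₁ g Pg)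
                (path-resp (identityˡ g) (≋-trans (∙-congʳ′ (inverseʳ-unique g z gz)) (Group.inverseˡ G g)) (path-∙ʳ g w)))

        small : ∀ {x j j′} → j < cut k → j′ < cut k → x ≈ α ^ j → x ≈ α⁻¹ ^ j′ → x ≈ 1#
        small {x} {j} {j′} j< j′< e e′ = ≈-trans e (reflexive (≡.cong (α ^_) j≡0))
          where
          cyclic : α ^ (j′ ℕ.+ j) ≈ 1#
          cyclic = ≈-trans (^-homo-* α j′ j) (≈-trans (*-congˡ (≈-trans (≈-sym e) e′)) (≈-trans (*-comm _ _) (inverse-power α⁻¹α j′)))
          bound : ∀ k {i j} → i < cut k → j < cut k → i ℕ.+ j < suc (suc k)
          bound zero    (s<s z≤n) (s<s z≤n) = z<s
          bound (suc k) (s<s i≤1) (s<s j≤1) = s<s (ℕ.≤-trans (ℕ.+-mono-≤ i≤1 j≤1) (s≤s (s≤s z≤n)))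
          zero? : ∀ l → l < m → α ^ l ≈ 1# → l ≡ 0
          zero? zero    _   _ = refl
          zero? (suc l) l<m e = ⊥-elim (Pα.order (suc l) z<s l<m e)
          j≡0 : j ≡ 0
          j≡0 = ℕ.m+n≡0⇒n≡0 j′ (zero? (j′ ℕ.+ j) (bound k j′< j<) cyclic)

        -- A diagonal element other than ε lies outside the lower part in at least one of the four
        -- sweeps. Otherwise each of its two entries would be both α^j and α^(-j′) with j, j′ below
        -- `cut k`; then α^(j + j′) = 1 with j + j′ < m, so j = j′ = 0 and the entry is 1.
        diagonal : ∀ {g e r d} → P g → Shape g e r d → r ≈ 0# → ¬ ε ≋ g →
          C₁.Located g e r d → C₂.Located g e r d → C₄.Located g e r d → Path E₁.all ε g
        diagonal {g} {e} {r} {d} Pg h r≈0 ε≉g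
          (i₁ , j₁ , s₁ , i₁<m , j₁<m , e₁ , d₁ , σ₁ , en₁) (i₂ , j₂ , s₂ , i₂<m , j₂<m , e₂ , d₂ , σ₂ , en₂) (i₄ , j₄ , s₄ , i₄<m , j₄<m , e₄ , d₄ , σ₄ , en₄)
          = by (cut k ℕ.≤? j₁) (cut k ℕ.≤? j₂) (cut k ℕ.≤? i₁) (cut k ℕ.≤? i₄)
          where
          vanish : ∀ {s x} → s ≈ x * r → s ≈ 0#
          vanish e = ≈-trans e (≈-trans (*-congˡ r≈0) (zeroʳ _))
          by : Dec (cut k ≤ j₁) → Dec (cut k ≤ j₂) → Dec (cut k ≤ i₁) → Dec (cut k ≤ i₄) → Path E₁.all ε g
          by (yes le) _ _ _ = path-resp ≋-refl (entries-≋ α⁻¹α α⁻¹α {i₁} {j₁} {s₁} (entries α⁻¹α α⁻¹α i₁ j₁ s₁) en₁)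
            (E₁.return-path i₁ j₁ s₁ (vanish σ₁) le j₁<m)
          by (no _) (yes le) _ _ = convert (E₂.all-unique λ {i} {j} {s} {i′} {j′} {t} → C₂.injective {i} {j} {s} {i′} {j′} {t}) sound₂ complete₂
            (path-resp ≋-refl (entries-≋ α⁻¹α αα⁻¹ {i₂} {j₂} {s₂} (entries α⁻¹α αα⁻¹ i₂ j₂ s₂) en₂)
              (E₂.return-path i₂ j₂ s₂ (vanish σ₂) le j₂<m))
          by (no _) (no _) (yes le) _ = convert (E₃.all-unique λ {i} {j} {s} {i′} {j′} {t} → C₁.injective′ {i} {j} {s} {i′} {j′} {t}) sound₃ complete₃
            (path-resp ≋-refl (entries-≋ α⁻¹α α⁻¹α {i₁} {j₁} {s₁} (entries′ α⁻¹α α⁻¹α i₁ j₁ s₁) en₁)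
              (E₃.return-path j₁ i₁ s₁ (vanish σ₁) le i₁<m))
          by (no _) (no _) (no _) (yes le) = convert (E₄.all-unique λ {i} {j} {s} {i′} {j′} {t} → C₄.injective′ {i} {j} {s} {i′} {j′} {t}) sound₄ complete₄
            (path-resp ≋-refl (entries-≋ αα⁻¹ α⁻¹α {i₄} {j₄} {s₄} (entries′ αα⁻¹ α⁻¹α i₄ j₄ s₄) en₄)
              (E₄.return-path j₄ i₄ s₄ (vanish σ₄) le i₄<m))
          by (no n₁) (no n₂) (no n₃) (no n₄) = ⊥-elim (ε≉g (shape-≋ shape-ε h
            (≈-sym (small (ℕ.≰⇒> n₃) (ℕ.≰⇒> n₄) e₁ e₄)) (≈-sym r≈0) (≈-sym (small (ℕ.≰⇒> n₁) (ℕ.≰⇒> n₂) d₁ d₂))))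

        reach : ∀ g → P g → ¬ ε ≋ g → Path E₁.all ε g
        reach g Pg ε≉g = let (_ , _ , _ , h , e≉0 , d≉0) = to-shape Pg in by h e≉0 d≉0 (C₁.coordinates h e≉0 d≉0)
          where
          by : ∀ {e r d} → Shape g e r d → ¬ e ≈ 0# → ¬ d ≈ 0# → C₁.Located g e r d → Path E₁.all ε g
          by {r = r} h e≉0 d≉0 c@(i , j , s , _ , _ , _ , _ , σ , en) =
            [ (λ s≈0 → diagonal Pg h (r≈0 s≈0) ε≉g c (C₂.coordinates h e≉0 d≉0) (C₄.coordinates h e≉0 d≉0)) ,
              generic i j s Pg (entries-≋ α⁻¹α α⁻¹α {i} {j} {s} en (entries α⁻¹α α⁻¹α i j s)) ]′ (toSum (s ≟F 0#))
            where
            r≈0 : s ≈ 0# → r ≈ 0#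
            r≈0 s≈0 = ≈-trans (≈-sym (*-identityˡ r)) (≈-trans (*-congʳ (≈-sym (≈-trans (*-comm _ _) (inverse-power α⁻¹α j))))
              (≈-trans (*-assoc _ _ _) (≈-trans (*-congˡ (≈-trans (≈-sym σ) s≈0)) (zeroʳ _))))

      evenPaths : HamConn P
      evenPaths = fromIdentity H E₁.all unique₁ sound₁ complete₁ reach

  module OddOrder (odd-m : odd m ≡ true) (S₀ : S (scale₀ α α⁻¹ α⁻¹α)) (Sₙ : S (scaleₙ α α⁻¹ α⁻¹α))
    {p} (H : Subgroup p)
    (to-shape : ∀ {X} → Subgroup.P H X → ∃[ e ] ∃[ d ] Shape X e 0# d × ¬ e ≈ 0# × ¬ d ≈ 0#)
    (from-shape : ∀ {X e r d} → Shape X e r d → r ≈ 0# → ¬ e ≈ 0# → ¬ d ≈ 0# → Subgroup.P H X) where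

    open Subgroup H

    private
      module Pα = Primitive primitive-α
      a = scale₀ α α⁻¹ α⁻¹α
      b = scaleₙ α α⁻¹ α⁻¹α
      a^m = period₀ α⁻¹α Pα.A^m
      step₀ : Steps a
      step₀ = step-gen S₀
      stepₙ : Steps b
      stepₙ = step-gen Sₙ
    open Coordinates primitive-α primitive-α
    open Cylinder step₀ stepₙ (scales-commute α⁻¹α α⁻¹α) k a^m using (rows)
    open CylinderPaths step₀ stepₙ (scales-commute α⁻¹α α⁻¹α) k a^m using (cylinder)
    open CylinderLists step₀ stepₙ (scales-commute α⁻¹α α⁻¹α) k a^m

    private
      node : ∀ i j → pow a i (pow b j (u 0#)) ≋ pow a i (pow b j ε)
      node i j = pow-cong a i (pow-cong b j u-zero)

      locate : ∀ {v} → P v → ∃[ i ] ∃[ j ] i < m × j < m × v ≋ pow a i (pow b j ε)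
      locate Pv = let (_ , _ , h , e≉0 , d≉0) = to-shape Pv ; (i , j , s , i<m , j<m , _ , _ , σ , en) = coordinates h e≉0 d≉0 in
        i , j , i<m , j<m , ≋-trans (entries-≋ α⁻¹α α⁻¹α {i} {j} {s} en (entries α⁻¹α α⁻¹α i j s))
          (≋-trans (pow-cong a i (pow-cong b j (u-cong (≈-trans σ (zeroʳ _))))) (node i j))

      unique : Unique (rows m ε)
      unique = rows-unique m ε λ {i} {r} {i′} {r′} i<m r<m i′<m r′<m p →
        let (p₁ , p₂ , _) = injective i<m r<m i′<m r′<m (≋-trans (node i r) (≋-trans p (≋-sym (node i′ r′)))) in p₁ , p₂

      sound : ∀ {v} → v ∈V rows m ε → P v
      sound v∈ = let (i , j , _ , _ , e) = ∈rows⁻ m ε v∈ ; (_ , _ , _ , ep , er , ed , h) = entries α⁻¹α α⁻¹α i j 0# in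
        resp (≋-sym (≋-trans e (≋-sym (node i j)))) (from-shape h (≈-trans er (zeroʳ _))
          (λ p≈0 → α^≉0 i (≈-trans (≈-sym ep) p≈0)) (λ d≈0 → α^≉0 j (≈-trans (≈-sym ed) d≈0)))

      complete : ∀ {v} → P v → v ∈V rows m ε
      complete Pv = let (i , j , i<m , j<m , e) = locate Pv in ∈rows⁺ i j ε i<m j<m e

      reach : ∀ g → P g → ¬ ε ≋ g → Path (rows m ε) ε g
      reach g Pg ε≉g = let (i , j , i<m , j<m , e) = locate Pg in
        path-resp ≋-refl (≋-sym e) (cylinder k j i j<m i<m (inj₂ (odd-m , positive i j e)) ε)
        where
        positive : ∀ i j → g ≋ pow a i (pow b j ε) → 0 < i ℕ.+ j
        positive zero    zero    e = ⊥-elim (ε≉g (≋-sym e))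
        positive zero    (suc j) e = z<s
        positive (suc i) j       e = z<s

    -- For odd m every nonzero displacement is admissible for `cylinder`, so the torus is Hamilton
    -- connected by itself.
    oddPaths : HamConn P
    oddPaths = fromIdentity H (rows m ε) unique sound complete reach

-- The case n = 2

module Plane {c ℓ q} (F : FiniteField c ℓ q) (n : ℕ) {i₀ N : Fin n} (i₀≢N : i₀ ≢ N) where

  open FiniteField F hiding (zero) renaming (refl to ≈-refl; sym to ≈-sym; trans to ≈-trans; Carrier to K; invertible to inv-exists)
  open SemiringSum semiring using (sum)
  open Solver commutativeRing
  open Matrices F
  open GLₙ n
  open Updates F n
  open Group group using (_∙_; ε) renaming (_≈_ to _≋_)

  -- Matrices that only differ from the identity in rows i₀ and N, where they are
  -- p e₀ and r e₀ + d e_N.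
  record Shape (Z : GL F n) (p r d : K) : Set ℓ where
    constructor shape
    field
      first  : ∀ l → entry Z i₀ l ≈ p * δ i₀ l
      second : ∀ l → entry Z N l ≈ r * δ i₀ l + d * δ N l
      others : ∀ k l → i₀ ≢ k → N ≢ k → entry Z k l ≈ δ k l

  open Shape

  shape-≋ : ∀ {Z Z′ p r d p′ r′ d′} → Shape Z p r d → Shape Z′ p′ r′ d′ → p ≈ p′ → r ≈ r′ → d ≈ d′ → Z ≋ Z′
  shape-≋ {Z} {Z′} h h′ p≈ r≈ d≈ k l = by (i₀ Fin.≟ k) (N Fin.≟ k)
    where
    by : Dec (i₀ ≡ k) → Dec (N ≡ k) → entry Z k l ≈ entry Z′ k l
    by (yes refl) _          = ≈-trans (first h l) (≈-trans (*-congʳ p≈) (≈-sym (first h′ l)))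
    by (no _)     (yes refl) = ≈-trans (second h l) (≈-trans (+-cong (*-congʳ r≈) (*-congʳ d≈)) (≈-sym (second h′ l)))
    by (no i₀≢k)  (no N≢k)   = ≈-trans (others h k l i₀≢k N≢k) (≈-sym (others h′ k l i₀≢k N≢k))

  private
    u-unit : ∀ s → 1# * (1# + sum (λ k → s * δ i₀ k * δ N k)) ≈ 1#
    u-unit s = ≈-trans (*-identityˡ _) (≈-trans (+-congˡ (≈-trans (SemiringSum.sum-cong-≋ semiring λ k → *-assoc s (δ i₀ k) (δ N k))
      (≈-trans (≈-sym (SemiringSum.*-distribˡ-sum semiring s (λ k → δ i₀ k * δ N k)))
      (≈-trans (*-congˡ (≈-trans (sum-δˡ i₀ (δ N)) (δ-diff (i₀≢N ∘ ≡.sym)))) (zeroʳ s))))) (+-identityʳ 1#))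

  u : K → GL F n
  u s = rank1 (δ N) (λ k → s * δ i₀ k) 1# (u-unit s)

  u-∙ : ∀ s X k l → entry (u s ∙ X) k l ≈ entry X k l + δ N k * (s * entry X i₀ l)
  u-∙ s X k l = ≈-trans (rank1-· (δ N) (λ k → s * δ i₀ k) 1# (u-unit s) X k l) (+-congˡ (*-congˡ
    (≈-trans (SemiringSum.sum-cong-≋ semiring λ k → *-assoc s (δ i₀ k) (entry X k l))
    (≈-trans (≈-sym (SemiringSum.*-distribˡ-sum semiring s (λ k → δ i₀ k * entry X k l))) (*-congˡ (sum-δˡ i₀ (λ k → entry X k l)))))))

  shape-ε : Shape ε 1# 0# 1#
  shape-ε = shape (λ l → ≈-sym (*-identityˡ _)) (λ l → solve 2 (λ x y → y := :0 :* x :+ :1 :* y) ≈-refl (δ i₀ l) (δ N l)) (λ k l _ _ → ≈-refl)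

  shape-u∙ : ∀ s {Z p r d} → Shape Z p r d → Shape (u s ∙ Z) p (s * p + r) d
  shape-u∙ s {Z} {p} {r} {d} h = shape
    (λ l → ≈-trans (u-∙ s Z i₀ l) (≈-trans (+-congˡ (≈-trans (*-congʳ (δ-diff (i₀≢N ∘ ≡.sym))) (zeroˡ _))) (≈-trans (+-identityʳ _) (first h l))))
    (λ l → ≈-trans (u-∙ s Z N l) (≈-trans (+-cong (second h l) (*-cong (δ-same N) (*-congˡ (first h l))))
      (solve 6 (λ r x d y s p → r :* x :+ d :* y :+ :1 :* (s :* (p :* x)) := (s :* p :+ r) :* x :+ d :* y) ≈-refl r (δ i₀ l) d (δ N l) s p)))
    (λ k l i₀≢k N≢k → ≈-trans (u-∙ s Z k l) (≈-trans (+-congˡ (≈-trans (*-congʳ (δ-diff N≢k)) (zeroˡ _))) (≈-trans (+-identityʳ _) (others h k l i₀≢k N≢k))))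

  shape-resp : ∀ {Z Z′ p r d} → Z ≋ Z′ → Shape Z p r d → Shape Z′ p r d
  shape-resp Z≋Z′ h = shape (λ l → ≈-trans (≈-sym (Z≋Z′ i₀ l)) (first h l)) (λ l → ≈-trans (≈-sym (Z≋Z′ N l)) (second h l))
    (λ k l a b → ≈-trans (≈-sym (Z≋Z′ k l)) (others h k l a b))

  module _ {A A′ : K} (A′A : A′ * A ≈ 1#) where

    scale₀ scaleₙ : GL F n
    scale₀ = scale i₀ A A′ A′A
    scaleₙ = scale N A A′ A′A

    shape-scale₀ : ∀ {Z p r d} → Shape Z p r d → Shape (scale₀ ∙ Z) (A * p) r d
    shape-scale₀ {Z} h = shape
      (λ l → ≈-trans (scale-target A′A Z l) (≈-trans (*-congˡ (first h l)) (≈-sym (*-assoc _ _ _))))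
      (λ l → ≈-trans (scale-other A′A Z l i₀≢N) (second h l))
      (λ k l i₀≢k N≢k → ≈-trans (scale-other A′A Z l i₀≢k) (others h k l i₀≢k N≢k))

    shape-scaleₙ : ∀ {Z p r d} → Shape Z p r d → Shape (scaleₙ ∙ Z) p (A * r) (A * d)
    shape-scaleₙ {Z} {p} {r} {d} h = shape
      (λ l → ≈-trans (scale-other A′A Z l (i₀≢N ∘ ≡.sym)) (first h l))
      (λ l → ≈-trans (scale-target A′A Z l) (≈-trans (*-congˡ (second h l))
        (solve 5 (λ a r x d y → a :* (r :* x :+ d :* y) := a :* r :* x :+ a :* d :* y) ≈-refl A r (δ i₀ l) d (δ N l))))
      (λ k l i₀≢k N≢k → ≈-trans (scale-other A′A Z l N≢k) (others h k l i₀≢k N≢k))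

  shape-first : ∀ {Z p r d} → Shape Z p r d → entry Z i₀ i₀ ≈ p
  shape-first h = ≈-trans (first h i₀) (≈-trans (*-congˡ (δ-same i₀)) (*-identityʳ _))

  shape-corner : ∀ {Z p r d} → Shape Z p r d → entry Z N N ≈ d
  shape-corner {d = d} h = ≈-trans (second h N) (≈-trans (+-cong (≈-trans (*-congˡ (δ-diff i₀≢N)) (zeroʳ _)) (*-congˡ (δ-same N)))
    (solve 1 (λ d → :0 :+ d :* :1 := d) ≈-refl d))

  shape-lower : ∀ {Z p r d} → Shape Z p r d → entry Z N i₀ ≈ r
  shape-lower {r = r} h = ≈-trans (second h i₀) (≈-trans (+-cong (*-congˡ (δ-same i₀)) (≈-trans (*-congˡ (δ-diff (i₀≢N ∘ ≡.sym))) (zeroʳ _)))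
    (solve 1 (λ r → r :* :1 :+ :0 := r) ≈-refl r))

  u-one : addRow i₀ N i₀≢N ≋ u 1#
  u-one k l = ≈-trans (addRow-entries i₀ N i₀≢N k l) (≈-trans (+-congˡ (*-congˡ (≈-sym (*-identityˡ _))))
    (≈-sym (reflexive (rank1-entry (δ N) (λ k → 1# * δ i₀ k) 1# (u-unit 1#) k l))))

  scale₀-shape : ∀ {A A′} (A′A : A′ * A ≈ 1#) → Shape (scale i₀ A A′ A′A) (A * 1#) 0# 1#
  scale₀-shape {A} {A′} A′A = shape-resp {scale i₀ A A′ A′A ∙ ε} {scale i₀ A A′ A′A} (Group.identityʳ group (scale i₀ A A′ A′A)) (shape-scale₀ A′A {ε} shape-ε)

  triangular : Triangular F group ℓ
  triangular = record
    { Shape         = Shape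
    ; shape-resp    = λ {X} {Y} → shape-resp {X} {Y}
    ; shape-≋       = λ {X} {Y} → shape-≋ {X} {Y}
    ; shape-entries = λ {X} {Y} h h′ X≋Y →
        ≈-trans (≈-sym (shape-first h)) (≈-trans (X≋Y i₀ i₀) (shape-first h′)) ,
        ≈-trans (≈-sym (shape-lower h)) (≈-trans (X≋Y N i₀) (shape-lower h′)) ,
        ≈-trans (≈-sym (shape-corner h)) (≈-trans (X≋Y N N) (shape-corner h′))
    ; shape-ε       = shape-ε
    ; scale₀        = scale i₀
    ; scaleₙ        = scale N
    ; shape-scale₀  = λ A′A {X} → shape-scale₀ A′A {X}
    ; shape-scaleₙ  = λ A′A {X} → shape-scaleₙ A′A {X}
    ; u             = u
    ; shape-u∙      = λ s {X} → shape-u∙ s {X}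
    }

-- The case n = 2; n is kept generic so that sums over Fin n do not unfold.
module PlaneConnected {c ℓ q} (F : FiniteField c ℓ q) (α : FiniteField.Carrier F) (generates : IsGenerator F α)
  (n : ℕ) {i₀ N : Fin n} (i₀≢N : i₀ ≢ N) (cover : ∀ k → i₀ ≢ k → N ≢ k → ⊥) {s} (S : Pred (GL F n) s)
  (k : ℕ) (m≡ : Order.m F α generates ≡ suc (suc k)) where

  open FiniteField F hiding (zero) renaming (refl to ≈-refl; sym to ≈-sym; trans to ≈-trans; Carrier to K; invertible to inv-exists)
  open Solver commutativeRing
  open Matrices F
  open Order F α generates hiding (m)
  open GLₙ n
  open Updates F n
  open Plane F n i₀≢N
  open Levels F n S N
  open Group group using (_∙_; ε; _⁻¹; inverseʳ; assoc) renaming (_≈_ to _≋_)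
  open Cayley group _≟_ S hiding (iterate)
  open TriangularPaths F α generates k m≡ group _≟_ S triangular using (primitive-α; αα⁻¹; m)
  private
    module L₀ = Levels F n S i₀
    module TP = TriangularPaths F α generates k m≡ group _≟_ S triangular

    by-cover : ∀ {p} {P : Fin n → Set p} → P i₀ → P N → ∀ l → P l
    by-cover {P = P} p₀ pN l = go (i₀ Fin.≟ l) (N Fin.≟ l)
      where
      go : Dec (i₀ ≡ l) → Dec (N ≡ l) → P l
      go (yes refl) _          = p₀
      go (no _)     (yes refl) = pN
      go (no i₀≢l)  (no N≢l)   = ⊥-elim (cover l i₀≢l N≢l)

    first≉0 : ∀ X → Stab X → ¬ entry X i₀ i₀ ≈ 0#
    first≉0 X PX = inverse≉0 (≈-trans (*-comm _ _) (≈-trans (≈-sym (L₀.row-∙ {X} (X ⁻¹) zero-row i₀)) (≈-trans (inverseʳ X i₀ i₀) (δ-same i₀))))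
      where
      zero-row : ∀ l → l ≢ i₀ → entry X i₀ l ≈ 0#
      zero-row = by-cover (λ ne → ⊥-elim (ne refl)) (λ _ → PX i₀ i₀≢N)

    corner≉0 : ∀ X → Stab X → ¬ entry X N N ≈ 0#
    corner≉0 X PX = inverse≉0 (corner {X} PX)

    stab-shape : ∀ X → Stab X → ∀ r → entry X N i₀ ≈ r → Shape X (entry X i₀ i₀) r (entry X N N)
    stab-shape X PX r Xr = shape
      (by-cover (≈-sym (≈-trans (*-congˡ (δ-same i₀)) (*-identityʳ _))) (≈-trans (PX i₀ i₀≢N) (≈-sym (≈-trans (*-congˡ (δ-diff i₀≢N)) (zeroʳ _)))))
      (by-cover (≈-trans Xr (≈-sym (≈-trans (+-cong (≈-trans (*-congˡ (δ-same i₀)) (*-identityʳ _)) (≈-trans (*-congˡ (δ-diff (i₀≢N ∘ ≡.sym))) (zeroʳ _))) (+-identityʳ r))))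
        (≈-sym (≈-trans (+-cong (≈-trans (*-congˡ (δ-diff i₀≢N)) (zeroʳ _)) (≈-trans (*-congˡ (δ-same N)) (*-identityʳ _))) (+-identityˡ _))))
      (λ l _ i₀≢l N≢l → ⊥-elim (cover l i₀≢l N≢l))

    shape-stab : ∀ {X p r d} → Shape X p r d → Stab X
    shape-stab h = by-cover (λ _ → ≈-trans (Shape.first h N) (≈-trans (*-congˡ (δ-diff i₀≢N)) (zeroʳ _))) (λ ne → ⊥-elim (ne refl))

    to-stab : ∀ {X} → Stab X → ∃[ e ] ∃[ r ] ∃[ d ] Shape X e r d × ¬ e ≈ 0# × ¬ d ≈ 0#
    to-stab {X} PX = _ , _ , _ , stab-shape X PX _ ≈-refl , first≉0 X PX , corner≉0 X PX

    to-levi : ∀ {X} → Levi X → ∃[ e ] ∃[ d ] Shape X e 0# d × ¬ e ≈ 0# × ¬ d ≈ 0#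
    to-levi {X} (PX , QX) = _ , _ , stab-shape X PX 0# (QX i₀ i₀≢N) , first≉0 X PX , corner≉0 X PX

    shape-levi : ∀ {X p r d} → Shape X p r d → r ≈ 0# → Levi X
    shape-levi h r≈0 = shape-stab h , by-cover (λ _ → ≈-trans (shape-lower h) r≈0) (λ ne → ⊥-elim (ne refl))

    α≉1 : ¬ α ≈ 1#
    α≉1 e = Primitive.order primitive-α 1 z<s (s<s z<s) (≈-trans (*-identityʳ α) e)

  module _ (St : S (addRow i₀ N i₀≢N)) (S₀ : S (scale i₀ α α⁻¹ α⁻¹α)) (Sₙ : S (scale N α α⁻¹ α⁻¹α)) where

    private
      -- A scalar matrix, as `i₀` and `N` are the only indices. It commutes with every `t` and
      -- therefore yields parallel edges between cosets.
      scalar : ∀ β β′ → β′ * β ≈ 1# → GL F n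
      scalar β β′ unit = scale i₀ β β′ unit ∙ scale N β β′ unit

      scalar-entry : ∀ β β′ unit X i j → entry (scalar β β′ unit ∙ X) i j ≈ β * entry X i j
      scalar-entry β β′ unit X i j = ≈-trans (assoc (scale i₀ β β′ unit) (scale N β β′ unit) X i j) (by-cover {P = λ i → entry (a ∙ (b ∙ X)) i j ≈ β * entry X i j}
        (≈-trans (scale-target unit (b ∙ X) j) (*-congˡ (scale-other unit X j (i₀≢N ∘ ≡.sym))))
        (≈-trans (scale-other unit (b ∙ X) j i₀≢N) (scale-target unit X j)) i)
        where
        a = scale i₀ β β′ unit
        b = scale N β β′ unit

      scalar-shape : ∀ β β′ unit → Shape (scalar β β′ unit) (β * 1#) (β * 0#) (β * 1#)
      scalar-shape β β′ unit = shape-scale₀ unit {scale N β β′ unit} (shape-resp {scale N β β′ unit ∙ ε} {scale N β β′ unit}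
        (Group.identityʳ group (scale N β β′ unit)) (shape-scaleₙ unit {ε} shape-ε))

      scalar-corner : ∀ β β′ unit → entry (scalar β β′ unit) N N ≈ β
      scalar-corner β β′ unit = ≈-trans (shape-corner (scalar-shape β β′ unit)) (*-identityʳ β)

      scalar-levi : ∀ β β′ unit → Levi (scalar β β′ unit)
      scalar-levi β β′ unit = shape-levi (scalar-shape β β′ unit) (zeroʳ β)

      scalar≉ε : ∀ β β′ unit → ¬ β ≈ 1# → ¬ ε ≋ scalar β β′ unit
      scalar≉ε β β′ unit β≉1 e = β≉1 (≈-trans (≈-sym (scalar-corner β β′ unit)) (≈-trans (≈-sym (e N N)) (δ-same N)))

      scalar-injective : ∀ {β β′ γ γ′} unit unit′ → scalar β β′ unit ≋ scalar γ γ′ unit′ → β ≈ γ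
      scalar-injective unit unit′ e = ≈-trans (≈-sym (scalar-corner _ _ unit)) (≈-trans (e N N) (scalar-corner _ _ unit′))

      even-stab : odd k ≡ false → HamConn Stab
      even-stab even = TP.EvenOrder.evenPaths even {addRow i₀ N i₀≢N} St u-one S₀ Sₙ stab (λ {X} → to-stab {X}) λ h _ _ → shape-stab h

      odd-stab : ∀ l → k ≡ suc l → odd m ≡ true → HamConn Stab
      odd-stab l k≡ odd-m = LeviToStab.leviToStab i₀≢N St (scale i₀ α α⁻¹ α⁻¹α) (scale-Levi i₀ α α⁻¹ α⁻¹α)
        (LeviToStab.spread-scale i₀≢N St α α⁻¹ α⁻¹α α≉1) v w (scalar-levi α α⁻¹ α⁻¹α) (scalar-levi α⁻¹ α αα⁻¹)
        (α , scalar-entry α α⁻¹ α⁻¹α T N , scalar-entry α α⁻¹ α⁻¹α T i₀) (α⁻¹ , scalar-entry α⁻¹ α αα⁻¹ T N , scalar-entry α⁻¹ α αα⁻¹ T i₀)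
        (scalar≉ε α α⁻¹ α⁻¹α α≉1) (scalar≉ε α⁻¹ α αα⁻¹ (λ e → α≉1 (≈-trans (≈-sym (*-identityˡ α)) (≈-trans (*-congʳ (≈-sym e)) α⁻¹α)))) v≉w
        (TP.OddOrder.oddPaths odd-m S₀ Sₙ levi (λ {X} → to-levi {X}) λ h r≈0 _ _ → shape-levi h r≈0)
        where
        open AddRow⁻¹ i₀≢N
        v w : GL F n
        v = scalar α α⁻¹ α⁻¹α
        w = scalar α⁻¹ α αα⁻¹
        v≉w : ¬ v ≋ w
        -- Equality would give α² = 1, but here the order k + 2 is at least 3.
        v≉w e = Primitive.order primitive-α 2 z<s (subst (λ k → 2 < suc (suc k)) (≡.sym k≡) (s<s (s<s z<s)))
          (≈-trans (*-congˡ (*-identityʳ α)) (≈-trans (*-congʳ (scalar-injective α⁻¹α αα⁻¹ e)) α⁻¹α))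

      planeStab : HamConn Stab
      planeStab = by k refl
        where
        by : ∀ l → k ≡ l → HamConn Stab
        by zero    e = even-stab (≡.cong odd e)
        by (suc l) e = parity (odd k) refl
          where
          parity : ∀ b → odd k ≡ b → HamConn Stab
          parity false p = even-stab p
          parity true  p = odd-stab l e (≡.trans (≡.cong (λ b → not (not b)) p) refl)

    planeTop : S (addRow N i₀ (i₀≢N ∘ ≡.sym)) → HamConn (Subgroup.P top)
    planeTop St′ = StabToTop.stabToTop (i₀≢N ∘ ≡.sym) St′ v w (proj₁ (scalar-levi α α⁻¹ α⁻¹α)) (shape-stab w-shape)
      (α , λ i → scalar-entry α α⁻¹ α⁻¹α T i N) (α , w-commutes) (scalar≉ε α α⁻¹ α⁻¹α α≉1)
      (λ e → α≉1 (≈-trans (≈-sym w-first) (≈-trans (≈-sym (e i₀ i₀)) (δ-same i₀))))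
      (λ e → α≉1 (≈-trans (≈-sym (scalar-corner α α⁻¹ α⁻¹α)) (≈-trans (e N N) (shape-corner w-shape)))) planeStab
      where
      open AddRow⁻¹ (i₀≢N ∘ ≡.sym)
      z : K
      -- For q = 3 there is only one scalar matrix besides the identity, so `w` has to be of another
      -- kind. This z makes row N of `w` equal to (1 - α) e₀ + e_N, whence `w` multiplies (-1, 1) by
      -- α.
      z = α⁻¹ - 1#
      a v w : GL F n
      a = scale i₀ α α⁻¹ α⁻¹α
      v = scalar α α⁻¹ α⁻¹α
      w = u z ∙ a
      w-shape : Shape w (α * 1#) (z * (α * 1#) + 0#) 1#
      w-shape = shape-u∙ z {a} (scale₀-shape α⁻¹α)
      w-first : entry w i₀ i₀ ≈ α
      w-first = ≈-trans (shape-first w-shape) (*-identityʳ α)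
      -- w has the same eigenvector (-1, 1) as t⁻¹ has last column.
      w-commutes : ∀ i → entry (w ∙ T) i N ≈ α * entry T i N
      w-commutes i = ≈-trans (assoc (u z) a T i N) (≈-trans (u-∙ z (a ∙ T) i N) (by-cover {P = λ i → entry (a ∙ T) i N + δ N i * (z * entry (a ∙ T) i₀ N) ≈ α * entry T i N}
        (≈-trans (+-cong (scale-target α⁻¹α T N) (≈-trans (*-congʳ (δ-diff (i₀≢N ∘ ≡.sym))) (zeroˡ _))) (+-identityʳ _))
        (≈-trans (+-cong (scale-other α⁻¹α T N i₀≢N) (*-cong (δ-same N) (*-congˡ (scale-target α⁻¹α T N))))
          (≈-trans (solve 4 (λ y b a x → y :+ :1 :* ((b :- :1) :* (a :* x)) := (y :+ b :* a :* x) :- a :* x) ≈-refl (entry T N N) α⁻¹ α (entry T i₀ N))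
          (≈-trans (+-congʳ (+-congˡ (*-congʳ α⁻¹α)))
          (≈-trans (solve 3 (λ y a x → (y :+ :1 :* x) :- a :* x := a :* y :+ (:1 :- a) :* (x :+ y)) ≈-refl (entry T N N) α (entry T i₀ N))
          (≈-trans (+-congˡ (≈-trans (*-congˡ (≈-trans (T-target N) (δ-diff i₀≢N))) (zeroʳ _))) (+-identityʳ _)))))) i))

-- Assembly: the induction on n and the graph of the statement

module ExactEnds {c ℓ r} (Γ : Graph c ℓ r) where

  open Graph Γ renaming (vertices to V)
  open Setoid V renaming (Carrier to C; refl to ≈-refl; sym to ≈-sym; trans to ≈-trans)
  open Walks Γ
  open Perm V using (_↭_; ↭-sym; ↭-trans)

  private
    finish : ∀ {z y l} → Walk z y l → ∀ {w} → Adj w z → ∃[ l′ ] last (w ∷ l′) ≡ just y × Linked Adj (w ∷ l′) × Pointwise _≈_ l l′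
    finish {y = y} (stop z≈u u≈y) a = y ∷ [] , refl , adj-resp ≈-refl (≈-trans z≈u u≈y) a ∷ [-] , u≈y ∷ []
    finish (step {u = u} z≈u b walk) a = let (l′ , end , linked , same) = finish walk b in
      u ∷ l′ , end , adj-resp ≈-refl z≈u a ∷ linked , ≈-refl ∷ same

  -- A `Walk` knows its ends only up to ≈, while a Hamilton path has to begin and end with the given
  -- elements themselves. The outer vertices are exchanged for them, which is possible at both ends
  -- because the walk has more than one vertex.
  exact : ∀ {l x y} → ¬ x ≈ y → Path l x y → ∃[ l′ ] head l′ ≡ just x × last l′ ≡ just y × Linked Adj l′ × l′ ↭ l
  exact x≉y (_ , stop x≈u u≈y , _) = ⊥-elim (x≉y (≈-trans x≈u u≈y))
  exact {x = x} _ (_ , step x≈u a walk , p↭l) = let (l′ , end , linked , same) = finish walk (adj-resp (≈-sym x≈u) ≈-refl a) in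
    x ∷ l′ , refl , end , linked , ↭-trans (↭-sym (Perm.refl (≈-sym x≈u ∷ same))) p↭l

module FieldSize {c ℓ q} (F : FiniteField c ℓ q) where

  open FiniteField F hiding (zero) renaming (refl to ≈-refl; sym to ≈-sym; trans to ≈-trans; Carrier to K; invertible to inv-exists)
  open Matrices F using (_≟F_)
  open Inverse cardinality using (to; from; to-cong; from-cong; strictlyInverseˡ; strictlyInverseʳ)

  private
    from-injective : ∀ {x y} → from x ≡ from y → x ≈ y
    from-injective {x} {y} e = ≈-trans (≈-sym (strictlyInverseˡ x)) (≈-trans (to-cong e) (strictlyInverseˡ y))

    to-injective : ∀ {i j} → to i ≈ to j → i ≡ j
    to-injective {i} {j} e = ≡.trans (≡.sym (strictlyInverseʳ i)) (≡.trans (from-cong e) (strictlyInverseʳ j))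

  units-trivial : q ≤ 2 → ∀ x → ¬ x ≈ 0# → x ≈ 1#
  units-trivial q≤2 x x≉0 = [ (λ e → e) , (λ x≉1 → ⊥-elim (ℕ.<⇒≱ (s<s (s<s z<s)) (ℕ.≤-trans (Fin.injective⇒≤ (λ {i} {j} → injective x≉1 i j)) q≤2))) ]′ (toSum (x ≟F 1#))
    where
    f : Fin 3 → K
    f 0F = 0#
    f 1F = 1#
    f 2F = x
    injective : ¬ x ≈ 1# → ∀ i j → from (f i) ≡ from (f j) → i ≡ j
    injective x≉1 0F 0F _ = refl
    injective x≉1 1F 1F _ = refl
    injective x≉1 2F 2F _ = refl
    injective x≉1 0F 1F e = ⊥-elim (1≉0 (≈-sym (from-injective e)))
    injective x≉1 1F 0F e = ⊥-elim (1≉0 (from-injective e))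
    injective x≉1 0F 2F e = ⊥-elim (x≉0 (≈-sym (from-injective e)))
    injective x≉1 2F 0F e = ⊥-elim (x≉0 (from-injective e))
    injective x≉1 1F 2F e = ⊥-elim (x≉1 (≈-sym (from-injective e)))
    injective x≉1 2F 1F e = ⊥-elim (x≉1 (from-injective e))

  trivial-units : (∀ x → ¬ x ≈ 0# → x ≈ 1#) → q ≤ 2
  trivial-units unit≈1 = Fin.injective⇒≤ (λ {i} {j} e → to-injective (same (to i) (to j) e))
    where
    class : ∀ {x} → Dec (x ≈ 0#) → Fin 2
    class (yes _) = 0F
    class (no _)  = 1F
    same : ∀ x y → class (x ≟F 0#) ≡ class (y ≟F 0#) → x ≈ y
    same x y = by (x ≟F 0#) (y ≟F 0#)
      where
      by : (d : Dec (x ≈ 0#)) (d′ : Dec (y ≈ 0#)) → class d ≡ class d′ → x ≈ y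
      by (yes x≈0) (yes y≈0) _ = ≈-trans x≈0 (≈-sym y≈0)
      by (no x≉0)  (no y≉0)  _ = ≈-trans (unit≈1 x x≉0) (≈-sym (unit≈1 y y≉0))

module Generators {c ℓ q} (F : FiniteField c ℓ q) (α : FiniteField.Carrier F) (generates : IsGenerator F α) where

  open FiniteField F hiding (zero) renaming (refl to ≈-refl; sym to ≈-sym; trans to ≈-trans; Carrier to K; invertible to inv-exists)
  open Matrices F
  open Order F α generates
  open TransitionGraph using (Edge; no-loop)
  open GL using (matrix)

  -- Inverse generators are left to the symmetry of `Adj`. Entries are compared up to ≈, so the
  -- proof of invertibility stored in `g` is irrelevant.
  data Gen {n} (T : TransitionGraph n) (g : GL F n) : Set (c ⊔ ℓ) where
    adds   : ∀ x y → Edge T x y → (∀ i j → matrix g i j ≈ A F x y i j) → Gen T g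
    scales : ∀ x → 2 < q → (∀ i j → matrix g i j ≈ M F α x i j) → Gen T g

  edge≢ : ∀ {n} (T : TransitionGraph n) {x y} → Edge T x y → x ≢ y
  edge≢ T e x≡y = no-loop T x≡y e

  gen-addRow : ∀ {n} (T : TransitionGraph n) {x y} → Edge T x y → (x≢y : x ≢ y) → Gen T (Updates.addRow F n x y x≢y)
  gen-addRow {n} T {x} {y} e x≢y = adds x y e λ i j → ≈-sym (Updates.A≋addRow F n x y x≢y i j)

  gen-scale : ∀ {n} (T : TransitionGraph n) x → 2 < q → Gen T (Updates.scale F n x α α⁻¹ α⁻¹α)
  gen-scale {n} T x 2<q = scales x 2<q λ i j → ≈-sym (Updates.M≋scale F n x α α⁻¹ α⁻¹α i j)

  gen-embed : ∀ {k} (T : TransitionGraph (suc k)) {g} → Gen (deleteLast T) g → Gen T (Embedding.embed F k g)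
  gen-embed {k} T {g} (adds x y e g≈A) = adds (inject₁ x) (inject₁ y) e λ i j → ≈-trans
    (Embedding.extend-update F k (matrix g) x y 1# (λ i j → ≈-trans (g≈A i j) (≈-trans (Updates.A-entries F k x y (edge≢ (deleteLast T) e) i j) (+-congˡ (*-congˡ (≈-sym (*-identityˡ _)))))) i j)
    (≈-trans (+-congˡ (*-congˡ (*-identityˡ _))) (≈-sym (Updates.A-entries F (suc k) (inject₁ x) (inject₁ y) (edge≢ T e) i j)))
  gen-embed {k} T {g} (scales x 2<q g≈M) = scales (inject₁ x) 2<q λ i j → ≈-trans
    (Embedding.extend-update F k (matrix g) x x (α - 1#) (λ i j → ≈-trans (g≈M i j) (Updates.M-entries F k x α i j)) i j)
    (≈-sym (Updates.M-entries F (suc k) (inject₁ x) α i j))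

  Connected : ∀ n → TransitionGraph n → Set (c ⊔ ℓ)
  Connected n T = Cayley.HamConn (GLₙ.group n) (GLₙ._≟_ n) (Gen T) (λ _ → ⊤ {ℓ})

  module StepUp {k} (T : TransitionGraph (suc k)) where

    open GLₙ (suc k)
    open Updates F (suc k)
    open Embedding F k using (N≢inject₁; module Transport)
    private
      N : Fin (suc k)
      N = fromℕ k
    open Levels F (suc k) (Gen T) N
    open Unipotent F α generates (suc k) (Gen T) N using (Levi₁; levi₁ToLevi)
    open Group group using (ε) renaming (_≈_ to _≋_)
    open Cayley group _≟_ (Gen T) using (HamConn)

    private
      inner≢N : ∀ {i : Fin k} → inject₁ i ≢ N
      inner≢N = N≢inject₁ ∘ ≡.sym

      inner≢ : ∀ {i j : Fin k} → i ≢ j → inject₁ i ≢ inject₁ j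
      inner≢ i≢j = i≢j ∘ Fin.inject₁-injective

      zero-entry : ∀ {x y} (x≢y : x ≢ y) {i j} → i ≢ j → (x ≡ j → y ≡ i → ⊥) → entry (addRow x y x≢y) i j ≈ 0#
      zero-entry {x} {y} x≢y {i} {j} i≢j off = ≈-trans (addRow-entries x y x≢y i j)
        (≈-trans (+-cong (δ-diff i≢j) (by (x Fin.≟ j) (y Fin.≟ i))) (+-identityˡ 0#))
        where
        by : Dec (x ≡ j) → Dec (y ≡ i) → δ y i * δ x j ≈ 0#
        by (no x≢j)  _         = ≈-trans (*-congˡ (δ-diff x≢j)) (zeroʳ _)
        by (yes _)   (no y≢i)  = ≈-trans (*-congʳ (δ-diff y≢i)) (zeroˡ _)
        by (yes x≡j) (yes y≡i) = ⊥-elim (off x≡j y≡i)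

      ε≉addRow : ∀ {x y} (x≢y : x ≢ y) → ¬ ε ≋ addRow x y x≢y
      ε≉addRow {x} {y} x≢y e = 1≉0 (≈-trans (≈-sym (addRow-entry x≢y)) (≈-trans (≈-sym (e y x)) (δ-diff (x≢y ∘ ≡.sym))))

      addRow-distinct : ∀ {x y x′ y′} (x≢y : x ≢ y) (x′≢y′ : x′ ≢ y′) → (x′ ≡ x → y′ ≡ y → ⊥) → ¬ addRow x y x≢y ≋ addRow x′ y′ x′≢y′
      addRow-distinct {x} {y} x≢y x′≢y′ off e = 1≉0 (≈-trans (≈-sym (addRow-entry x≢y)) (≈-trans (e y x) (zero-entry x′≢y′ (x≢y ∘ ≡.sym) off)))

    levi₁-connected : Connected k (deleteLast T) → HamConn Levi₁
    levi₁-connected = Transport.embedded (Gen (deleteLast T)) (Gen T) (λ {g} → gen-embed T {g}) α generates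

    levi-connected : 2 < q → ∀ {a b : Fin k} → a ≢ b → HamConn Levi₁ → HamConn Levi
    levi-connected 2<q {a} {b} a≢b = levi₁ToLevi (gen-scale T N 2<q) (addRow x y x≢y) (addRow y x y≢x)
      (addRow-Levi x≢y inner≢N inner≢N , addRow-NN x≢y) (addRow-Levi y≢x inner≢N inner≢N , addRow-NN y≢x)
      (ε≉addRow x≢y) (ε≉addRow y≢x) (addRow-distinct x≢y y≢x λ y≡x _ → y≢x y≡x)
      where
      x y : Fin (suc k)
      x = inject₁ a
      y = inject₁ b
      x≢y = inner≢ a≢b
      y≢x = inner≢ (a≢b ∘ ≡.sym)
      addRow-NN : ∀ {i j : Fin k} (ne : inject₁ i ≢ inject₁ j) → entry (addRow (inject₁ i) (inject₁ j) ne) N N ≈ 1#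
      addRow-NN {i} {j} ne = ≈-trans (addRow-entries (inject₁ i) (inject₁ j) ne N N)
        (≈-trans (+-cong (δ-same N) (≈-trans (*-congʳ (δ-diff inner≢N)) (zeroˡ _))) (+-identityʳ 1#))

    -- With a single unit the factor GL(1) is trivial and the two subgroups coincide.
    levi-trivial : (∀ x → ¬ x ≈ 0# → x ≈ 1#) → HamConn Levi₁ → HamConn Levi
    levi-trivial unit≈1 hc = record
      { elems    = elems
      ; unique   = unique
      ; sound    = λ {v} v∈ → proj₁ (sound {v} v∈)
      ; complete = λ {v} L → complete {v} (lift v L)
      ; path     = λ {x} {y} Lx Ly → path {x} {y} (lift x Lx) (lift y Ly)
      }
      where
      open Cayley.HamConn hc
      lift : ∀ v → Levi v → Levi₁ v
      lift v L = L , unit≈1 (entry v N N) (inverse≉0 (corner {v} (proj₁ L)))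

    module _ {i : Fin k} (e : Edge T (inject₁ i) N) {l : Fin k} (l≢i : l ≢ i) where

      private
        x y : Fin (suc k)
        x = inject₁ i
        y = inject₁ l
        y≢x = inner≢ l≢i
        x≢y = inner≢ (l≢i ∘ ≡.sym)
        open LeviToStab (inner≢N {i}) (gen-addRow T e inner≢N)

        -- Two of the three parallel edges come from ε and A_xy. The third needs another operation
        -- on row y: a scaling if α ≠ 1, or an addition from a fourth index. For n = 3 and q = 2
        -- there is neither.
        stab-by : ∀ w → Levi w → Commutes w → ¬ ε ≋ w → ¬ addRow x y x≢y ≋ w → HamConn Levi → HamConn Stab
        stab-by w Lw Cw ε≉w u≉w = leviToStab (addRow y x y≢x) (addRow-Levi y≢x inner≢N inner≢N) (spread-addRow y≢x inner≢N)
          (addRow x y x≢y) w (addRow-Levi x≢y inner≢N inner≢N) Lw (commutes-addRow x≢y y≢x inner≢N) Cw (ε≉addRow x≢y) ε≉w u≉w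

      stab-connected : ¬ α ≈ 1# → HamConn Levi → HamConn Stab
      stab-connected α≉1 = stab-by (scale y α α⁻¹ α⁻¹α) (scale-Levi y α α⁻¹ α⁻¹α) (commutes-scale α α⁻¹ α⁻¹α y≢x inner≢N)
        (λ e → α≉1 (≈-trans (≈-sym (scale-corner y α α⁻¹ α⁻¹α)) (≈-trans (≈-sym (e y y)) (δ-same y))))
        (λ e → 1≉0 (≈-trans (≈-sym (addRow-entry x≢y)) (≈-trans (e y x) (scale-diagonal y α α⁻¹ α⁻¹α y≢x))))

      stab-connected′ : ∀ {l′ : Fin k} → l′ ≢ i → l′ ≢ l → HamConn Levi → HamConn Stab
      stab-connected′ {l′} l′≢i l′≢l = stab-by (addRow z y z≢y) (addRow-Levi z≢y inner≢N inner≢N) (commutes-addRow z≢y y≢x inner≢N)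
        (ε≉addRow z≢y) (addRow-distinct x≢y z≢y λ z≡x _ → inner≢ l′≢i z≡x)
        where
        z = inject₁ l′
        z≢y = inner≢ l′≢l

    top-connected : ∀ {j : Fin k} → Edge T N (inject₁ j) → ∀ {l : Fin k} → l ≢ j → HamConn Stab → Connected (suc k) T
    top-connected e l≢j = StabToTop.stabToTop≥3 N≢inject₁ (gen-addRow T e N≢inject₁) _ (inner≢ l≢j) inner≢N

private
  other : ∀ {k} (i : Fin (suc (suc k))) → ∃[ l ] l ≢ i
  other zero    = 1F , λ ()
  other (suc i) = 0F , λ ()

  two-others : ∀ {k} (i : Fin (suc (suc (suc k)))) → ∃₂ λ l l′ → l ≢ i × l′ ≢ i × l′ ≢ l
  two-others zero          = 1F , 2F , (λ ()) , (λ ()) , λ ()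
  two-others (suc zero)    = 0F , 2F , (λ ()) , (λ ()) , λ ()
  two-others (suc (suc i)) = 0F , 1F , (λ ()) , (λ ()) , λ ()

module Induction {c ℓ q} (F : FiniteField c ℓ q) (α : FiniteField.Carrier F) (generates : IsGenerator F α) where

  open FiniteField F hiding (zero) renaming (refl to ≈-refl; sym to ≈-sym; trans to ≈-trans; Carrier to K; invertible to inv-exists)
  open Exp semiring using (_^_; ^-congˡ)
  open Order F α generates
  open Generators F α generates
  open FieldSize F
  open Matrices F
  open GL using (matrix)

  α≉1 : 2 < q → ¬ α ≈ 1#
  α≉1 2<q α≈1 = ℕ.<⇒≱ 2<q (trivial-units λ x x≉0 →
    let (k , e) = proj₂ generates x x≉0 in ≈-trans e (≈-trans (^-congˡ k α≈1) (1^ k)))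

  plane : (T : TransitionGraph 2) → IsBypass T → 2 < q → Connected 2 T
  plane T ((0F , e) , (0F , e′) , _) 2<q = by m-1 refl
    where
    cover : ∀ (k : Fin 2) → 0F ≢ k → 1F ≢ k → ⊥
    cover 0F 0≢0 _ = 0≢0 refl
    cover 1F _ 1≢1 = 1≢1 refl
    by : ∀ l → m-1 ≡ l → Connected 2 T
    -- Order 1 would mean α = 1, which is excluded for q > 2.
    by zero    e₁ = ⊥-elim (α≉1 2<q (≈-trans (≈-sym (*-identityʳ α)) (subst (λ l → α ^ suc l ≈ 1#) e₁ α^m)))
    by (suc l) e₁ = PlaneConnected.planeTop F α generates 2 {0F} {1F} (λ ()) cover (Gen T) l (≡.cong suc e₁)
      (gen-addRow T e λ ()) (gen-scale T 0F 2<q) (gen-scale T 1F 2<q) (gen-addRow T e′ λ ())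

  space₂ : (T : TransitionGraph 3) → IsBypass T → q ≤ 2 → Connected 3 T
  space₂ T ((i , ei) , (j , ej) , (0F , e₀₁) , (0F , e₁₀) , _) q≤2 = StepUp.top-connected T ej (proj₂ (other j))
    (TwoElementField.stabPath F (units-trivial q≤2) (Gen T) i letter)
    where
    open BooleanModel using (source; target; source≢target)
    letter : ∀ o → Gen T (Updates.addRow F 3 (source i o) (target i o) (source≢target i o))
    letter 0F = gen-addRow T e₀₁ (source≢target i 0F)
    letter 1F = gen-addRow T e₁₀ (source≢target i 1F)
    letter 2F = gen-addRow T ei (source≢target i 2F)

  connected : ∀ k (T : TransitionGraph (suc (suc k))) → IsBypass T → (k ≡ 0 → 2 < q) → Connected (suc (suc k)) T
  connected zero    T b h = plane T b (h refl)
  connected (suc k) T b@((i , ei) , (j , ej) , b′) h = [ large , small k T b ]′ (ℕ.<-≤-connex 2 q)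
    where
    large : 2 < q → Connected (suc (suc (suc k))) T
    large 2<q = top-connected ej (proj₂ (other j)) (stab-connected ei (proj₂ (other i)) (α≉1 2<q)
      (levi-connected 2<q {0F} {1F} (λ ()) (levi₁-connected (connected k (deleteLast T) b′ λ _ → 2<q))))
      where open StepUp T
    small : ∀ k (T : TransitionGraph (suc (suc (suc k)))) → IsBypass T → q ≤ 2 → Connected (suc (suc (suc k))) T
    small zero    T b q≤2 = space₂ T b q≤2
    small (suc k) T ((i , ei) , (j , ej) , b′) q≤2 = let (l , l′ , l≢i , l′≢i , l′≢l) = two-others i in
      top-connected ej (proj₂ (other j)) (stab-connected′ ei l≢i l′≢i l′≢l
        (levi-trivial (units-trivial q≤2) (levi₁-connected (small k (deleteLast T) b′ q≤2))))
      where
      open StepUp T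

  module _ {n} (T : TransitionGraph n) where

    open GLₙ n
    open Cayley group _≟_ (Gen T) using (cayley; Adj)
    open Setoid (matrixSetoid F n) using () renaming (_≈_ to _≋ᴹ_)
    private V = GL-setoid F n

    private
      forward : ∀ g {X Y} → Gen T g → matrix Y ≋ᴹ _·_ F (matrix g) (matrix X) → Step F α T X Y
      forward g {X} (adds x y e g≈A)     p = A F x y , add e , ≋-trans p (·-cong {Y = matrix X} g≈A ≋-refl)
      forward g {X} (scales x 2<q g≈M)   p = M F α x , mult x 2<q , ≋-trans p (·-cong {Y = matrix X} g≈M ≋-refl)

      closure : ∀ {X Y} → Adj X Y → SymClosure (Step F α T) X Y
      closure {X} {Y} (g , Sg , inj₁ p) = fwd (forward g {X} {Y} Sg p)
      closure {X} {Y} (g , Sg , inj₂ p) = bwd (forward g {Y} {X} Sg p)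

    hamiltonConnected : Connected n T → HamiltonConnected (cayleyGraph F α T)
    hamiltonConnected hc X Y X≉Y = let (l , start , end , linked , l↭) = ExactEnds.exact cayley {elems} {X} {Y} X≉Y (path {X} {Y} tt tt X≉Y) in
      assemble l start end linked l↭
      where
      open Cayley.HamConn hc
      open Perm V using (_↭_; ↭-sym)
      assemble : ∀ l → head l ≡ just X → last l ≡ just Y → Linked Adj l → l ↭ elems → HamiltonPath (cayleyGraph F α T) X Y
      assemble l start end linked l↭ = record
        { path     = l
        ; start    = start
        ; end      = end
        -- Adjacency in the simple graph also demands distinct vertices; for consecutive vertices
        -- this follows from the absence of repetitions.
        ; adjacent = Linked.zipWith (λ {Z} {W} (Z≉W , a) → Z≉W , closure {Z} {W} a) (LinkedP.AllPairs⇒Linked distinct , linked)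
        ; distinct = distinct
        ; spanning = λ v → PermP.∈-resp-↭ V {v} (↭-sym l↭) (complete {v} tt)
        }
        where
        distinct : Uniq.Unique V l
        distinct = PermP.Unique-resp-↭ V (↭-sym l↭) unique

theorem1 : ∀ {c ℓ} (n q : ℕ) → 2 ≤ n → IsPrimePower q → (n ≡ 2 → 3 ≤ q) →
  (F : FiniteField c ℓ q) (α : FiniteField.Carrier F) → IsGenerator F α →
  (T : TransitionGraph n) → IsBypass T →
  HamiltonConnected (cayleyGraph F α T)
theorem1 (suc (suc k)) q (s≤s (s≤s _)) _ 3≤q F α generates T b = hamiltonConnected T (connected k T b λ k≡0 → 3≤q (≡.cong (λ k → suc (suc k)) k≡0))
  where open Induction F α generates
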